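{- Let $n\ge 3$ be odd, $d,R\in\mathbb{Q}$ with $d\ne0$ and $R$ not a square in $\mathbb{Q}$, $D=d^2-R$. Then $f_n=f_n(Z,d,R)$ is irreducible in $\mathbb{Q}[Z]$ if and only if, for every prime $p$ dividing $n$, the number $(d+\sqrt R)/(d-\sqrt R)$ is not a $p$th power in $\mathbb{Q}(\sqrt R)$.
   Context: For $k\ge1$, $F_k=\sum_{j=0}^{\lfloor k/2\rfloor}(-1)^j\frac{k}{k-j}\binom{k-j}{j}Z^{k-2j}$ (so $2\cos(kx)=F_k(2\cos x)$). For odd $n\ge3$, $d\ne0$, $R$ non-square, $D=d^2-R$: $$f_n(Z,d,R)=\sqrt D^{\,n}F_n(Z/\sqrt D)-2dD^{(n-1)/2}=\sum_{j=0}^{(n-1)/2}(-1)^j\frac{n}{n-j}\binom{n-j}{j}D^jZ^{n-2j}-2dD^{(n-1)/2}.$$ -}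

module Defs where

open import Algebra.Bundles.Raw using (RawSemiring)
import Algebra.Definitions.RawSemiring as RawSemiringDefs
open import Data.Fin.Base using (Fin; toℕ)
open import Data.Fin.Properties using (toℕ≤pred[n])
open import Data.Integer.Base using (+_)
open import Data.List.Base using (List; []; _∷_; map; replicate; _++_)
open import Data.Nat.Base as ℕ using (ℕ; zero; suc; _∸_)
open import Data.Nat.Combinatorics using (_C_)
open import Data.Nat.DivMod using (m/n≤m)
import Data.Nat.Properties as ℕ
open import Data.Product.Base using (∃-syntax; _,_)
open import Data.Rational.Base
  using (ℚ; 0ℚ; 1ℚ; _+_; _*_; _-_; -_; _/_; 1/_; NonZero; ≢-nonZero; +-*-rawSemiring)
open import Data.Rational.Properties
  using (_≟_; *-inverseˡ; *-inverseʳ; *-zeroʳ; *-assoc; *-identityˡ)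
open import Data.Rational.Solver using (module +-*-Solver)
open import Level using (0ℓ)
open import Relation.Binary.PropositionalEquality
open import Relation.Nullary using (¬_; yes; no)

module Polynomial {c ℓ} (S : RawSemiring c ℓ) where
  private module S = RawSemiring S

  -- Coefficient lists, constant term first. Trailing zeros are allowed, so
  -- equality of polynomials is _≈ₚ_ and not equality of lists.
  Poly : Set c
  Poly = List S.Carrier

  coeff : Poly → ℕ → S.Carrier
  coeff []      _       = S.0#
  coeff (a ∷ p) zero    = a
  coeff (a ∷ p) (suc i) = coeff p i

  infix 4 _≈ₚ_
  _≈ₚ_ : Poly → Poly → Set ℓ
  p ≈ₚ q = ∀ i → coeff p i S.≈ coeff q i

  infixl 6 _+ₚ_
  _+ₚ_ : Poly → Poly → Poly
  []      +ₚ q       = q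
  (a ∷ p) +ₚ []      = a ∷ p
  (a ∷ p) +ₚ (b ∷ q) = (a S.+ b) ∷ (p +ₚ q)

  infixl 7 _*ₚ_
  _*ₚ_ : Poly → Poly → Poly
  []      *ₚ q = []
  (a ∷ p) *ₚ q = map (a S.*_) q +ₚ (S.0# ∷ (p *ₚ q))

  monomial : S.Carrier → ℕ → Poly
  monomial a k = replicate k S.0# ++ (a ∷ [])

  polySemiring : RawSemiring c ℓ
  polySemiring = record
    { Carrier = Poly
    ; _≈_     = _≈ₚ_
    ; _+_     = _+ₚ_
    ; _*_     = _*ₚ_
    ; 0#      = []
    ; 1#      = S.1# ∷ []
    }

open Polynomial +-*-rawSemiring public
  renaming (Poly to ℚ[Z]; polySemiring to ℚ[Z]-rawSemiring)

open RawSemiringDefs +-*-rawSemiring using (_^_)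
open RawSemiringDefs ℚ[Z]-rawSemiring public using (Irreducible)
open RawSemiringDefs ℚ[Z]-rawSemiring using (sum)

-- The coefficient (-1)^j · k/(k-j) · binom(k-j, j) of Z^(k-2j) in F_k.
F-coeff : (k j : ℕ) → .{{ℕ.NonZero (k ∸ j)}} → ℚ
F-coeff k j = (- 1ℚ) ^ j * (+ k / (k ∸ j)) * (+ ((k ∸ j) C j) / 1)

private
  k∸j-nonZero : ∀ k → 3 ℕ.≤ k → (j : Fin (suc ((k ∸ 1) ℕ./ 2))) →
                ℕ.NonZero (k ∸ toℕ j)
  k∸j-nonZero (suc k) _ j = ℕ.>-nonZero
    (ℕ.m<n⇒0<n∸m (ℕ.s≤s (ℕ.≤-trans (toℕ≤pred[n] j) (m/n≤m k 2))))

-- Meaningful for odd n only.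
f : (n : ℕ) → .(3 ℕ.≤ n) → (d R : ℚ) → ℚ[Z]
f n 3≤n d R =
  sum (λ (j : Fin (suc m)) →
         monomial (F-coeff n (toℕ j) {{k∸j-nonZero n 3≤n j}} * D ^ toℕ j)
                  (n ∸ 2 ℕ.* toℕ j))
  +ₚ monomial (- ((+ 2 / 1) * d * D ^ m)) 0
  where
  m = (n ∸ 1) ℕ./ 2
  D = d * d - R

IsSquare : ℚ → Set
IsSquare R = ∃[ q ] q * q ≡ R

-- re + im √R. This is the field ℚ(√R) when R is not a square.
record ℚ⟨√_⟩ (R : ℚ) : Set where
  constructor _+_√
  field
    re im : ℚ

open ℚ⟨√_⟩ public

module _ {R : ℚ} where

  infixl 6 _+√_
  _+√_ : ℚ⟨√ R ⟩ → ℚ⟨√ R ⟩ → ℚ⟨√ R ⟩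
  (a + b √) +√ (c + e √) = (a + c) + (b + e) √

  infixl 7 _*√_
  _*√_ : ℚ⟨√ R ⟩ → ℚ⟨√ R ⟩ → ℚ⟨√ R ⟩
  (a + b √) *√ (c + e √) = (a * c + R * (b * e)) + (a * e + b * c) √

  0√ 1√ : ℚ⟨√ R ⟩
  0√ = 0ℚ + 0ℚ √
  1√ = 1ℚ + 0ℚ √

  norm : ℚ⟨√ R ⟩ → ℚ
  norm (a + b √) = a * a - R * (b * b)

ℚ⟨√_⟩-rawSemiring : ℚ → RawSemiring 0ℓ 0ℓ
ℚ⟨√ R ⟩-rawSemiring = record
  { Carrier = ℚ⟨√ R ⟩
  ; _≈_     = _≡_
  ; _+_     = _+√_
  ; _*_     = _*√_
  ; 0#      = 0√
  ; 1#      = 1√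
  }

module _ {R : ℚ} where
  open RawSemiringDefs ℚ⟨√ R ⟩-rawSemiring public using () renaming (_^_ to _^√_)

private
  square≡0 : ∀ a → a * a ≡ 0ℚ → a ≡ 0ℚ
  square≡0 a a²≡0 with a ≟ 0ℚ
  ... | yes a≡0 = a≡0
  ... | no  a≢0 = begin
      a              ≡⟨ *-identityˡ a ⟨
      1ℚ * a         ≡⟨ cong (_* a) (*-inverseˡ a) ⟨
      1/ a * a * a   ≡⟨ *-assoc (1/ a) a a ⟩
      1/ a * (a * a) ≡⟨ cong (1/ a *_) a²≡0 ⟩
      1/ a * 0ℚ      ≡⟨ *-zeroʳ (1/ a) ⟩
      0ℚ             ∎
    where
    open ≡-Reasoning
    instance _ = ≢-nonZero a≢0

norm≢0 : ∀ {R} → ¬ IsSquare R → {β : ℚ⟨√ R ⟩} → β ≢ 0√ → norm β ≢ 0ℚ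
norm≢0 {R} R≠□ {a + b √} β≢0 N≡0 with b ≟ 0ℚ
... | yes refl = β≢0 (cong (_+ 0ℚ √) (square≡0 a (trans (eq a R) N≡0)))
  where
  open +-*-Solver
  eq : ∀ a R → a * a ≡ a * a - R * (0ℚ * 0ℚ)
  eq = solve 2 (λ a R → a :* a := a :* a :- R :* (con 0ℚ :* con 0ℚ)) refl
... | no b≢0 = R≠□ (a * i , (begin
    a * i * (a * i)                                     ≡⟨ eq a b i R ⟩
    i * i * (a * a - R * (b * b)) + R * (b * i) * (b * i)
      ≡⟨ cong₂ (λ x y → i * i * x + R * y * y) N≡0 (*-inverseʳ b) ⟩
    i * i * 0ℚ + R * 1ℚ * 1ℚ                            ≡⟨ eq′ i R ⟩
    R                                                   ∎))
  where
  open ≡-Reasoning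
  open +-*-Solver
  instance _ = ≢-nonZero b≢0
  i = 1/ b
  eq : ∀ a b i R → a * i * (a * i) ≡ i * i * (a * a - R * (b * b)) + R * (b * i) * (b * i)
  eq = solve 4 (λ a b i R → a :* i :* (a :* i) :=
         i :* i :* (a :* a :- R :* (b :* b)) :+ R :* (b :* i) :* (b :* i)) refl
  eq′ : ∀ i R → i * i * 0ℚ + R * 1ℚ * 1ℚ ≡ R
  eq′ = solve 2 (λ i R → i :* i :* con 0ℚ :+ R :* con 1ℚ :* con 1ℚ := R) refl

inverse√ : ∀ {R} → .(¬ IsSquare R) → (β : ℚ⟨√ R ⟩) → .(β ≢ 0√) → ℚ⟨√ R ⟩
inverse√ R≠□ β β≢0 = (re β * N⁻¹) + (- im β * N⁻¹) √
  where
  N⁻¹ = (1/ norm β) {{≢-nonZero (norm≢0 R≠□ β≢0)}}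

inverse√-inverseʳ : ∀ {R} (R≠□ : ¬ IsSquare R) (β : ℚ⟨√ R ⟩) (β≢0 : β ≢ 0√) →
                    β *√ inverse√ R≠□ β β≢0 ≡ 1√
inverse√-inverseʳ {R} R≠□ β@(a + b √) β≢0 = cong₂ _+_√
    (trans (eq a b i R) (*-inverseʳ (norm β))) (eq′ a b i)
  where
  open +-*-Solver
  instance _ = ≢-nonZero (norm≢0 R≠□ β≢0)
  i = 1/ norm β
  eq : ∀ a b i R → a * (a * i) + R * (b * (- b * i)) ≡ (a * a - R * (b * b)) * i
  eq = solve 4 (λ a b i R → a :* (a :* i) :+ R :* (b :* (:- b :* i)) :=
         (a :* a :- R :* (b :* b)) :* i) refl
  eq′ : ∀ a b i → a * (- b * i) + b * (a * i) ≡ 0ℚ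
  eq′ = solve 3 (λ a b i → a :* (:- b :* i) :+ b :* (a :* i) := con 0ℚ) refl

-- (d + √R) / (d - √R)
conjugateRatio : (d R : ℚ) → .(¬ IsSquare R) → ℚ⟨√ R ⟩
conjugateRatio d R R≠□ =
  (d + 1ℚ √) *√ inverse√ R≠□ (d + (- 1ℚ) √) (λ eq → -1≢0 (cong im eq))
  where
  -1≢0 : - 1ℚ ≢ 0ℚ
  -1≢0 ()

{-# OPTIONS --safe #-}

-- Put D = αᾱ with α = d + √R and ρ = α/ᾱ, and let n = 2m + 1. With Z = u + D/u,
-- f(Z) = uⁿ + Dⁿ/uⁿ - 2dDᵐ vanishes iff uⁿ is Dᵐα or Dᵐᾱ, and Dᵐα is a p-th power in ℚ(√R)
-- (p | n) iff ρ is one.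
--
-- If ρ = γᵖ and n = kp, then Dᵐα = wᵖ with w w̄ = Dᵏ; so the Dickson polynomial of degree p takes
-- the value 2dDᵐ at the rational point w + w̄, and composing with the one of degree k shows that
-- D_k(Z) - (w + w̄) divides f.
--
-- Conversely let f = gh with 2 deg g < n. Then u^(deg g) g(u + D/u) is a polynomial in u of degree
-- below n. A root u of an irreducible factor of it generates a field containing a square root of R,
-- over which uⁿ = Dᵐα; but Xⁿ - Dᵐα is irreducible over ℚ(√R) by Capelli's theorem.
--
-- Capelli's theorem is proved by induction on n = pk: if y = xᵖ has degree k over S and x has degree
-- i < p over S[y], the constant term c of the minimal polynomial of x satisfies cᵖ = (-y)ⁱ, and
-- taking the norm from S[y] to S makes -a, hence a, a p-th power in S. Products over roots are
-- formed in splitting rings (iterated quotients A[X]/(monic)), which exist over any commutative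
-- ring and are not fields.
module Submission where

open import Algebra.Bundles using (CommutativeRing; CommutativeSemiring)
open import Algebra.Bundles.Raw using (RawMonoid; RawSemiring)
import Algebra.Definitions.RawMagma
import Algebra.Definitions.RawSemiring
import Algebra.Properties.AbelianGroup
import Algebra.Properties.CommutativeSemiring.Exp as Exp
import Algebra.Properties.Ring as RingProperties
import Algebra.Properties.Semiring.Mult.TCOptimised
import Algebra.Solver.Ring
open import Algebra.Solver.Ring.AlmostCommutativeRing
  using (fromCommutativeRing; _-Raw-AlmostCommutative⟶_)
open import Algebra.Structures using (IsCommutativeRing)
open import Data.Empty using (⊥; ⊥-elim)
open import Data.Fin.Base using (Fin; toℕ) renaming (zero to fzero; suc to fsuc)
open import Data.Fin.Properties using (toℕ≤pred[n])
open import Data.Integer.Base as ℤ using (ℤ; +_; -[1+_]; ∣_∣; sign; _◃_; _⊖_)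
import Data.Integer.Properties as ℤ
open import Data.List.Base using (List; []; _∷_; map; _++_; length; replicate; _∷ʳ_; initLast; _∷ʳ′_)
open import Data.List.Properties using (length-map; length-replicate; length-++)
open import Data.List.Relation.Unary.All as All using (All; []; _∷_)
open import Data.List.Relation.Unary.All.Properties using (++⁺; ∷ʳ⁻)
open import Data.Maybe.Base using (Maybe; just; nothing)
open import Data.Nat.Base as ℕ using (ℕ; zero; suc; z≤n; s≤s; _∸_; _≤_; _<_)
open import Data.Nat.Combinatorics using (nCk+nC[k+1]≡[n+1]C[k+1]; nC1≡n; k>n⇒nCk≡0) renaming (_C_ to _choose_)
open import Data.Nat.Coprimality using (coprime-Bézout; prime⇒coprime)
open import Data.Nat.Divisibility using (_∣_; divides; ∣-trans)
open import Data.Nat.DivMod using (m*n/n≡m; m/n≤m)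
open import Data.Nat.GCD using (module Bézout)
open import Data.Nat.ListAction using (product)
open import Data.Nat.ListAction.Properties using (∈⇒∣product)
open import Data.Nat.Primality using (Prime; prime⇒nonZero; prime⇒nonTrivial; productOfPrimes≥1)
open import Data.Nat.Primality.Factorisation using (PrimeFactorisation; factorise)
import Data.Nat.Properties as ℕ
open import Data.Nat.Solver using () renaming (module +-*-Solver to ℕSolver)
open import Data.Product.Base using (_,_; _×_; proj₁; proj₂; ∃-syntax)
open import Data.Rational.Base as ℚ using (ℚ; 0ℚ; 1ℚ; toℚᵘ)
import Data.Rational.Properties as ℚ
open import Data.Rational.Unnormalised.Base as ℚᵘ using (mkℚᵘ; *≡*)
import Data.Rational.Unnormalised.Properties as ℚᵘ
open import Data.Sign.Base as Sign using (Sign)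
open import Data.Sum.Base using (_⊎_; inj₁; inj₂)
open import Data.Unit.Base using (⊤; tt)
import Defs
open import Function.Bundles using (_⇔_; mk⇔)
open import Level using (0ℓ)
open import Relation.Binary.PropositionalEquality as ≡ using (_≡_; _≢_)
import Relation.Binary.Reasoning.Setoid as ≈-Reasoning
open import Relation.Nullary using (¬_; yes; no)

-- The norm and constant-term arguments only compare products over all roots with elements of the
-- base, so it is enough that the base injects into some ring where the polynomial is a product of
-- linear factors; the quotient by a monic polynomial of positive degree always keeps that
-- injectivity. Irreducible factors, likewise, are found only up to double negation, which is
-- harmless because the absence of a small factor is a negative claim. The two possible values of
-- `uⁿ` cause no case distinction: √R is not fixed beforehand but read off from u as `uⁿ/Dᵐ - d`,
-- and this choice makes `uⁿ` the conjugate written with α. The bound `2 deg g < n` is the price of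
-- a substitution that doubles degrees. Oddness of n makes -1 a p-th power for each p dividing n,
-- which removes the sign between a and -a and the exceptional case of Capelli's theorem at
-- exponents divisible by 4.

CRing : Set₁
CRing = CommutativeRing 0ℓ 0ℓ

-- Integer coefficients let the solver cancel terms in rings without decidable equality.
module IntegerSolver (A : CRing) where
  open CommutativeRing A
  open RingProperties ring
  open Algebra.Properties.AbelianGroup +-abelianGroup using (⁻¹-∙-comm)
  open Algebra.Properties.Semiring.Mult.TCOptimised semiring
    using (1+×; ×-homo-+; ×1-homo-*) renaming (_×_ to _·_)
  open ≈-Reasoning setoid

  private
    -- The optimised multiple makes `1 · 1#` reduce to `1#`, so that `con (+ 1)` matches a literal
    -- `1#` in a goal.
    ⟦_⟧ℤ : ℤ → Carrier
    ⟦ + n      ⟧ℤ = n · 1#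
    ⟦ -[1+ n ] ⟧ℤ = - (suc n · 1#)

    ⊖-homo : ∀ m n → ⟦ m ⊖ n ⟧ℤ ≈ m · 1# - n · 1#
    ⊖-homo zero    zero    = sym (-‿inverseʳ 0#)
    ⊖-homo zero    (suc n) = sym (+-identityˡ _)
    ⊖-homo (suc m) zero    = sym (trans (+-congˡ -0#≈0#) (+-identityʳ _))
    ⊖-homo (suc m) (suc n) = begin
      ⟦ suc m ⊖ suc n ⟧ℤ ≡⟨ ≡.cong ⟦_⟧ℤ (ℤ.[1+m]⊖[1+n]≡m⊖n m n) ⟩
      ⟦ m ⊖ n ⟧ℤ ≈⟨ ⊖-homo m n ⟩
      m · 1# - n · 1# ≈⟨ +-congʳ (+-identityˡ _) ⟨
      0# + m · 1# - n · 1# ≈⟨ +-congʳ (+-congʳ (-‿inverseʳ 1#)) ⟨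
      1# - 1# + m · 1# - n · 1# ≈⟨ +-congʳ (+-assoc _ _ _) ⟩
      1# + (- 1# + m · 1#) - n · 1# ≈⟨ +-congʳ (+-congˡ (+-comm _ _)) ⟩
      1# + (m · 1# - 1#) - n · 1# ≈⟨ +-congʳ (+-assoc _ _ _) ⟨
      1# + m · 1# - 1# - n · 1# ≈⟨ +-assoc _ _ _ ⟩
      1# + m · 1# + (- 1# - n · 1#) ≈⟨ +-congˡ (⁻¹-∙-comm _ _) ⟩
      (1# + m · 1#) - (1# + n · 1#) ≈⟨ +-cong (1+× m 1#) (-‿cong (1+× n 1#)) ⟨
      suc m · 1# - suc n · 1# ∎

    -- Integer multiplication is defined through signs and absolute values; its homomorphism law is
    -- split in the same way.
    signed : Sign → Carrier → Carrier
    signed Sign.+ x = x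
    signed Sign.- x = - x

    ◃-homo : ∀ s n → ⟦ s ◃ n ⟧ℤ ≈ signed s (n · 1#)
    ◃-homo Sign.+ zero    = refl
    ◃-homo Sign.- zero    = sym -0#≈0#
    ◃-homo Sign.+ (suc n) = refl
    ◃-homo Sign.- (suc n) = refl

    signed-cong : ∀ s {x y} → x ≈ y → signed s x ≈ signed s y
    signed-cong Sign.+ = λ eq → eq
    signed-cong Sign.- = -‿cong

    signed-* : ∀ s t x y → signed (s Sign.* t) (x * y) ≈ signed s x * signed t y
    signed-* Sign.+ Sign.+ x y = refl
    signed-* Sign.+ Sign.- x y = -‿distribʳ-* x y
    signed-* Sign.- Sign.+ x y = -‿distribˡ-* x y
    signed-* Sign.- Sign.- x y = begin
      x * y ≈⟨ -‿involutive _ ⟨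
      - - (x * y) ≈⟨ -‿cong (-‿distribˡ-* x y) ⟩
      - (- x * y) ≈⟨ -‿distribʳ-* (- x) y ⟩
      - x * - y ∎

    signed-abs : ∀ i → ⟦ i ⟧ℤ ≡ signed (sign i) (∣ i ∣ · 1#)
    signed-abs (+ zero)  = ≡.refl
    signed-abs (+ suc n) = ≡.refl
    signed-abs -[1+ n ]  = ≡.refl

    +-homo : ∀ i j → ⟦ i ℤ.+ j ⟧ℤ ≈ ⟦ i ⟧ℤ + ⟦ j ⟧ℤ
    +-homo (+ m)    (+ n)    = ×-homo-+ 1# m n
    +-homo (+ m)    -[1+ n ] = ⊖-homo m (suc n)
    +-homo -[1+ m ] (+ n)    = trans (⊖-homo n (suc m)) (+-comm _ _)
    +-homo -[1+ m ] -[1+ n ] = begin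
      - (suc (suc (m ℕ.+ n)) · 1#) ≡⟨ ≡.cong (λ k → - (suc k · 1#)) (≡.sym (ℕ.+-suc m n)) ⟩
      - ((suc m ℕ.+ suc n) · 1#) ≈⟨ -‿cong (×-homo-+ 1# (suc m) (suc n)) ⟩
      - (suc m · 1# + suc n · 1#) ≈⟨ ⁻¹-∙-comm _ _ ⟨
      - (suc m · 1#) - suc n · 1# ∎


    *-homo : ∀ i j → ⟦ i ℤ.* j ⟧ℤ ≈ ⟦ i ⟧ℤ * ⟦ j ⟧ℤ
    *-homo i j = begin
      ⟦ s Sign.* t ◃ (m ℕ.* n) ⟧ℤ ≈⟨ ◃-homo (s Sign.* t) (m ℕ.* n) ⟩
      signed (s Sign.* t) ((m ℕ.* n) · 1#) ≈⟨ signed-cong (s Sign.* t) (×1-homo-* m n) ⟩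
      signed (s Sign.* t) (m · 1# * n · 1#) ≈⟨ signed-* s t _ _ ⟩
      signed s (m · 1#) * signed t (n · 1#) ≡⟨ ≡.cong₂ _*_ (signed-abs i) (signed-abs j) ⟨
      ⟦ i ⟧ℤ * ⟦ j ⟧ℤ ∎
      where
      s = sign i
      t = sign j
      m = ∣ i ∣
      n = ∣ j ∣

    -‿homo : ∀ i → ⟦ ℤ.- i ⟧ℤ ≈ - ⟦ i ⟧ℤ
    -‿homo (+ zero)  = sym -0#≈0#
    -‿homo (+ suc n) = refl
    -‿homo -[1+ n ]  = sym (-‿involutive _)

    morphism : ℤ.+-*-rawRing -Raw-AlmostCommutative⟶ fromCommutativeRing A
    morphism = record
      { ⟦_⟧    = ⟦_⟧ℤ
      ; +-homo = +-homo
      ; *-homo = *-homo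
      ; -‿homo = -‿homo
      ; 0-homo = refl
      ; 1-homo = refl
      }

    ≟-weak : ∀ i j → Maybe (⟦ i ⟧ℤ ≈ ⟦ j ⟧ℤ)
    ≟-weak i j with i ℤ.≟ j
    ... | yes eq = just (reflexive (≡.cong ⟦_⟧ℤ eq))
    ... | no  _  = nothing

  open Algebra.Solver.Ring ℤ.+-*-rawRing (fromCommutativeRing A) morphism ≟-weak public
    using (solve; _:=_; _:+_; _:*_; _:-_; :-_; con)

-- Polynomials

record Hom (A B : CRing) : Set where
  private
    module A = CommutativeRing A
    module B = CommutativeRing B
  field
    ⟦_⟧    : A.Carrier → B.Carrier
    cong   : ∀ {x y} → x A.≈ y → ⟦ x ⟧ B.≈ ⟦ y ⟧
    +-homo : ∀ x y → ⟦ x A.+ y ⟧ B.≈ ⟦ x ⟧ B.+ ⟦ y ⟧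
    *-homo : ∀ x y → ⟦ x A.* y ⟧ B.≈ ⟦ x ⟧ B.* ⟦ y ⟧
    1-homo : ⟦ A.1# ⟧ B.≈ B.1#

  open ≈-Reasoning B.setoid
  open RingProperties B.ring using (x+x≈x⇒x≈0)
  open Algebra.Properties.AbelianGroup B.+-abelianGroup using () renaming (∙-cancelʳ to +-cancelʳ)

  0-homo : ⟦ A.0# ⟧ B.≈ B.0#
  0-homo = x+x≈x⇒x≈0 _ (B.trans (B.sym (+-homo _ _)) (cong (A.+-identityˡ _)))

  -‿homo : ∀ x → ⟦ A.- x ⟧ B.≈ B.- ⟦ x ⟧
  -‿homo x = +-cancelʳ ⟦ x ⟧ _ _ (begin
    ⟦ A.- x ⟧ B.+ ⟦ x ⟧ ≈⟨ +-homo _ _ ⟨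
    ⟦ A.- x A.+ x ⟧ ≈⟨ cong (A.-‿inverseˡ x) ⟩
    ⟦ A.0# ⟧ ≈⟨ 0-homo ⟩
    B.0# ≈⟨ B.-‿inverseˡ _ ⟨
    B.- ⟦ x ⟧ B.+ ⟦ x ⟧ ∎)

  private
    module A^ = Exp A.commutativeSemiring
    module B^ = Exp B.commutativeSemiring

  ^-homo : ∀ x n → ⟦ x A^.^ n ⟧ B.≈ ⟦ x ⟧ B^.^ n
  ^-homo x zero    = 1-homo
  ^-homo x (suc n) = B.trans (*-homo _ _) (B.*-congˡ (^-homo x n))

  Injective : Set
  Injective = ∀ {x} → ⟦ x ⟧ B.≈ B.0# → x A.≈ A.0#

  injective : Injective → ∀ {x y} → ⟦ x ⟧ B.≈ ⟦ y ⟧ → x A.≈ y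
  injective inj {x} {y} eq = x∙y⁻¹≈ε⇒x≈y x y (inj (begin
    ⟦ x A.- y ⟧ ≈⟨ +-homo _ _ ⟩
    ⟦ x ⟧ B.+ ⟦ A.- y ⟧ ≈⟨ B.+-cong eq (-‿homo y) ⟩
    ⟦ y ⟧ B.- ⟦ y ⟧ ≈⟨ B.-‿inverseʳ _ ⟩
    B.0# ∎))
    where open RingProperties A.ring using (x∙y⁻¹≈ε⇒x≈y)

idHom : ∀ {A} → Hom A A
idHom {A} = record
  { ⟦_⟧ = λ x → x ; cong = λ eq → eq ; +-homo = λ _ _ → refl ; *-homo = λ _ _ → refl ; 1-homo = refl }
  where open CommutativeRing A using (refl)

infixr 9 _∘ʰ_
_∘ʰ_ : ∀ {A B C} → Hom B C → Hom A B → Hom A C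
_∘ʰ_ {A} {B} {C} ψ φ = record
  { ⟦_⟧    = λ x → ψ.⟦ φ.⟦ x ⟧ ⟧
  ; cong   = λ eq → ψ.cong (φ.cong eq)
  ; +-homo = λ x y → trans (ψ.cong (φ.+-homo x y)) (ψ.+-homo _ _)
  ; *-homo = λ x y → trans (ψ.cong (φ.*-homo x y)) (ψ.*-homo _ _)
  ; 1-homo = trans (ψ.cong φ.1-homo) ψ.1-homo
  }
  where
  module φ = Hom φ
  module ψ = Hom ψ
  open CommutativeRing C using (trans)

-- The coefficient sequence turns _*ₚ_ into the Cauchy product of sequences, for which the
-- ring laws are proved.
module CauchyProduct (A : CRing) where
  open CommutativeRing A
  open ≈-Reasoning setoid
  open IntegerSolver A

  Seq : Set
  Seq = ℕ → Carrier

  infix 4 _≈ˢ_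
  _≈ˢ_ : Seq → Seq → Set
  f ≈ˢ g = ∀ i → f i ≈ g i

  tail : Seq → Seq
  tail f i = f (suc i)

  _⊛_ : Seq → Seq → Seq
  (f ⊛ g) zero    = f 0 * g 0
  (f ⊛ g) (suc i) = f 0 * g (suc i) + (tail f ⊛ g) i

  ⊛-cong : ∀ {f f′ g g′} → f ≈ˢ f′ → g ≈ˢ g′ → f ⊛ g ≈ˢ f′ ⊛ g′
  ⊛-cong f≈ g≈ zero    = *-cong (f≈ 0) (g≈ 0)
  ⊛-cong f≈ g≈ (suc i) =
    +-cong (*-cong (f≈ 0) (g≈ (suc i))) (⊛-cong (λ j → f≈ (suc j)) g≈ i)

  ⊛-zeroˡ : ∀ g → (λ _ → 0#) ⊛ g ≈ˢ (λ _ → 0#)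
  ⊛-zeroˡ g zero    = zeroˡ _
  ⊛-zeroˡ g (suc i) = trans (+-cong (zeroˡ _) (⊛-zeroˡ g i)) (+-identityˡ _)

  ⊛-distribʳ : ∀ f g h → (λ i → f i + g i) ⊛ h ≈ˢ (λ i → (f ⊛ h) i + (g ⊛ h) i)
  ⊛-distribʳ f g h zero    = distribʳ _ _ _
  ⊛-distribʳ f g h (suc i) = trans (+-congˡ (⊛-distribʳ (tail f) (tail g) h i))
    (solve 5 (λ a b c x y → (a :+ b) :* c :+ (x :+ y) := a :* c :+ x :+ (b :* c :+ y)) refl
      (f 0) (g 0) (h (suc i)) _ _)

  ⊛-scaleˡ : ∀ a f g → (λ i → a * f i) ⊛ g ≈ˢ (λ i → a * (f ⊛ g) i)
  ⊛-scaleˡ a f g zero    = *-assoc _ _ _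
  ⊛-scaleˡ a f g (suc i) = trans (+-congˡ (⊛-scaleˡ a (tail f) g i))
    (solve 4 (λ a b c x → a :* b :* c :+ a :* x := a :* (b :* c :+ x)) refl a (f 0) (g (suc i)) _)

  -- The mirror image of the defining recursion, peeling the second factor; commutativity follows by
  -- comparing the two.
  ⊛-sucʳ : ∀ f g i → (f ⊛ g) (suc i) ≈ f (suc i) * g 0 + (f ⊛ tail g) i
  ⊛-sucʳ f g zero    = +-comm _ _
  ⊛-sucʳ f g (suc i) = trans (+-congˡ (⊛-sucʳ (tail f) g i))
    (solve 3 (λ a b c → a :+ (b :+ c) := b :+ (a :+ c)) refl _ _ _)

  ⊛-comm : ∀ f g → f ⊛ g ≈ˢ g ⊛ f
  ⊛-comm f g zero    = *-comm _ _
  ⊛-comm f g (suc i) = trans (⊛-sucʳ f g i) (+-cong (*-comm _ _) (⊛-comm f (tail g) i))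

  ⊛-assoc : ∀ f g h → (f ⊛ g) ⊛ h ≈ˢ f ⊛ (g ⊛ h)
  ⊛-assoc f g h zero    = *-assoc _ _ _
  ⊛-assoc f g h (suc i) = begin
    f 0 * g 0 * h (suc i) + ((λ j → f 0 * g (suc j) + (tail f ⊛ g) j) ⊛ h) i
      ≈⟨ +-congˡ (⊛-distribʳ _ _ h i) ⟩
    f 0 * g 0 * h (suc i) + (((λ j → f 0 * g (suc j)) ⊛ h) i + ((tail f ⊛ g) ⊛ h) i)
      ≈⟨ +-congˡ (+-cong (⊛-scaleˡ (f 0) (tail g) h i) (⊛-assoc (tail f) g h i)) ⟩
    f 0 * g 0 * h (suc i) + (f 0 * (tail g ⊛ h) i + (tail f ⊛ (g ⊛ h)) i)
      ≈⟨ solve 5 (λ a b c x y → a :* b :* c :+ (a :* x :+ y) := a :* (b :* c :+ x) :+ y) refl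
           (f 0) (g 0) (h (suc i)) _ _ ⟩
    f 0 * (g 0 * h (suc i) + (tail g ⊛ h) i) + (tail f ⊛ (g ⊛ h)) i ∎

module PolynomialRing (A : CRing) where
  open CommutativeRing A
  open ≈-Reasoning setoid
  open CauchyProduct A
  open RingProperties ring using (-0#≈0#)
  open Defs.Polynomial (CommutativeSemiring.rawSemiring commutativeSemiring) public using (Poly; coeff; _≈ₚ_; _+ₚ_; _*ₚ_)

  infix 8 -ₚ_
  -ₚ_ : Poly → Poly
  -ₚ_ = map (λ a → - a)

  coeff-+ : ∀ p q i → coeff (p +ₚ q) i ≈ coeff p i + coeff q i
  coeff-+ []      q       i       = sym (+-identityˡ _)
  coeff-+ (a ∷ p) []      i       = sym (+-identityʳ _)
  coeff-+ (a ∷ p) (b ∷ q) zero    = refl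
  coeff-+ (a ∷ p) (b ∷ q) (suc i) = coeff-+ p q i

  coeff-scale : ∀ a p i → coeff (map (a *_) p) i ≈ a * coeff p i
  coeff-scale a []      i       = sym (zeroʳ a)
  coeff-scale a (b ∷ p) zero    = refl
  coeff-scale a (b ∷ p) (suc i) = coeff-scale a p i

  coeff-neg : ∀ p i → coeff (-ₚ p) i ≈ - coeff p i
  coeff-neg []      i       = sym -0#≈0#
  coeff-neg (b ∷ p) zero    = refl
  coeff-neg (b ∷ p) (suc i) = coeff-neg p i

  coeff-* : ∀ p q → coeff (p *ₚ q) ≈ˢ coeff p ⊛ coeff q
  coeff-* []      q i       = sym (⊛-zeroˡ (coeff q) i)
  coeff-* (a ∷ p) q zero    = begin
    coeff (map (a *_) q +ₚ (0# ∷ p *ₚ q)) 0 ≈⟨ coeff-+ (map (a *_) q) _ 0 ⟩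
    coeff (map (a *_) q) 0 + 0# ≈⟨ +-identityʳ _ ⟩
    coeff (map (a *_) q) 0 ≈⟨ coeff-scale a q 0 ⟩
    a * coeff q 0 ∎
  coeff-* (a ∷ p) q (suc i) = begin
    coeff (map (a *_) q +ₚ (0# ∷ p *ₚ q)) (suc i) ≈⟨ coeff-+ (map (a *_) q) _ (suc i) ⟩
    coeff (map (a *_) q) (suc i) + coeff (p *ₚ q) i ≈⟨ +-cong (coeff-scale a q (suc i)) (coeff-* p q i) ⟩
    a * coeff q (suc i) + (coeff p ⊛ coeff q) i ∎


  *-zeroˡ′ : ∀ p q → p ≈ₚ [] → p *ₚ q ≈ₚ []
  *-zeroˡ′ p q p≈0 i =
    trans (coeff-* p q i) (trans (⊛-cong p≈0 (λ _ → refl) i) (⊛-zeroˡ (coeff q) i))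

  *ₚ-comm : ∀ p q → p *ₚ q ≈ₚ q *ₚ p
  *ₚ-comm p q i = trans (coeff-* p q i)
    (trans (⊛-comm (coeff p) (coeff q) i) (sym (coeff-* q p i)))

  *ₚ-identityˡ : ∀ p → (1# ∷ []) *ₚ p ≈ₚ p
  *ₚ-identityˡ p zero    = trans (coeff-* (1# ∷ []) p 0) (*-identityˡ _)
  *ₚ-identityˡ p (suc i) = begin
    coeff ((1# ∷ []) *ₚ p) (suc i) ≈⟨ coeff-* (1# ∷ []) p (suc i) ⟩
    1# * coeff p (suc i) + ((λ _ → 0#) ⊛ coeff p) i ≈⟨ +-cong (*-identityˡ _) (⊛-zeroˡ (coeff p) i) ⟩
    coeff p (suc i) + 0# ≈⟨ +-identityʳ _ ⟩
    coeff p (suc i) ∎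

  *ₚ-distribʳ : ∀ p q r → (q +ₚ r) *ₚ p ≈ₚ q *ₚ p +ₚ r *ₚ p
  *ₚ-distribʳ p q r i = begin
    coeff ((q +ₚ r) *ₚ p) i ≈⟨ coeff-* (q +ₚ r) p i ⟩
    (coeff (q +ₚ r) ⊛ coeff p) i ≈⟨ ⊛-cong (coeff-+ q r) (λ _ → refl) i ⟩
    ((λ i → coeff q i + coeff r i) ⊛ coeff p) i ≈⟨ ⊛-distribʳ (coeff q) (coeff r) (coeff p) i ⟩
    (coeff q ⊛ coeff p) i + (coeff r ⊛ coeff p) i ≈⟨ +-cong (coeff-* q p i) (coeff-* r p i) ⟨
    coeff (q *ₚ p) i + coeff (r *ₚ p) i ≈⟨ coeff-+ (q *ₚ p) (r *ₚ p) i ⟨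
    coeff (q *ₚ p +ₚ r *ₚ p) i ∎

  *ₚ-assoc : ∀ p q r → p *ₚ q *ₚ r ≈ₚ p *ₚ (q *ₚ r)
  *ₚ-assoc p q r i = begin
    coeff (p *ₚ q *ₚ r) i ≈⟨ coeff-* (p *ₚ q) r i ⟩
    (coeff (p *ₚ q) ⊛ coeff r) i ≈⟨ ⊛-cong (coeff-* p q) (λ _ → refl) i ⟩
    ((coeff p ⊛ coeff q) ⊛ coeff r) i ≈⟨ ⊛-assoc (coeff p) (coeff q) (coeff r) i ⟩
    (coeff p ⊛ (coeff q ⊛ coeff r)) i ≈⟨ ⊛-cong (λ _ → refl) (coeff-* q r) i ⟨
    (coeff p ⊛ coeff (q *ₚ r)) i ≈⟨ coeff-* p (q *ₚ r) i ⟨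
    coeff (p *ₚ (q *ₚ r)) i ∎

  private
    *ₚ-cong : ∀ {p p′ q q′} → p ≈ₚ p′ → q ≈ₚ q′ → p *ₚ q ≈ₚ p′ *ₚ q′
    *ₚ-cong {p} {p′} {q} {q′} p≈ q≈ i =
      trans (coeff-* p q i) (trans (⊛-cong p≈ q≈ i) (sym (coeff-* p′ q′ i)))

    +ₚ-cong : ∀ {p p′ q q′} → p ≈ₚ p′ → q ≈ₚ q′ → p +ₚ q ≈ₚ p′ +ₚ q′
    +ₚ-cong {p} {p′} {q} {q′} p≈ q≈ i =
      trans (coeff-+ p q i) (trans (+-cong (p≈ i) (q≈ i)) (sym (coeff-+ p′ q′ i)))

    +ₚ-assoc : ∀ p q r → p +ₚ q +ₚ r ≈ₚ p +ₚ (q +ₚ r)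
    +ₚ-assoc p q r i = begin
      coeff (p +ₚ q +ₚ r) i ≈⟨ trans (coeff-+ (p +ₚ q) r i) (+-congʳ (coeff-+ p q i)) ⟩
      coeff p i + coeff q i + coeff r i ≈⟨ +-assoc _ _ _ ⟩
      coeff p i + (coeff q i + coeff r i) ≈⟨ trans (coeff-+ p (q +ₚ r) i) (+-congˡ (coeff-+ q r i)) ⟨
      coeff (p +ₚ (q +ₚ r)) i ∎

    +ₚ-comm : ∀ p q → p +ₚ q ≈ₚ q +ₚ p
    +ₚ-comm p q i = trans (coeff-+ p q i) (trans (+-comm _ _) (sym (coeff-+ q p i)))

    -ₚ-cong : ∀ {p q} → p ≈ₚ q → -ₚ p ≈ₚ -ₚ q
    -ₚ-cong {p} {q} p≈ i = trans (coeff-neg p i) (trans (-‿cong (p≈ i)) (sym (coeff-neg q i)))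

    +ₚ-identityʳ : ∀ p → p +ₚ [] ≈ₚ p
    +ₚ-identityʳ p i = trans (coeff-+ p [] i) (+-identityʳ _)

    -ₚ-inverseˡ : ∀ p → -ₚ p +ₚ p ≈ₚ []
    -ₚ-inverseˡ p i = trans (coeff-+ (-ₚ p) p i) (trans (+-congʳ (coeff-neg p i)) (-‿inverseˡ _))

  -- A record, unlike the function type _≈ₚ_, lets Agda infer the two polynomials.
  infix 4 _≋_
  record _≋_ (p q : Poly) : Set where
    constructor ⟨_⟩
    field at : p ≈ₚ q
  open _≋_ public

  polyRing : CRing
  polyRing = record
    { Carrier = Poly
    ; _≈_     = _≋_
    ; _+_     = _+ₚ_
    ; _*_     = _*ₚ_
    ; -_      = -ₚ_
    ; 0#      = []
    ; 1#      = 1# ∷ []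
    ; isCommutativeRing = record
      { isRing = record
        { +-isAbelianGroup = record
          { isGroup = record
            { isMonoid = record
              { isSemigroup = record
                { isMagma = record
                  { isEquivalence = record
                    { refl  = ⟨ (λ _ → refl) ⟩
                    ; sym   = λ eq → ⟨ (λ i → sym (at eq i)) ⟩
                    ; trans = λ eq eq′ → ⟨ (λ i → trans (at eq i) (at eq′ i)) ⟩
                    }
                  ; ∙-cong = λ {p} {p′} {q} {q′} eq eq′ → ⟨ +ₚ-cong {p} {p′} {q} {q′} (at eq) (at eq′) ⟩
                  }
                ; assoc = λ p q r → ⟨ +ₚ-assoc p q r ⟩
                }
              ; identity = (λ _ → ⟨ (λ _ → refl) ⟩) , (λ p → ⟨ +ₚ-identityʳ p ⟩)
              }
            ; inverse = (λ p → ⟨ -ₚ-inverseˡ p ⟩)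
                      , (λ p → ⟨ (λ i → trans (+ₚ-comm p (-ₚ p) i) (-ₚ-inverseˡ p i)) ⟩)
            ; ⁻¹-cong = λ {p} {q} eq → ⟨ -ₚ-cong {p} {q} (at eq) ⟩
            }
          ; comm = λ p q → ⟨ +ₚ-comm p q ⟩
          }
        ; *-cong     = λ {p} {p′} {q} {q′} eq eq′ → ⟨ *ₚ-cong {p} {p′} {q} {q′} (at eq) (at eq′) ⟩
        ; *-assoc    = λ p q r → ⟨ *ₚ-assoc p q r ⟩
        ; *-identity = (λ p → ⟨ *ₚ-identityˡ p ⟩)
                     , (λ p → ⟨ (λ i → trans (*ₚ-comm p (1# ∷ []) i) (*ₚ-identityˡ p i)) ⟩)
        ; distrib    = (λ p q r → ⟨ (λ i → trans (*ₚ-comm p (q +ₚ r) i) (trans (*ₚ-distribʳ p q r i)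
                         (+ₚ-cong {q *ₚ p} {p *ₚ q} {r *ₚ p} {p *ₚ r} (*ₚ-comm q p) (*ₚ-comm r p) i))) ⟩)
                     , (λ p q r → ⟨ *ₚ-distribʳ p q r ⟩)
        }
      ; *-comm = λ p q → ⟨ *ₚ-comm p q ⟩
      }
    }

  X : Poly
  X = 0# ∷ 1# ∷ []

  const : Hom A polyRing
  const = record
    { ⟦_⟧    = λ a → a ∷ []
    ; cong   = λ eq → ⟨ (λ { zero → eq ; (suc i) → refl }) ⟩
    ; +-homo = λ a b → ⟨ (λ { zero → refl ; (suc i) → refl }) ⟩
    ; *-homo = λ a b → ⟨ (λ { zero → sym (+-identityʳ _) ; (suc i) → refl }) ⟩
    ; 1-homo = ⟨ (λ _ → refl) ⟩
    }

module Evaluation {A B : CRing} (φ : Hom A B) where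
  open PolynomialRing A
  private
    module A = CommutativeRing A
    module φ = Hom φ
  open CommutativeRing B
  open ≈-Reasoning setoid
  open IntegerSolver B

  -- Coefficients pass through `φ` only during evaluation, so a polynomial over A is evaluated in
  -- any A-algebra without rewriting its coefficient list.
  ev : Poly → Carrier → Carrier
  ev []      z = 0#
  ev (a ∷ p) z = φ.⟦ a ⟧ + z * ev p z

  ev-zero : ∀ p z → p ≈ₚ [] → ev p z ≈ 0#
  ev-zero []      z p≈0 = refl
  ev-zero (a ∷ p) z p≈0 = begin
    φ.⟦ a ⟧ + z * ev p z
      ≈⟨ +-cong (trans (φ.cong (p≈0 0)) φ.0-homo) (*-congˡ (ev-zero p z (λ i → p≈0 (suc i)))) ⟩
    0# + z * 0# ≈⟨ trans (+-identityˡ _) (zeroʳ z) ⟩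
    0# ∎

  ev-cong : ∀ p q {z w} → p ≈ₚ q → z ≈ w → ev p z ≈ ev q w
  ev-cong []      q       p≈q z≈w = sym (ev-zero q _ (λ i → A.sym (p≈q i)))
  ev-cong (a ∷ p) []      p≈q z≈w = ev-zero (a ∷ p) _ p≈q
  ev-cong (a ∷ p) (b ∷ q) p≈q z≈w =
    +-cong (φ.cong (p≈q 0)) (*-cong z≈w (ev-cong p q (λ i → p≈q (suc i)) z≈w))

  ev-+ : ∀ p q z → ev (p +ₚ q) z ≈ ev p z + ev q z
  ev-+ []      q       z = sym (+-identityˡ _)
  ev-+ (a ∷ p) []      z = sym (+-identityʳ _)
  ev-+ (a ∷ p) (b ∷ q) z = trans (+-cong (φ.+-homo a b) (*-congˡ (ev-+ p q z)))
    (solve 5 (λ a b z x y → (a :+ b) :+ z :* (x :+ y) := a :+ z :* x :+ (b :+ z :* y)) refl _ _ z _ _)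

  ev-scale : ∀ a p z → ev (map (a A.*_) p) z ≈ φ.⟦ a ⟧ * ev p z
  ev-scale a []      z = sym (zeroʳ _)
  ev-scale a (b ∷ p) z = trans (+-cong (φ.*-homo a b) (*-congˡ (ev-scale a p z)))
    (solve 4 (λ a b z x → a :* b :+ z :* (a :* x) := a :* (b :+ z :* x)) refl _ _ z _)

  ev-* : ∀ p q z → ev (p *ₚ q) z ≈ ev p z * ev q z
  ev-* []      q z = sym (zeroˡ _)
  ev-* (a ∷ p) q z = begin
    ev (map (a A.*_) q +ₚ (A.0# ∷ p *ₚ q)) z ≈⟨ ev-+ (map (a A.*_) q) _ z ⟩
    ev (map (a A.*_) q) z + (φ.⟦ A.0# ⟧ + z * ev (p *ₚ q) z)
      ≈⟨ +-cong (ev-scale a q z) (+-cong φ.0-homo (*-congˡ (ev-* p q z))) ⟩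
    φ.⟦ a ⟧ * ev q z + (0# + z * (ev p z * ev q z))
      ≈⟨ solve 4 (λ a z x y → a :* y :+ (con (+ 0) :+ z :* (x :* y)) := (a :+ z :* x) :* y) refl _ z _ _ ⟩
    (φ.⟦ a ⟧ + z * ev p z) * ev q z ∎


  ev-const : ∀ a z → ev (a ∷ []) z ≈ φ.⟦ a ⟧
  ev-const a z = trans (+-congˡ (zeroʳ z)) (+-identityʳ _)

  ev-X : ∀ z → ev X z ≈ z
  ev-X z = begin
    φ.⟦ A.0# ⟧ + z * ev (A.1# ∷ []) z ≈⟨ +-cong φ.0-homo (*-congˡ (trans (ev-const A.1# z) φ.1-homo)) ⟩
    0# + z * 1# ≈⟨ trans (+-identityˡ _) (*-identityʳ z) ⟩
    z ∎

  evHom : Carrier → Hom polyRing B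
  evHom z = record
    { ⟦_⟧    = λ p → ev p z
    ; cong   = λ {p} {q} eq → ev-cong p q (at eq) refl
    ; +-homo = λ p q → ev-+ p q z
    ; *-homo = λ p q → ev-* p q z
    ; 1-homo = trans (ev-const A.1# z) φ.1-homo
    }

open Evaluation public using (ev)

ev-hom : ∀ {A B C} (ψ : Hom B C) (φ : Hom A B) p z →
         let open CommutativeRing C in Hom.⟦ ψ ⟧ (ev φ p z) ≈ ev (ψ ∘ʰ φ) p (Hom.⟦ ψ ⟧ z)
ev-hom {C = C} ψ φ []      z = Hom.0-homo ψ
ev-hom {C = C} ψ φ (a ∷ p) z = trans (ψ.+-homo _ _) (+-congˡ
  (trans (ψ.*-homo _ _) (*-congˡ (ev-hom ψ φ p z))))
  where
  module ψ = Hom ψ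
  open CommutativeRing C

-- Composites that differ by reassociation or by `idHom` agree pointwise without being the same
-- record; this bridges them.
ev-agree : ∀ {A B} (φ ψ : Hom A B) → let open CommutativeRing B in
           (∀ a → Hom.⟦ φ ⟧ a ≈ Hom.⟦ ψ ⟧ a) → ∀ p z → ev φ p z ≈ ev ψ p z
ev-agree {B = B} φ ψ eq []      z = CommutativeRing.refl B
ev-agree {B = B} φ ψ eq (a ∷ p) z = +-cong (eq a) (*-congˡ (ev-agree φ ψ eq p z))
  where open CommutativeRing B

module _ (A : CRing) where
  open CommutativeRing A
  open PolynomialRing A
  private module P = CommutativeRing polyRing

  X-* : ∀ p → X *ₚ p ≋ 0# ∷ p
  at (X-* p) zero    = trans (coeff-* X p 0) (zeroˡ _)
  at (X-* p) (suc i) = trans (coeff-+ (map (0# *_) p) _ (suc i))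
    (trans (+-cong (trans (coeff-scale 0# p (suc i)) (zeroˡ _)) (*ₚ-identityˡ p i)) (+-identityˡ _))

  private
    snoc : ∀ a p → (a ∷ []) +ₚ (0# ∷ p) ≋ a ∷ p
    at (snoc a p) zero    = +-identityʳ a
    at (snoc a p) (suc i) = refl

  ∷-≋ : ∀ a p → a ∷ p ≋ (a ∷ []) +ₚ X *ₚ p
  ∷-≋ a p = P.sym (P.trans (P.+-congˡ {a ∷ []} (X-* p)) (snoc a p))

  -- `X` is the generic point: an identity between values that holds in every A-algebra becomes an
  -- identity of polynomials.
  ev-generic : ∀ p → ev const p X ≋ p
  ev-generic []      = P.refl
  ev-generic (a ∷ p) =
    P.trans (P.+-congˡ {a ∷ []} (P.*-congˡ {X} (ev-generic p))) (P.sym (∷-≋ a p))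

-- Splitting rings

module Monic (A : CRing) where
  open CommutativeRing A
  open PolynomialRing A
  open IntegerSolver A
  open ≈-Reasoning setoid

  IsMonic : ℕ → Poly → Set
  IsMonic k p = coeff p k ≈ 1# × (∀ {i} → k < i → coeff p i ≈ 0#)

  -- Monic polynomials are represented by the list of their lower coefficients.
  M : List Carrier → Poly
  M q = q ++ 1# ∷ []

  M-isMonic : ∀ q → IsMonic (length q) (M q)
  M-isMonic []      = refl , λ { (s≤s _) → refl }
  M-isMonic (a ∷ q) = proj₁ (M-isMonic q) , λ { (s≤s k<i) → proj₂ (M-isMonic q) k<i }

  IsMonic-resp : ∀ {k p q} → p ≋ q → IsMonic k p → IsMonic k q
  IsMonic-resp p≋q (lead , top) =
    trans (sym (at p≋q _)) lead , λ k<i → trans (sym (at p≋q _)) (top k<i)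

  takeCoeffs : ℕ → Poly → List Carrier
  takeCoeffs zero    p       = []
  takeCoeffs (suc k) []      = 0# ∷ takeCoeffs k []
  takeCoeffs (suc k) (a ∷ p) = a ∷ takeCoeffs k p

  length-takeCoeffs : ∀ k p → length (takeCoeffs k p) ≡ k
  length-takeCoeffs zero    p       = ≡.refl
  length-takeCoeffs (suc k) []      = ≡.cong suc (length-takeCoeffs k [])
  length-takeCoeffs (suc k) (a ∷ p) = ≡.cong suc (length-takeCoeffs k p)

  IsMonic⇒M : ∀ k p → IsMonic k p → M (takeCoeffs k p) ≋ p
  IsMonic⇒M zero    p       (lead , top) =
    ⟨ (λ { zero → sym lead ; (suc i) → sym (top (s≤s z≤n)) }) ⟩
  IsMonic⇒M (suc k) []      (lead , top) =
    ⟨ (λ { zero → refl ; (suc i) → at (IsMonic⇒M k [] (lead , λ _ → refl)) i }) ⟩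
  IsMonic⇒M (suc k) (a ∷ p) (lead , top) =
    ⟨ (λ { zero → refl ; (suc i) → at (IsMonic⇒M k p (lead , λ k<i → top (s≤s k<i))) i }) ⟩

  coeff-∷* : ∀ a t p i → coeff ((a ∷ t) *ₚ p) i ≈ a * coeff p i + coeff (0# ∷ t *ₚ p) i
  coeff-∷* a t p i = trans (coeff-+ (map (a *_) p) _ i) (+-congʳ (coeff-scale a p i))

  -- A leading coefficient 1 annihilates nothing, so over any ring a nonzero multiple shows a
  -- nonzero coefficient in some degree at least k. The tail of the cofactor is treated before its
  -- constant term, whose contribution in degree k is visible only once the tail has vanished.
  monic-multiple : ∀ {k p} → IsMonic k p → ∀ t →
                   (∀ {i} → k ≤ i → coeff (t *ₚ p) i ≈ 0#) → t ≋ []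
  monic-multiple                 mon          []      low = ⟨ (λ _ → refl) ⟩
  monic-multiple {k} {p} mon@(lead , top) (a ∷ t) low = ⟨ (λ { zero → a≈0 ; (suc i) → at t≋[] i }) ⟩
    where
    t≋[] : t ≋ []
    t≋[] = monic-multiple {k} {p} mon t (λ {i} k≤i → begin
      coeff (t *ₚ p) i ≈⟨ +-identityˡ _ ⟨
      0# + coeff (t *ₚ p) i ≈⟨ +-congʳ (trans (*-congˡ (top (s≤s k≤i))) (zeroʳ a)) ⟨
      a * coeff p (suc i) + coeff (t *ₚ p) i ≈⟨ coeff-∷* a t p (suc i) ⟨
      coeff ((a ∷ t) *ₚ p) (suc i) ≈⟨ low (ℕ.m≤n⇒m≤1+n k≤i) ⟩
      0# ∎)
    shifted : ∀ i → coeff (0# ∷ t *ₚ p) i ≈ 0#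
    shifted zero    = refl
    shifted (suc i) = *-zeroˡ′ t p (at t≋[]) i
    a≈0 : a ≈ 0#
    a≈0 = begin
      a ≈⟨ solve 1 (λ a → a := a :* con (+ 1) :+ con (+ 0)) refl a ⟩
      a * 1# + 0# ≈⟨ +-cong (*-congˡ lead) (shifted k) ⟨
      a * coeff p k + coeff (0# ∷ t *ₚ p) k ≈⟨ coeff-∷* a t p k ⟨
      coeff ((a ∷ t) *ₚ p) k ≈⟨ low ℕ.≤-refl ⟩
      0# ∎

open Monic public using (M)

module _ {A B : CRing} (φ : Hom A B) where
  private
    module A = CommutativeRing A
    module φ = Hom φ
  open CommutativeRing B

  ev-M-map : ∀ {C} (ψ : Hom B C) q z → let module C = CommutativeRing C in
             ev ψ (M B (map φ.⟦_⟧ q)) z C.≈ ev (ψ ∘ʰ φ) (M A q) z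
  ev-M-map {C} ψ []      z = C.+-congʳ (Hom.cong ψ (sym φ.1-homo))
    where module C = CommutativeRing C
  ev-M-map {C} ψ (a ∷ q) z = C.+-congˡ (C.*-congˡ (ev-M-map ψ q z))
    where module C = CommutativeRing C

module QuotientRing (A : CRing) (p : CommutativeRing.Carrier A) where
  open CommutativeRing A
  open IntegerSolver A

  infix 4 _∼_
  -- The carrier stays the same and equality stores its cofactor, so facts about the quotient are
  -- identities of the original ring.
  record _∼_ (x y : Carrier) : Set where
    constructor modulo
    field
      factor   : Carrier
      equation : x ≈ y + factor * p

  private
    lift : ∀ {x y} → x ≈ y → x ∼ y
    lift eq = modulo 0# (trans eq (solve 2 (λ y p → y := y :+ con (+ 0) :* p) refl _ p))

    ∼-trans : ∀ {x y z} → x ∼ y → y ∼ z → x ∼ z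
    ∼-trans (modulo s eq) (modulo t eq′) = modulo (s + t) (trans eq (trans (+-congʳ eq′)
      (solve 4 (λ z s t p → z :+ t :* p :+ s :* p := z :+ (s :+ t) :* p) refl _ s t p)))

    ∼-sym : ∀ {x y} → x ∼ y → y ∼ x
    ∼-sym {x} {y} (modulo s eq) = modulo (- s) (trans
      (solve 3 (λ y s p → y := y :+ s :* p :+ (:- s) :* p) refl y s p) (+-congʳ (sym eq)))

    +-cong′ : ∀ {x x′ y y′} → x ∼ x′ → y ∼ y′ → x + y ∼ x′ + y′
    +-cong′ (modulo s eq) (modulo t eq′) = modulo (s + t) (trans (+-cong eq eq′)
      (solve 5 (λ x y s t p → x :+ s :* p :+ (y :+ t :* p) := x :+ y :+ (s :+ t) :* p) refl _ _ s t p))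

    *-cong′ : ∀ {x x′ y y′} → x ∼ x′ → y ∼ y′ → x * y ∼ x′ * y′
    *-cong′ {x} {x′} {y} {y′} (modulo s eq) (modulo t eq′) =
      modulo (s * y′ + x′ * t + s * t * p) (trans (*-cong eq eq′)
        (solve 5 (λ x y s t p → (x :+ s :* p) :* (y :+ t :* p) :=
          x :* y :+ (s :* y :+ x :* t :+ s :* t :* p) :* p) refl x′ y′ s t p))

    neg-cong′ : ∀ {x y} → x ∼ y → - x ∼ - y
    neg-cong′ (modulo s eq) = modulo (- s) (trans (-‿cong eq)
      (solve 3 (λ y s p → :- (y :+ s :* p) := :- y :+ (:- s) :* p) refl _ s p))

  quotientRing : CRing
  quotientRing = record
    { Carrier = Carrier
    ; _≈_     = _∼_
    ; _+_     = _+_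
    ; _*_     = _*_
    ; -_      = λ x → - x
    ; 0#      = 0#
    ; 1#      = 1#
    ; isCommutativeRing = record
      { isRing = record
        { +-isAbelianGroup = record
          { isGroup = record
            { isMonoid = record
              { isSemigroup = record
                { isMagma = record
                  { isEquivalence = record { refl = lift refl ; sym = ∼-sym ; trans = ∼-trans }
                  ; ∙-cong        = +-cong′
                  }
                ; assoc = λ x y z → lift (+-assoc x y z)
                }
              ; identity = (λ x → lift (+-identityˡ x)) , (λ x → lift (+-identityʳ x))
              }
            ; inverse = (λ x → lift (-‿inverseˡ x)) , (λ x → lift (-‿inverseʳ x))
            ; ⁻¹-cong = neg-cong′
            }
          ; comm = λ x y → lift (+-comm x y)
          }
        ; *-cong     = *-cong′
        ; *-assoc    = λ x y z → lift (*-assoc x y z)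
        ; *-identity = (λ x → lift (*-identityˡ x)) , (λ x → lift (*-identityʳ x))
        ; distrib    = (λ x y z → lift (distribˡ x y z)) , (λ x y z → lift (distribʳ x y z))
        }
      ; *-comm = λ x y → lift (*-comm x y)
      }
    }

  projection : Hom A quotientRing
  projection = record
    { ⟦_⟧    = λ x → x
    ; cong   = lift
    ; +-homo = λ _ _ → lift refl
    ; *-homo = λ _ _ → lift refl
    ; 1-homo = lift refl
    }

module Adjoin (A : CRing) (q : List (CommutativeRing.Carrier A)) where
  private module A = CommutativeRing A
  open PolynomialRing A
  private module P = CommutativeRing polyRing
  open QuotientRing polyRing (M A q)

  extension : CRing
  extension = quotientRing

  open CommutativeRing extension

  embedding : Hom A extension
  embedding = projection ∘ʰ const

  root : Carrier
  root = X

  root-eq : ev embedding (M A q) root ≈ 0#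
  root-eq = trans (sym (ev-hom projection const (M A q) X))
    (modulo P.1# (P.trans (ev-generic A (M A q)) (P.sym (P.*-identityˡ (M A q)))))

  -- A constant has no coefficient in degree `length q` or above when that degree is positive, so
  -- `monic-multiple` forces the cofactor to vanish.
  embedding-injective : 0 < length q → Hom.Injective embedding
  embedding-injective 0<k {a} (modulo t eq) = A.trans (at eq 0) (*-zeroˡ′ t (M A q) (at t≋[]) 0)
    where
    t≋[] : t ≋ []
    t≋[] = Monic.monic-multiple A (Monic.M-isMonic A q) t
      λ { {zero} k≤0 → ⊥-elim (ℕ.<⇒≱ 0<k k≤0) ; {suc i} _ → A.sym (at eq (suc i)) }


module SyntheticDivision {B : CRing} (β : CommutativeRing.Carrier B) where
  open CommutativeRing B

  -- Synthetic division by `X - β`: the lower coefficients of the quotient are the Horner values at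
  -- β of the successive tails, and the leading 1 stays implicit. The value at the empty list is a
  -- default, since 1 has no monic quotient.
  quotient : List Carrier → List Carrier
  quotient []              = []
  quotient (a ∷ [])        = []
  quotient (a ∷ q@(_ ∷ _)) = ev (idHom {B}) (M B q) β ∷ quotient q

  length-quotient : ∀ a q → length (quotient (a ∷ q)) ≡ length q
  length-quotient a []      = ≡.refl
  length-quotient a (b ∷ q) = ≡.cong suc (length-quotient b q)

  quotient-spec : ∀ {C} (ψ : Hom B C) a q x → let module C = CommutativeRing C in
    ev ψ (M B (a ∷ q)) x C.≈
      (x C.- Hom.⟦ ψ ⟧ β) C.* ev ψ (M B (quotient (a ∷ q))) x C.+ Hom.⟦ ψ ⟧ (ev (idHom {B}) (M B (a ∷ q)) β)
  quotient-spec {C} ψ a [] x = begin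
      ψ.⟦ a ⟧ C.+ x C.* u
    ≈⟨ solve 4 (λ a x u b → a :+ x :* u := (x :- b) :* u :+ (a :+ b :* u)) C.refl ψ.⟦ a ⟧ x u ψ.⟦ β ⟧ ⟩
      (x C.- ψ.⟦ β ⟧) C.* u C.+ (ψ.⟦ a ⟧ C.+ ψ.⟦ β ⟧ C.* u)
    ≈⟨ C.+-congˡ (C.+-congˡ (C.*-congˡ u≈)) ⟩
      (x C.- ψ.⟦ β ⟧) C.* u C.+ (ψ.⟦ a ⟧ C.+ ψ.⟦ β ⟧ C.* ψ.⟦ 1# + β * 0# ⟧)
    ≈⟨ C.+-congˡ (C.trans (C.+-congˡ (C.sym (ψ.*-homo _ _))) (C.sym (ψ.+-homo _ _))) ⟩
      (x C.- ψ.⟦ β ⟧) C.* u C.+ ψ.⟦ a + β * (1# + β * 0#) ⟧ ∎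
    where
    module C = CommutativeRing C
    module ψ = Hom ψ
    open IntegerSolver C
    open ≈-Reasoning C.setoid
    u : C.Carrier
    u = ψ.⟦ 1# ⟧ C.+ x C.* C.0#
    u≈ : u C.≈ ψ.⟦ 1# + β * 0# ⟧
    u≈ = C.trans (C.trans (C.+-congˡ (C.zeroʳ x)) (C.+-identityʳ _))
           (ψ.cong (sym (trans (+-congˡ (zeroʳ β)) (+-identityʳ 1#))))
  quotient-spec {C} ψ a q@(b ∷ q′) x = begin
      ψ.⟦ a ⟧ C.+ x C.* ev ψ (M B q) x
    ≈⟨ C.+-congˡ (C.*-congˡ (quotient-spec ψ b q′ x)) ⟩
      ψ.⟦ a ⟧ C.+ x C.* ((x C.- ψ.⟦ β ⟧) C.* Q C.+ ψ.⟦ r ⟧)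
    ≈⟨ solve 5 (λ a x b q r → a :+ x :* ((x :- b) :* q :+ r) := (x :- b) :* (r :+ x :* q) :+ (a :+ b :* r))
         C.refl ψ.⟦ a ⟧ x ψ.⟦ β ⟧ Q ψ.⟦ r ⟧ ⟩
      (x C.- ψ.⟦ β ⟧) C.* (ψ.⟦ r ⟧ C.+ x C.* Q) C.+ (ψ.⟦ a ⟧ C.+ ψ.⟦ β ⟧ C.* ψ.⟦ r ⟧)
    ≈⟨ C.+-congˡ (C.trans (C.+-congˡ (C.sym (ψ.*-homo _ _))) (C.sym (ψ.+-homo _ _))) ⟩
      (x C.- ψ.⟦ β ⟧) C.* (ψ.⟦ r ⟧ C.+ x C.* Q) C.+ ψ.⟦ a + β * r ⟧ ∎
    where
    module C = CommutativeRing C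
    module ψ = Hom ψ
    open IntegerSolver C
    open ≈-Reasoning C.setoid
    Q : C.Carrier
    Q = ev ψ (M B (quotient q)) x
    r : Carrier
    r = ev (idHom {B}) (M B q) β

module _ {E C : CRing} (ψ : Hom E C) where
  private module ψ = Hom ψ
  open CommutativeRing C

  linearProduct : List (CommutativeRing.Carrier E) → Carrier → Carrier
  linearProduct []       x = 1#
  linearProduct (b ∷ bs) x = (x - ψ.⟦ b ⟧) * linearProduct bs x

-- The factorisation is demanded at every point of every E-algebra instead of as an identity of
-- polynomials over E, so it can be carried into further extensions as it stands.
Splits : ∀ {A E} → Hom A E → List (CommutativeRing.Carrier A) → List (CommutativeRing.Carrier E) → Set₁
Splits {A} {E} φ q bs = ∀ {C} (ψ : Hom E C) x →
  let open CommutativeRing C in ev (ψ ∘ʰ φ) (M A q) x ≈ linearProduct ψ bs x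

record SplittingRing {A : CRing} (q : List (CommutativeRing.Carrier A)) : Set₁ where
  field
    ring         : CRing
    φ            : Hom A ring
    φ-injective  : Hom.Injective φ
    roots        : List (CommutativeRing.Carrier ring)
    length-roots : length roots ≡ length q
    splits       : Splits φ q roots

splittingRing : ∀ {A} (q : List (CommutativeRing.Carrier A)) → SplittingRing {A} q
splittingRing {A} q = go (length q) q ≡.refl
  where
  -- The ring grows together with the shrinking quotient, so the recursion runs on the degree with
  -- `A` generalised.
  go : ∀ n {A} (q : List (CommutativeRing.Carrier A)) → length q ≡ n → SplittingRing {A} q
  go zero {A} [] _ = record
    { ring         = A
    ; φ            = idHom {A}
    ; φ-injective  = λ eq → eq
    ; roots        = []
    ; length-roots = ≡.refl
    ; splits       = λ {C} ψ x → let open CommutativeRing C in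
        trans (+-cong (Hom.1-homo ψ) (zeroʳ x)) (+-identityʳ 1#)
    }
  go (suc n) {A} q@(a ∷ q′) |q|≡1+n = record
    { ring         = ring
    ; φ            = φ ∘ʰ embedding
    ; φ-injective  = λ eq → embedding-injective (s≤s z≤n) (φ-injective eq)
    ; roots        = Hom.⟦ φ ⟧ root ∷ roots
    ; length-roots = ≡.cong suc (≡.trans length-roots (≡.trans |Q|≡n (≡.sym (ℕ.suc-injective |q|≡1+n))))
    ; splits       = splits′
    }
    where
    open Adjoin A q
    open Hom embedding using (⟦_⟧)
    module E = CommutativeRing extension
    open SyntheticDivision {extension} root
    Q : List E.Carrier
    Q = quotient (map ⟦_⟧ q)
    |Q|≡n : length Q ≡ n
    |Q|≡n = ≡.trans (length-quotient ⟦ a ⟧ (map ⟦_⟧ q′))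
              (≡.trans (length-map ⟦_⟧ q′) (ℕ.suc-injective |q|≡1+n))
    open SplittingRing (go n {extension} Q |Q|≡n)
    splits′ : Splits (φ ∘ʰ embedding) q (Hom.⟦ φ ⟧ root ∷ roots)
    splits′ {C} ψ x = begin
      ev (ψ ∘ʰ (φ ∘ʰ embedding)) (M A q) x
        ≈⟨ ev-agree (ψ ∘ʰ (φ ∘ʰ embedding)) (χ ∘ʰ embedding) (λ _ → C.refl) (M A q) x ⟩
      ev (χ ∘ʰ embedding) (M A q) x ≈⟨ ev-M-map embedding χ q x ⟨
      ev χ (M extension (map ⟦_⟧ q)) x ≈⟨ quotient-spec χ ⟦ a ⟧ (map ⟦_⟧ q′) x ⟩
      (x C.- Hom.⟦ χ ⟧ root) C.* ev χ (M extension Q) x C.+ Hom.⟦ χ ⟧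
        (ev (idHom {extension}) (M extension (map ⟦_⟧ q)) root)
        ≈⟨ C.+-cong (C.*-congˡ (splits ψ x)) (C.trans (Hom.cong χ root-eq′) (Hom.0-homo χ)) ⟩
      (x C.- Hom.⟦ χ ⟧ root) C.* linearProduct ψ roots x C.+ C.0#
        ≈⟨ C.+-identityʳ _ ⟩
      (x C.- Hom.⟦ χ ⟧ root) C.* linearProduct ψ roots x ∎
      where
      module C = CommutativeRing C
      open ≈-Reasoning C.setoid
      χ : Hom extension C
      χ = ψ ∘ʰ φ
      root-eq′ : ev (idHom {extension}) (M extension (map ⟦_⟧ q)) root E.≈ E.0#
      root-eq′ = E.trans (ev-M-map embedding (idHom {extension}) q root) (E.trans
        (ev-agree (idHom {extension} ∘ʰ embedding) embedding (λ _ → E.refl) (M A q) root) root-eq)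

-- Fields

-- Deciding whether an element is zero belongs to the structure: normalisation and Euclid's
-- algorithm branch on it, and `zeroOrInverse-mod` passes it on to the quotient by an irreducible
-- polynomial.
record DiscreteField : Set₁ where
  field
    𝔽 : CRing
  open CommutativeRing 𝔽 public
  field
    1≉0            : ¬ 1# ≈ 0#
    zeroOrInverse  : ∀ x → x ≈ 0# ⊎ (∃[ y ] x * y ≈ 1#)

-- A predicate instead of a ring of its own: S and S[y] then share the carrier of `F`, all
-- arithmetic takes place in `F`, and only the membership of coefficients is tracked.
record Subfield (F : DiscreteField) : Set₁ where
  open DiscreteField F
  infix 4 _∈S
  field
    _∈S    : Carrier → Set
    resp   : ∀ {x y} → x ≈ y → x ∈S → y ∈S
    1-∈    : 1# ∈S
    +-∈    : ∀ {x y} → x ∈S → y ∈S → x + y ∈S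
    *-∈    : ∀ {x y} → x ∈S → y ∈S → x * y ∈S
    neg-∈  : ∀ {x} → x ∈S → - x ∈S
    inv-∈  : ∀ {x y} → x * y ≈ 1# → x ∈S → y ∈S

whole : ∀ F → Subfield F
whole F = record
  { _∈S = λ _ → ⊤ ; resp = λ _ _ → tt ; 1-∈ = tt ; +-∈ = λ _ _ → tt ; *-∈ = λ _ _ → tt
  ; neg-∈ = λ _ → tt ; inv-∈ = λ _ _ → tt }

fieldHom-injective : ∀ (F : DiscreteField) {B} (φ : Hom (DiscreteField.𝔽 F) B) →
                     let open CommutativeRing B in ¬ 1# ≈ 0# → Hom.Injective φ
fieldHom-injective F {B} φ 1≉0 {x} φx≈0 with DiscreteField.zeroOrInverse F x
... | inj₁ x≈0        = x≈0
... | inj₂ (y , xy≈1) = ⊥-elim (1≉0 (trans (sym φ.1-homo) (trans (φ.cong (F.sym xy≈1))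
        (trans (φ.*-homo x y) (trans (*-congʳ φx≈0) (zeroˡ _))))))
  where
  open CommutativeRing B
  module φ = Hom φ
  module F = DiscreteField F

record RootExtension {A : CRing} (p : PolynomialRing.Poly A) : Set₁ where
  field
    extensionField : DiscreteField
  open DiscreteField extensionField
  field
    φ       : Hom A 𝔽
    root    : Carrier
    root-eq : ev φ p root ≈ 0#

module Field (F : DiscreteField) where
  open DiscreteField F
  open PolynomialRing 𝔽
  open Exp commutativeSemiring using (_^_; ^-distrib-*; ^-congˡ)
  private module P = CommutativeRing polyRing

  field-product : ∀ {x y} → x * y ≈ 0# → x ≈ 0# ⊎ y ≈ 0#
  field-product {x} {y} xy≈0 with zeroOrInverse x
  ... | inj₁ x≈0         = inj₁ x≈0
  ... | inj₂ (x′ , xx′≈1) = inj₂ (begin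
      y ≈⟨ *-identityˡ y ⟨
      1# * y ≈⟨ *-congʳ xx′≈1 ⟨
      x * x′ * y ≈⟨ solve 3 (λ x x′ y → x :* x′ :* y := x :* y :* x′) refl x x′ y ⟩
      x * y * x′ ≈⟨ *-congʳ xy≈0 ⟩
      0# * x′ ≈⟨ zeroˡ x′ ⟩
      0# ∎)
    where
    open ≈-Reasoning setoid
    open IntegerSolver 𝔽

  field-power : ∀ {x} n → x ^ n ≈ 0# → x ≈ 0#
  field-power zero    1≈0 = ⊥-elim (1≉0 1≈0)
  field-power (suc n) eq with field-product eq
  ... | inj₁ x≈0  = x≈0
  ... | inj₂ xⁿ≈0 = field-power n xⁿ≈0

  module _ (S : Subfield F) where
    open Subfield S

    0-∈ : 0# ∈S
    0-∈ = resp (-‿inverseʳ 1#) (+-∈ 1-∈ (neg-∈ 1-∈))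

    ^-∈ : ∀ {x} n → x ∈S → x ^ n ∈S
    ^-∈ zero    x∈ = 1-∈
    ^-∈ (suc n) x∈ = *-∈ x∈ (^-∈ n x∈)

    M-∈ : ∀ {q} → All _∈S q → All _∈S (M 𝔽 q)
    M-∈ q∈ = ++⁺ q∈ (1-∈ ∷ [])

    scale-∈ : ∀ {a p} → a ∈S → All _∈S p → All _∈S (map (a *_) p)
    scale-∈ a∈ []        = []
    scale-∈ a∈ (b∈ ∷ p∈) = *-∈ a∈ b∈ ∷ scale-∈ a∈ p∈

    +ₚ-∈ : ∀ {p q} → All _∈S p → All _∈S q → All _∈S (p +ₚ q)
    +ₚ-∈ []        q∈        = q∈
    +ₚ-∈ (a∈ ∷ p∈) []        = a∈ ∷ p∈
    +ₚ-∈ (a∈ ∷ p∈) (b∈ ∷ q∈) = +-∈ a∈ b∈ ∷ +ₚ-∈ p∈ q∈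

    -ₚ-∈ : ∀ {p} → All _∈S p → All _∈S (-ₚ p)
    -ₚ-∈ []        = []
    -ₚ-∈ (a∈ ∷ p∈) = neg-∈ a∈ ∷ -ₚ-∈ p∈

    *ₚ-∈ : ∀ {p q} → All _∈S p → All _∈S q → All _∈S (p *ₚ q)
    *ₚ-∈ []        q∈ = []
    *ₚ-∈ (a∈ ∷ p∈) q∈ = +ₚ-∈ (scale-∈ a∈ q∈) (0-∈ ∷ *ₚ-∈ p∈ q∈)

    ev-∈ : ∀ {p z} → All _∈S p → z ∈S → ev (idHom {𝔽}) p z ∈S
    ev-∈ []        z∈ = 0-∈
    ev-∈ (a∈ ∷ p∈) z∈ = +-∈ a∈ (*-∈ z∈ (ev-∈ p∈ z∈))

    -- The remainder is padded to exactly the length of the divisor's list, so bounds on its degree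
    -- need no inspection of its leading coefficient.
    record Division (h : Poly) (q : List Carrier) : Set where
      field
        quot rem : Poly
        quot-∈   : All _∈S quot
        rem-∈    : All _∈S rem
        |rem|    : length rem ≡ length q
        equation : h ≋ quot *ₚ M 𝔽 q +ₚ rem

    private
      -- `c` is the last entry of `a ∷ r`, the only one in the degree of the divisor; subtracting
      -- `c` times the divisor removes it.
      reduce : ∀ {a} r q → a ∈S → All _∈S r → All _∈S q → length r ≡ length q →
               ∃[ c ] ∃[ s ] c ∈S × All _∈S s × length s ≡ length q ×
                 a ∷ r ≋ (c ∷ []) *ₚ M 𝔽 q +ₚ s
      reduce {a} [] [] a∈ r∈ q∈ |r| = a , [] , a∈ , [] , ≡.refl ,
        P.sym (P.trans (P.+-identityʳ _) (P.*-identityʳ (a ∷ [])))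
      reduce {a} (a′ ∷ r) (b ∷ q) a∈ (a′∈ ∷ r∈) (b∈ ∷ q∈) |r|
        with c , s , c∈ , s∈ , |s| , eq ← reduce r q a′∈ r∈ q∈ (ℕ.suc-injective |r|)
        = c , a - c * b ∷ s , c∈ , +-∈ a∈ (neg-∈ (*-∈ c∈ b∈)) ∷ s∈ , ≡.cong suc |s| , (begin
          a ∷ a′ ∷ r
            ≈⟨ ∷-≋ 𝔽 a (a′ ∷ r) ⟩
          K a +ₚ X *ₚ (a′ ∷ r)
            ≈⟨ P.+-congˡ {K a} (P.*-congˡ {X} eq) ⟩
          K a +ₚ X *ₚ (K c *ₚ M 𝔽 q +ₚ s)
            ≈⟨ solve 6 (λ a b c x m s → a :+ x :* (c :* m :+ s) := c :* (b :+ x :* m) :+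
              ((a :- c :* b) :+ x :* s))
                 P.refl (K a) (K b) (K c) X (M 𝔽 q) s ⟩
          K c *ₚ (K b +ₚ X *ₚ M 𝔽 q) +ₚ ((K a +ₚ -ₚ (K c *ₚ K b)) +ₚ X *ₚ s)
            ≈⟨ P.+-cong (P.*-congˡ {K c} (P.sym (∷-≋ 𝔽 b (M 𝔽 q))))
                 (P.trans (P.+-congʳ {X *ₚ s} (P.sym const-homo)) (P.sym (∷-≋ 𝔽 (a - c * b) s))) ⟩
          K c *ₚ M 𝔽 (b ∷ q) +ₚ (a - c * b ∷ s) ∎)
        where
        open ≈-Reasoning P.setoid
        open IntegerSolver polyRing
        open Hom const using (+-homo; -‿homo; *-homo)
        K : Carrier → Poly
        K = Hom.⟦ const ⟧
        const-homo : K (a - c * b) ≋ K a +ₚ -ₚ (K c *ₚ K b)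
        const-homo = P.trans (+-homo a (- (c * b)))
          (P.+-congˡ {K a} (P.trans (-‿homo (c * b)) (P.-‿cong (*-homo c b))))

      zeros : ℕ → Poly
      zeros zero    = []
      zeros (suc n) = 0# ∷ zeros n

      zeros≋0 : ∀ n → zeros n ≋ []
      zeros≋0 zero    = P.refl
      zeros≋0 (suc n) = ⟨ (λ { zero → refl ; (suc i) → at (zeros≋0 n) i }) ⟩

      zeros-∈ : ∀ n → All _∈S (zeros n)
      zeros-∈ zero    = []
      zeros-∈ (suc n) = 0-∈ ∷ zeros-∈ n

      length-zeros : ∀ n → length (zeros n) ≡ n
      length-zeros zero    = ≡.refl
      length-zeros (suc n) = ≡.cong suc (length-zeros n)

    divide : ∀ {h q} → All _∈S h → All _∈S q → Division h q
    divide {q = q} [] q∈ = record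
      { quot = [] ; rem = zeros (length q) ; quot-∈ = [] ; rem-∈ = zeros-∈ (length q)
      ; |rem| = length-zeros (length q) ; equation = P.sym (zeros≋0 (length q)) }
    divide {a ∷ h} {q} (a∈ ∷ h∈) q∈
      with record { quot = t ; rem = r ; quot-∈ = t∈ ; rem-∈ = r∈ ; |rem| = |r| ; equation = eq } ← divide
        h∈ q∈
      with c , s , c∈ , s∈ , |s| , eq′ ← reduce r q a∈ r∈ q∈ |r| = record
      { quot = c ∷ t ; rem = s ; quot-∈ = c∈ ∷ t∈ ; rem-∈ = s∈ ; |rem| = |s|
      ; equation = begin
          a ∷ h ≈⟨ ∷-≋ 𝔽 a h ⟩
          K a +ₚ X *ₚ h ≈⟨ P.+-congˡ {K a} (P.*-congˡ {X} eq) ⟩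
          K a +ₚ X *ₚ (t *ₚ m +ₚ r)
            ≈⟨ solve 5 (λ a x t m r → a :+ x :* (t :* m :+ r) := x :* t :* m :+ (a :+ x :* r))
                                                           P.refl (K a) X t m r ⟩
          X *ₚ t *ₚ m +ₚ (K a +ₚ X *ₚ r) ≈⟨ P.+-congˡ {X *ₚ t *ₚ m} (P.trans (P.sym (∷-≋ 𝔽 a r)) eq′) ⟩
          X *ₚ t *ₚ m +ₚ (K c *ₚ m +ₚ s)
            ≈⟨ solve 5 (λ c x t m s → x :* t :* m :+ (c :* m :+ s) := (c :+ x :* t) :* m :+ s)
                                                           P.refl (K c) X t m s ⟩
          (K c +ₚ X *ₚ t) *ₚ m +ₚ s ≈⟨ P.+-congʳ {s} (P.*-congʳ {m} (P.sym (∷-≋ 𝔽 c t))) ⟩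
          (c ∷ t) *ₚ m +ₚ s ∎ }
      where
      open ≈-Reasoning P.setoid
      open IntegerSolver polyRing
      K : Carrier → Poly
      K = Hom.⟦ const ⟧
      m : Poly
      m = M 𝔽 q

    -- The length of `part` is the true degree of p, below the length of its list; this strict
    -- inequality drives the Euclidean recursions.
    record MonicPart (p : Poly) : Set where
      field
        lead lead⁻¹ : Carrier
        inverse     : lead * lead⁻¹ ≈ 1#
        lead-∈      : lead ∈S
        lead⁻¹-∈    : lead⁻¹ ∈S
        part        : List Carrier
        part-∈      : All _∈S part
        |part|      : length part < length p
        equation    : p ≋ (lead ∷ []) *ₚ M 𝔽 part

    normalise : ∀ {p} → All _∈S p → p ≋ [] ⊎ MonicPart p
    normalise [] = inj₁ P.refl
    normalise {a ∷ p} (a∈ ∷ p∈) with normalise p∈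
    ... | inj₁ p≋0 with zeroOrInverse a
    ...   | inj₁ a≈0 = inj₁ ⟨ (λ { zero → a≈0 ; (suc i) → at p≋0 i }) ⟩
    ...   | inj₂ (a′ , aa′≈1) = inj₂ record
      { lead = a ; lead⁻¹ = a′ ; inverse = aa′≈1 ; lead-∈ = a∈ ; lead⁻¹-∈ = inv-∈ aa′≈1 a∈
      ; part = [] ; part-∈ = [] ; |part| = s≤s z≤n
      ; equation = P.trans ⟨ (λ { zero → refl ; (suc i) → at p≋0 i }) ⟩ (P.sym (P.*-identityʳ (a ∷ []))) }
    normalise {a ∷ p} (a∈ ∷ p∈) | inj₂ mp = inj₂ record
      { lead = lead ; lead⁻¹ = lead⁻¹ ; inverse = inverse ; lead-∈ = lead-∈ ; lead⁻¹-∈ = lead⁻¹-∈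
      ; part = lead⁻¹ * a ∷ part ; part-∈ = *-∈ lead⁻¹-∈ a∈ ∷ part-∈ ; |part| = s≤s |part|
      ; equation = begin
          a ∷ p ≈⟨ ∷-≋ 𝔽 a p ⟩
          K a +ₚ X *ₚ p ≈⟨ P.+-cong (const.cong a≈) (P.*-congˡ {X} equation) ⟩
          K (lead * (lead⁻¹ * a)) +ₚ X *ₚ (K lead *ₚ m)
            ≈⟨ P.+-congʳ {X *ₚ (K lead *ₚ m)} (const.*-homo lead (lead⁻¹ * a)) ⟩
          K lead *ₚ K (lead⁻¹ * a) +ₚ X *ₚ (K lead *ₚ m)
            ≈⟨ solve 4 (λ l a x m → l :* a :+ x :* (l :* m) := l :* (a :+ x :* m))
                                                               P.refl (K lead) (K (lead⁻¹ * a)) X m ⟩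
          K lead *ₚ (K (lead⁻¹ * a) +ₚ X *ₚ m) ≈⟨ P.*-congˡ {K lead} (P.sym (∷-≋ 𝔽 (lead⁻¹ * a) m)) ⟩
          K lead *ₚ (lead⁻¹ * a ∷ m) ∎ }
      where
      open MonicPart mp
      open ≈-Reasoning P.setoid
      open IntegerSolver polyRing
      module const = Hom const
      K : Carrier → Poly
      K = Hom.⟦ const ⟧
      m : Poly
      m = M 𝔽 part
      a≈ : a ≈ lead * (lead⁻¹ * a)
      a≈ = trans (sym (*-identityˡ a)) (trans (*-congʳ (sym inverse)) (*-assoc _ _ _))

    -- Excluding monic proper divisors is enough after normalisation, and the negative form can be
    -- established without deciding reducibility.
    IrreducibleOver : List Carrier → Set
    IrreducibleOver q = ∀ b t → All _∈S b → All _∈S t → 0 < length b → length b < length q →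
                        ¬ M 𝔽 q ≋ t *ₚ M 𝔽 b

    private
      -- Modulo q, only one polynomial has to shrink. With b the monic part of h and q = t b + r,
      -- irreducibility gives r ≠ 0 unless b = 1, and r ≡ -t b; hence an inverse s of the shorter r
      -- yields the inverse `-s t` of b, which is rescaled by the leading coefficient of h.
      invert : ∀ {q} → All _∈S q → IrreducibleOver q →
               ∀ n {h} → All _∈S h → length h ≤ n → length h ≤ length q →
               h ≋ [] ⊎ (∃[ s ] All _∈S s × ∃[ u ] s *ₚ h ≋ P.1# +ₚ u *ₚ M 𝔽 q)
      invert q∈ irr zero    {[]} h∈ h≤n h≤q = inj₁ P.refl
      invert {q} q∈ irr (suc n) {h}  h∈ h≤n h≤q with normalise h∈
      ... | inj₁ h≋0 = inj₁ h≋0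
      ... | inj₂ mp@record { part = [] } = inj₂ (K lead⁻¹ , lead⁻¹-∈ ∷ [] , [] , (begin
          K lead⁻¹ *ₚ h ≈⟨ P.*-congˡ {K lead⁻¹} (P.trans equation (P.*-identityʳ (K lead))) ⟩
          K lead⁻¹ *ₚ K lead ≈⟨ P.sym (const.*-homo lead⁻¹ lead) ⟩
          K (lead⁻¹ * lead) ≈⟨ const.cong (trans (*-comm _ _) inverse) ⟩
          P.1# ≈⟨ P.sym (P.+-identityʳ P.1#) ⟩
          P.1# +ₚ [] *ₚ M 𝔽 q ∎))
        where
        open MonicPart mp
        open ≈-Reasoning P.setoid
        module const = Hom const
        K : Carrier → Poly
        K = Hom.⟦ const ⟧
      ... | inj₂ mp@record { part = b@(_ ∷ _) } = further (invert q∈ irr n rem-∈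
              (ℕ.≤-pred (ℕ.≤-trans r<h h≤n)) (ℕ.≤-trans (ℕ.<⇒≤ r<h) h≤q))
        where
        open MonicPart mp hiding (equation)
        open Division (divide (M-∈ q∈) part-∈)
        open ≈-Reasoning P.setoid
        open IntegerSolver polyRing
        module const = Hom const
        K : Carrier → Poly
        K = Hom.⟦ const ⟧
        r<h : length rem < length h
        r<h = ≡.subst (_< length h) (≡.sym |rem|) |part|
        further : rem ≋ [] ⊎ (∃[ s ] All _∈S s × ∃[ u ] s *ₚ rem ≋ P.1# +ₚ u *ₚ M 𝔽 q) →
                  h ≋ [] ⊎ (∃[ s ] All _∈S s × ∃[ u ] s *ₚ h ≋ P.1# +ₚ u *ₚ M 𝔽 q)
        further (inj₁ r≋0) = ⊥-elim (irr b quot part-∈ quot-∈ (s≤s z≤n) (ℕ.≤-trans |part| h≤q)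
          (P.trans equation (P.trans (P.+-congˡ {quot *ₚ M 𝔽 b} r≋0) (P.+-identityʳ _))))
        further (inj₂ (s , s∈ , u , sr≋1)) = inj₂
          ( -ₚ (s *ₚ (quot *ₚ K lead⁻¹)) , -ₚ-∈ (*ₚ-∈ s∈ (*ₚ-∈ quot-∈ (lead⁻¹-∈ ∷ []))) , u +ₚ -ₚ s , (begin
            -ₚ (s *ₚ (quot *ₚ K lead⁻¹)) *ₚ h
              ≈⟨ P.*-congˡ { -ₚ (s *ₚ (quot *ₚ K lead⁻¹))} (MonicPart.equation mp) ⟩
            -ₚ (s *ₚ (quot *ₚ K lead⁻¹)) *ₚ (K lead *ₚ mb)
              ≈⟨ solve 6 (λ s t l′ l m r → :- (s :* (t :* l′)) :* (l :* m) := l :* l′ :*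
                (s :* r :- s :* (t :* m :+ r)))
                   P.refl s quot (K lead⁻¹) (K lead) mb rem ⟩
            K lead *ₚ K lead⁻¹ *ₚ (s *ₚ rem +ₚ -ₚ (s *ₚ (quot *ₚ mb +ₚ rem)))
              ≈⟨ P.*-cong (P.trans (P.sym (const.*-homo lead lead⁻¹)) (const.cong inverse))
                   (P.+-cong sr≋1 (P.-‿cong (P.*-congˡ {s} (P.sym equation)))) ⟩
            P.1# *ₚ (P.1# +ₚ u *ₚ mq +ₚ -ₚ (s *ₚ mq))
              ≈⟨ solve 3 (λ u s m → con (+ 1) :* (con (+ 1) :+ u :* m :- s :* m) := con (+ 1) :+ (u :- s) :*
                m)
                   P.refl u s mq ⟩
            P.1# +ₚ (u +ₚ -ₚ s) *ₚ mq ∎) )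
          where
          mb mq : Poly
          mb = M 𝔽 b
          mq = M 𝔽 q

    zeroOrInverse-mod : ∀ {q} → All _∈S q → IrreducibleOver q → ∀ {h} → All _∈S h →
      (∃[ t ] h ≋ t *ₚ M 𝔽 q) ⊎ (∃[ s ] All _∈S s × ∃[ u ] s *ₚ h ≋ P.1# +ₚ u *ₚ M 𝔽 q)
    zeroOrInverse-mod {q} q∈ irr {h} h∈ with D ← divide h∈ q∈
      with invert q∈ irr _ (Division.rem-∈ D) ℕ.≤-refl (ℕ.≤-reflexive (Division.|rem| D))
    ... | inj₁ r≋0 = inj₁ (quot , P.trans equation (P.trans (P.+-congˡ {quot *ₚ M 𝔽 q} r≋0)
      (P.+-identityʳ _)))
      where open Division D
    ... | inj₂ (s , s∈ , u , sr≋1) = inj₂ (s , s∈ , s *ₚ quot +ₚ u , (begin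
        s *ₚ h ≈⟨ P.*-congˡ {s} equation ⟩
        s *ₚ (quot *ₚ mq +ₚ rem)
          ≈⟨ solve 4 (λ s t m r → s :* (t :* m :+ r) := s :* t :* m :+ s :* r) P.refl s quot mq rem ⟩
        s *ₚ quot *ₚ mq +ₚ s *ₚ rem ≈⟨ P.+-congˡ {s *ₚ quot *ₚ mq} sr≋1 ⟩
        s *ₚ quot *ₚ mq +ₚ (P.1# +ₚ u *ₚ mq)
          ≈⟨ solve 4 (λ s t u m → s :* t :* m :+ (con (+ 1) :+ u :* m) := con (+ 1) :+ (s :* t :+ u) :* m)
                                                     P.refl s quot u mq ⟩
        P.1# +ₚ (s *ₚ quot +ₚ u) *ₚ mq ∎))
      where
      open Division D
      open ≈-Reasoning P.setoid
      open IntegerSolver polyRing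
      mq : Poly
      mq = M 𝔽 q

  all-whole : ∀ p → All (Subfield._∈S (whole F)) p
  all-whole p = All.universal (λ _ → tt) p

  Irreducible′ : List Carrier → Set
  Irreducible′ = IrreducibleOver (whole F)

  module _ {q : List Carrier} (0<|q| : 0 < length q) (irr : Irreducible′ q) where
    open Adjoin 𝔽 q

    adjunction : DiscreteField
    adjunction = record
      { 𝔽      = extension
      ; 1≉0           = λ 1≈0 → 1≉0 (embedding-injective 0<|q| 1≈0)
      ; zeroOrInverse = λ h → dichotomy h (zeroOrInverse-mod (whole F) (all-whole q) irr (all-whole h))
      }
      where
      module E = CommutativeRing extension
      open QuotientRing using (modulo)
      dichotomy : ∀ h → (∃[ t ] h ≋ t *ₚ M 𝔽 q) ⊎
                    (∃[ s ] All _ s × ∃[ u ] s *ₚ h ≋ P.1# +ₚ u *ₚ M 𝔽 q) →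
                  h E.≈ E.0# ⊎ (∃[ s ] h E.* s E.≈ E.1#)
      dichotomy h (inj₁ (t , eq))         = inj₁ (modulo t eq)
      dichotomy h (inj₂ (s , _ , u , eq)) = inj₂ (s , modulo u (P.trans (P.*-comm h s) eq))

    rootExtension : RootExtension (M 𝔽 q)
    rootExtension = record { extensionField = adjunction ; φ = embedding ; root = root ; root-eq = root-eq }

  infix 4 _∣ᴹ_
  _∣ᴹ_ : List Carrier → List Carrier → Set
  b ∣ᴹ q = ∃[ t ] M 𝔽 q ≋ t *ₚ M 𝔽 b

  -- Deciding reducibility is avoided: a nonconstant divisor of least degree exists classically.
  irreducibleFactor : ∀ q → 0 < length q →
    ¬ ¬ (∃[ b ] 0 < length b × length b ≤ length q × b ∣ᴹ q × Irreducible′ b)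
  irreducibleFactor q = go (length q) q ℕ.≤-refl
    where
    go : ∀ n q → length q ≤ n → 0 < length q →
         ¬ ¬ (∃[ b ] 0 < length b × length b ≤ length q × b ∣ᴹ q × Irreducible′ b)
    go zero    q |q|≤n 0<|q| _ = ℕ.<⇒≱ 0<|q| |q|≤n
    go (suc n) q |q|≤n 0<|q| none = none (q , 0<|q| , ℕ.≤-refl , (P.1# , P.sym (P.*-identityˡ _)) ,
      λ b t _ _ 0<|b| |b|<|q| q≋tb → go n b (ℕ.≤-pred (ℕ.≤-trans |b|<|q| |q|≤n)) 0<|b|
        λ { (c , 0<|c| , |c|≤|b| , (u , b≋uc) , irr) → none (c , 0<|c| , ℕ.≤-trans |c|≤|b| (ℕ.<⇒≤ |b|<|q|) ,
          (t *ₚ u , P.trans q≋tb (P.trans (P.*-congˡ {t} b≋uc) (P.sym (P.*-assoc t u _)))) , irr) })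

-- Resultants

module Product (C : CRing) where
  open CommutativeRing C
  open Exp commutativeSemiring using (_^_; ^-distrib-*; ^-congˡ)
  open IntegerSolver C
  open ≈-Reasoning setoid

  prod : {X : Set} → (X → Carrier) → List X → Carrier
  prod f []       = 1#
  prod f (b ∷ bs) = f b * prod f bs

  1^n≈1 : ∀ n → 1# ^ n ≈ 1#
  1^n≈1 zero    = refl
  1^n≈1 (suc n) = trans (*-identityˡ _) (1^n≈1 n)

  module _ {X : Set} where
    prod-cong : ∀ {f g : X → Carrier} {bs} → All (λ b → f b ≈ g b) bs → prod f bs ≈ prod g bs
    prod-cong []         = refl
    prod-cong (eq ∷ eqs) = *-cong eq (prod-cong eqs)

    prod-cong′ : ∀ {f g : X → Carrier} → (∀ b → f b ≈ g b) → ∀ bs → prod f bs ≈ prod g bs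
    prod-cong′ eq bs = prod-cong (All.universal eq bs)

    prod-* : ∀ (f g : X → Carrier) bs → prod (λ b → f b * g b) bs ≈ prod f bs * prod g bs
    prod-* f g []       = sym (*-identityˡ 1#)
    prod-* f g (b ∷ bs) = trans (*-congˡ (prod-* f g bs))
      (solve 4 (λ a b x y → a :* b :* (x :* y) := a :* x :* (b :* y)) refl _ _ _ _)

    prod-const : ∀ c (bs : List X) → prod (λ _ → c) bs ≈ c ^ length bs
    prod-const c []       = refl
    prod-const c (b ∷ bs) = *-congˡ (prod-const c bs)

    prod-^ : ∀ n (f : X → Carrier) bs → prod (λ b → f b ^ n) bs ≈ prod f bs ^ n
    prod-^ n f []       = sym (1^n≈1 n)
    prod-^ n f (b ∷ bs) = trans (*-congˡ (prod-^ n f bs)) (sym (^-distrib-* _ _ n))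

    prod-neg : ∀ (f g : X → Carrier) bs → prod (λ b → f b - g b) bs ≈
               (- 1#) ^ length bs * prod (λ b → g b - f b) bs
    prod-neg f g bs = begin
      prod (λ b → f b - g b) bs
        ≈⟨ prod-cong′ (λ b → solve 2 (λ x y → x :- y := (:- con (+ 1)) :* (y :- x)) refl (f b) (g b)) bs ⟩
      prod (λ b → - 1# * (g b - f b)) bs ≈⟨ prod-* (λ _ → - 1#) (λ b → g b - f b) bs ⟩
      prod (λ _ → - 1#) bs * prod (λ b → g b - f b) bs ≈⟨ *-congʳ (prod-const (- 1#) bs) ⟩
      (- 1#) ^ length bs * prod (λ b → g b - f b) bs ∎

  prod-swap : ∀ {X Y : Set} (f : X → Y → Carrier) xs ys →
              prod (λ x → prod (f x) ys) xs ≈ prod (λ y → prod (λ x → f x y) xs) ys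
  prod-swap f []       ys = sym (trans (prod-const 1# ys) (1^n≈1 (length ys)))
  prod-swap f (x ∷ xs) ys = trans (*-congˡ (prod-swap f xs ys)) (sym (prod-* (f x) _ ys))

open Product public using (prod)

prod-hom : ∀ {B C} (φ : Hom B C) {X : Set} (f : X → CommutativeRing.Carrier B) bs →
           let open CommutativeRing C in Hom.⟦ φ ⟧ (prod B f bs) ≈ prod C (λ b → Hom.⟦ φ ⟧ (f b)) bs
prod-hom φ f []       = Hom.1-homo φ
prod-hom {C = C} φ f (b ∷ bs) = trans (Hom.*-homo φ _ _) (*-congˡ (prod-hom φ f bs))
  where open CommutativeRing C

linearProduct-prod : ∀ {E C} (ψ : Hom E C) bs x → let open CommutativeRing C in
                     linearProduct ψ bs x ≈ prod C (λ b → x - Hom.⟦ ψ ⟧ b) bs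
linearProduct-prod {C = C} ψ []       x = CommutativeRing.refl C
linearProduct-prod {C = C} ψ (b ∷ bs) x = *-congˡ (linearProduct-prod ψ bs x)
  where open CommutativeRing C

module _ {A E : CRing} (φ : Hom A E) {q : List (CommutativeRing.Carrier A)}
  {bs : List (CommutativeRing.Carrier E)} (sp : Splits φ q bs) where
  open CommutativeRing E

  private
    linear-vanishes : ∀ bs → All (λ b → linearProduct (idHom {E}) bs b ≈ 0#) bs
    linear-vanishes []       = []
    linear-vanishes (b ∷ bs) = trans (*-congʳ (-‿inverseʳ b)) (zeroˡ _) ∷
      All.map (λ eq → trans (*-congˡ eq) (zeroʳ _)) (linear-vanishes bs)

  splits-ev : ∀ x → ev φ (M A q) x ≈ linearProduct (idHom {E}) bs x
  splits-ev x = trans (ev-agree φ (idHom {E} ∘ʰ φ) (λ _ → refl) (M A q) x) (sp (idHom {E}) x)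

  splits-roots : All (λ b → ev φ (M A q) b ≈ 0#) bs
  splits-roots = All.map (λ {b} eq → trans (splits-ev b) eq) (linear-vanishes bs)

-- Both sides of  Res(q, h) = ± lead^k Res(h, q mod h)  are products of values at roots in a
-- common splitting ring; Euclid's algorithm thus keeps the resultant in the subfield.
module Norm (F : DiscreteField) (S : Subfield F) where
  open DiscreteField F
  open Subfield S
  open PolynomialRing 𝔽
  open Field F
  open Exp commutativeSemiring using (_^_)
  private module P = CommutativeRing polyRing

  Resultant : Poly → List Carrier → Set₁
  Resultant h q = ∃[ c ] c ∈S × (∀ {E} (φ : Hom 𝔽 E) bs → length bs ≡ length q →
    Splits φ q bs → let open CommutativeRing E using () renaming (_≈_ to _≈ᴱ_) in prod E (ev φ h) bs ≈ᴱ
      Hom.⟦ φ ⟧ c)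

  private
    res-zero : ∀ {h} q → h ≋ [] → Resultant h q
    -- A constant q has no roots, and the empty product is 1 even for h = 0.
    res-zero []      h≋0 = 1# , 1-∈ , λ { {E} φ [] _ _ → CommutativeRing.sym E (Hom.1-homo φ) }
    res-zero {h} (_ ∷ _) h≋0 = 0# , 0-∈ S , λ { {E} φ (b ∷ bs) _ _ → let module E = CommutativeRing E in
      E.trans (E.*-congʳ (Evaluation.ev-zero φ h b (at h≋0))) (E.trans (E.zeroˡ _) (E.sym (Hom.0-homo φ))) }

    go : ∀ n {h q} → length h ≤ n → All _∈S h → All _∈S q → Resultant h q
    go zero    {[]} {q} _ _ _ = res-zero {[]} q P.refl
    go (suc n) {h} {q} |h|≤n h∈ q∈ with normalise S h∈
    ... | inj₁ h≋0 = res-zero q h≋0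
    ... | inj₂ mp = step (go n (ℕ.≤-pred (ℕ.≤-trans |r|<|h| |h|≤n)) rem-∈ part-∈)
      where
      open MonicPart mp
      open Division (divide S (M-∈ S q∈) part-∈) using (quot; rem; rem-∈; |rem|) renaming (equation to q≋)
      |r|<|h| : length rem < length h
      |r|<|h| = ≡.subst (_< length h) (≡.sym |rem|) |part|
      k l : ℕ
      k = length q
      l = length part
      step : Resultant rem part → Resultant h q
      -- The sign `((- 1#) ^ l) ^ k` comes from reversing the l·k differences between roots of q and
      -- roots of the monic part of h.
      step (c , c∈ , spec) = lead ^ k * (((- 1#) ^ l) ^ k * c) ,
        *-∈ (^-∈ S k lead-∈) (*-∈ (^-∈ S k (^-∈ S l (neg-∈ 1-∈))) c∈) , spec′
        where
        spec′ : ∀ {E} (φ : Hom 𝔽 E) bs → length bs ≡ k → Splits φ q bs →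
          let open CommutativeRing E using () renaming (_≈_ to _≈ᴱ_) in
          prod E (ev φ h) bs ≈ᴱ Hom.⟦ φ ⟧ (lead ^ k * (((- 1#) ^ l) ^ k * c))
        -- The roots of `part` live in a splitting ring `D` above `E`; the identity is proved there
        -- and pulled back along the injective `χ`.
        spec′ {E} φ bs |bs| sp = Hom.injective χ φ-injective (begin
          χ.⟦ prod E (ev φ h) bs ⟧
            ≈⟨ prod-hom χ (ev φ h) bs ⟩
          prod D (λ b → χ.⟦ ev φ h b ⟧) bs
            ≈⟨ prod-cong′ value bs ⟩
          prod D (λ b → θ.⟦ lead ⟧ D.* (m ^ᴰ l D.* prod D (λ g → g D.- χ.⟦ b ⟧) γs)) bs
            ≈⟨ D.trans (prod-* _ _ bs) (D.*-congˡ (prod-* _ _ bs)) ⟩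
          prod D (λ _ → θ.⟦ lead ⟧) bs D.* (prod D (λ _ → m ^ᴰ l) bs D.*
            prod D (λ b → prod D (λ g → g D.- χ.⟦ b ⟧) γs) bs)
            ≈⟨ D.*-cong (power θ.⟦ lead ⟧) (D.*-cong (power (m ^ᴰ l))
              (D.trans (prod-swap _ bs γs) (prod-cong (All.map (λ {g} → residue {g}) roots-h)))) ⟩
          θ.⟦ lead ⟧ ^ᴰ k D.* ((m ^ᴰ l) ^ᴰ k D.* prod D (ev θ rem) γs)
            ≈⟨ D.*-congˡ (D.*-congˡ (spec θ γs |γs| sp-h)) ⟩
          θ.⟦ lead ⟧ ^ᴰ k D.* ((m ^ᴰ l) ^ᴰ k D.* θ.⟦ c ⟧)
            ≈⟨ D.sym (D.trans (θ.*-homo _ _) (D.*-cong (θ.^-homo lead k) (D.trans (θ.*-homo _ _) (D.*-congʳ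
                 (D.trans (θ.^-homo _ k) (^-congˡ k (D.trans (θ.^-homo (- 1#) l)
                   (^-congˡ l (D.trans (θ.-‿homo 1#) (D.-‿cong θ.1-homo)))))))))) ⟩
          θ.⟦ lead ^ k * (((- 1#) ^ l) ^ k * c) ⟧ ∎)
          where
          module φ = Hom φ
          open SplittingRing (splittingRing {E} (map φ.⟦_⟧ part))
            renaming (ring to D; φ to χ; roots to γs; length-roots to |γs|′; splits to sp-h′)
          module D = CommutativeRing D
          module χ = Hom χ
          open Product D hiding (prod)
          open Exp D.commutativeSemiring using (^-congˡ) renaming (_^_ to _^ᴰ_)
          open ≈-Reasoning D.setoid
          θ : Hom 𝔽 D
          θ = χ ∘ʰ φ
          module θ = Hom θ
          m : D.Carrier
          m = D.- D.1#
          |γs| : length γs ≡ l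
          |γs| = ≡.trans |γs|′ (length-map φ.⟦_⟧ part)
          sp-h : Splits θ part γs
          sp-h {C} ψ x = C.trans (ev-agree (ψ ∘ʰ θ) ((ψ ∘ʰ χ) ∘ʰ φ) (λ _ → C.refl) (M 𝔽 part) x)
            (C.trans (C.sym (ev-M-map φ (ψ ∘ʰ χ) part x)) (sp-h′ ψ x))
            where module C = CommutativeRing C
          roots-h : All (λ g → ev θ (M 𝔽 part) g D.≈ D.0#) γs
          roots-h = splits-roots θ {part} {γs} sp-h
          power : ∀ x → prod D (λ _ → x) bs D.≈ x ^ᴰ k
          power x = D.trans (prod-const x bs) (D.reflexive (≡.cong (x ^ᴰ_) |bs|))
          value : ∀ b → χ.⟦ ev φ h b ⟧ D.≈ θ.⟦ lead ⟧ D.* (m ^ᴰ l D.* prod D (λ g → g D.- χ.⟦ b ⟧) γs)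
          value b = begin
            χ.⟦ ev φ h b ⟧ ≈⟨ ev-hom χ φ h b ⟩
            ev θ h β ≈⟨ Hom.cong evθ equation ⟩
            ev θ ((lead ∷ []) *ₚ M 𝔽 part) β ≈⟨ Hom.*-homo evθ (lead ∷ []) (M 𝔽 part) ⟩
            ev θ (lead ∷ []) β D.* ev θ (M 𝔽 part) β
              ≈⟨ D.*-cong (Evaluation.ev-const θ lead β) (D.trans (splits-ev θ {part} {γs} sp-h β)
                (linearProduct-prod (idHom {D}) γs β)) ⟩
            θ.⟦ lead ⟧ D.* prod D (λ g → β D.- g) γs ≈⟨ D.*-congˡ (prod-neg (λ _ → β) (λ g → g) γs) ⟩
            θ.⟦ lead ⟧ D.* (m ^ᴰ length γs D.* prod D (λ g → g D.- β) γs)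
              ≡⟨ ≡.cong (λ j → θ.⟦ lead ⟧ D.* (m ^ᴰ j D.* prod D (λ g → g D.- β) γs)) |γs| ⟩
            θ.⟦ lead ⟧ D.* (m ^ᴰ l D.* prod D (λ g → g D.- β) γs) ∎
            where
            β : D.Carrier
            β = χ.⟦ b ⟧
            evθ : Hom polyRing D
            evθ = Evaluation.evHom θ β
          residue : ∀ {g} → ev θ (M 𝔽 part) g D.≈ D.0# → prod D (λ b → g D.- χ.⟦ b ⟧) bs D.≈ ev θ rem g
          residue {g} root = begin
            prod D (λ b → g D.- χ.⟦ b ⟧) bs ≈⟨ linearProduct-prod χ bs g ⟨
            linearProduct χ bs g ≈⟨ sp χ g ⟨
            ev θ (M 𝔽 q) g ≈⟨ Hom.cong evθ q≋ ⟩
            ev θ (quot *ₚ M 𝔽 part +ₚ rem) g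
              ≈⟨ D.trans (Hom.+-homo evθ (quot *ₚ M 𝔽 part) rem)
                (D.+-congʳ (Hom.*-homo evθ quot (M 𝔽 part))) ⟩
            ev θ quot g D.* ev θ (M 𝔽 part) g D.+ ev θ rem g
              ≈⟨ D.+-congʳ (D.trans (D.*-congˡ root) (D.zeroʳ _)) ⟩
            D.0# D.+ ev θ rem g ≈⟨ D.+-identityˡ _ ⟩
            ev θ rem g ∎
            where
            evθ : Hom polyRing D
            evθ = Evaluation.evHom θ g

  resultant : ∀ {h q} → All _∈S h → All _∈S q → Resultant h q
  resultant = go _ ℕ.≤-refl

-- Capelli's theorem for odd exponents

Odd : ℕ → Set
Odd n = ∃[ t ] n ≡ 1 ℕ.+ 2 ℕ.* t

module Powers (A : CRing) where
  open CommutativeRing A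
  open Exp commutativeSemiring public
  open IntegerSolver A
  open ≈-Reasoning setoid

  ^-neg-odd : ∀ {n} → Odd n → ∀ x → (- x) ^ n ≈ - (x ^ n)
  ^-neg-odd (t , ≡.refl) x = begin
    - x * (- x) ^ (2 ℕ.* t) ≈⟨ *-congˡ (^-assocʳ (- x) 2 t) ⟨
    - x * ((- x) ^ 2) ^ t
      ≈⟨ *-congˡ (^-congˡ t (solve 1 (λ x → (:- x) :* ((:- x) :* con (+ 1)) := x :* (x :* con (+ 1))) refl
        x)) ⟩
    - x * (x ^ 2) ^ t ≈⟨ *-congˡ (^-assocʳ x 2 t) ⟩
    - x * x ^ (2 ℕ.* t) ≈⟨ solve 2 (λ x y → (:- x) :* y := :- (x :* y)) refl x _ ⟩
    - (x * x ^ (2 ℕ.* t)) ∎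

  open Product A public using (1^n≈1)

  ^-swap : ∀ x m n → (x ^ m) ^ n ≈ (x ^ n) ^ m
  ^-swap x m n = trans (^-assocʳ x m n) (trans (^-congʳ x (ℕ.*-comm m n)) (sym (^-assocʳ x n m)))

module _ (A : CRing) where
  open CommutativeRing A
  open PolynomialRing A
  open Powers polyRing using () renaming (_^_ to _^ₚ_)
  private module P = CommutativeRing polyRing

  -- M (binomial n a) = Xⁿ - a, for n ≥ 1.
  binomial : ℕ → Carrier → List Carrier
  binomial zero    a = []
  binomial (suc n) a = - a ∷ replicate n 0#

  length-binomial : ∀ n a → length (binomial n a) ≡ n
  length-binomial zero    a = ≡.refl
  length-binomial (suc n) a = ≡.cong suc (length-replicate n)

  ev-binomial : ∀ {B} (ψ : Hom A B) n .{{_ : ℕ.NonZero n}} a z → let module B = CommutativeRing B in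
                ev ψ (M A (binomial n a)) z B.≈ Powers._^_ B z n B.- Hom.⟦ ψ ⟧ a
  ev-binomial {B} ψ (suc n) a z = B.trans (B.+-cong (ψ.-‿homo a) (B.*-congˡ (ev-zeros n))) (B.+-comm _ _)
    where
    module B = CommutativeRing B
    module ψ = Hom ψ
    open Powers B
    ev-zeros : ∀ n → ev ψ (M A (replicate n 0#)) z B.≈ z ^ n
    ev-zeros zero    = B.trans (Evaluation.ev-const ψ 1# z) ψ.1-homo
    ev-zeros (suc n) = B.trans (B.+-cong ψ.0-homo (B.*-congˡ (ev-zeros n))) (B.+-identityˡ _)

  binomial-≋ : ∀ n .{{_ : ℕ.NonZero n}} a → M A (binomial n a) ≋ X ^ₚ n P.- (a ∷ [])
  binomial-≋ n a = P.trans (P.sym (ev-generic A (M A (binomial n a)))) (ev-binomial const n a X)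

  -- The sum of Xⁱ gᵢ(Xᵖ) over the listed polynomials gᵢ, in Horner form; with p of them it sorts
  -- exponents by their residue modulo p.
  interleave : ℕ → List Poly → Poly
  interleave p []       = []
  interleave p (g ∷ gs) = ev const g (X ^ₚ p) +ₚ X *ₚ interleave p gs

  interleave-∷ʳ : ∀ p gs g →
    interleave p (gs ∷ʳ g) ≋ interleave p gs +ₚ X ^ₚ length gs *ₚ ev const g (X ^ₚ p)
  interleave-∷ʳ p [] g = begin
      G +ₚ X *ₚ [] ≈⟨ P.+-congˡ {G} (P.zeroʳ X) ⟩
      G +ₚ [] ≈⟨ P.+-identityʳ G ⟩
      G ≈⟨ P.sym (P.*-identityˡ G) ⟩
      P.1# *ₚ G ∎
    where
    open ≈-Reasoning P.setoid
    G : Poly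
    G = ev const g (X ^ₚ p)
  interleave-∷ʳ p (g′ ∷ gs) g = begin
      G′ +ₚ X *ₚ interleave p (gs ∷ʳ g) ≈⟨ P.+-congˡ {G′} (P.*-congˡ {X} (interleave-∷ʳ p gs g)) ⟩
      G′ +ₚ X *ₚ (I +ₚ Y *ₚ G)
        ≈⟨ solve 5 (λ g′ x i y g → g′ :+ x :* (i :+ y :* g) := g′ :+ x :* i :+ x :* y :* g) P.refl G′ X I Y
          G ⟩
      (G′ +ₚ X *ₚ I) +ₚ X *ₚ Y *ₚ G ∎
    where
    open ≈-Reasoning P.setoid
    open IntegerSolver polyRing
    G G′ I Y : Poly
    G = ev const g (X ^ₚ p)
    G′ = ev const g′ (X ^ₚ p)
    I = interleave p gs
    Y = X ^ₚ length gs

  -- Multiplying by X rotates the p components: the last one returns to the front as X g, because X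
  -- · Xᵖ⁻¹ g(Xᵖ) = (X g)(Xᵖ), and its free constant term takes the new coefficient `a`.
  deinterleave : ∀ {Q : Carrier → Set} p .{{_ : ℕ.NonZero p}} {h} → All Q h →
    ∃[ gs ] All (All Q) gs × length gs ≡ p × h ≋ interleave p gs
  deinterleave {Q} (suc p) [] = replicate (suc p) [] , all-[] (suc p) , length-replicate (suc p) ,
    zero-≋ (suc p)
    where
    all-[] : ∀ n → All (All Q) (replicate n [])
    all-[] zero    = []
    all-[] (suc n) = [] ∷ all-[] n
    zero-≋ : ∀ n → [] ≋ interleave (suc p) (replicate n [])
    zero-≋ zero    = P.refl
    zero-≋ (suc n) = P.sym (P.trans (P.*-congˡ {X} (P.sym (zero-≋ n))) (P.zeroʳ X))
  deinterleave {Q} (suc p) {a ∷ h} (a∈ ∷ h∈) with deinterleave (suc p) h∈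
  ... | gs , gs∈ , |gs| , eq with initLast gs
  ...   | init ∷ʳ′ g = (a ∷ g) ∷ init , (a∈ ∷ proj₂ (∷ʳ⁻ gs∈)) ∷ proj₁ (∷ʳ⁻ gs∈) , ≡.cong suc |init| ,
    (begin
      a ∷ h ≈⟨ ∷-≋ A a h ⟩
      K +ₚ X *ₚ h ≈⟨ P.+-congˡ {K} (P.*-congˡ {X} (P.trans eq (interleave-∷ʳ (suc p) init g))) ⟩
      K +ₚ X *ₚ (I +ₚ X ^ₚ length init *ₚ G) ≡⟨ ≡.cong (λ j → K +ₚ X *ₚ (I +ₚ X ^ₚ j *ₚ G)) |init| ⟩
      K +ₚ X *ₚ (I +ₚ X ^ₚ p *ₚ G)
        ≈⟨ solve 5 (λ k x i y g → k :+ x :* (i :+ y :* g) := k :+ x :* y :* g :+ x :* i) P.refl K X I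
          (X ^ₚ p) G ⟩
      (K +ₚ X ^ₚ suc p *ₚ G) +ₚ X *ₚ I ∎)
    where
    open ≈-Reasoning P.setoid
    open IntegerSolver polyRing
    |init| : length init ≡ p
    |init| = ℕ.suc-injective (≡.trans (≡.trans (ℕ.+-comm 1 (length init)) (≡.sym (length-++ init))) |gs|)
    K G I : Poly
    K = a ∷ []
    G = ev const g (X ^ₚ suc p)
    I = interleave (suc p) init

module Capelli (F : DiscreteField) (S : Subfield F) {a : DiscreteField.Carrier F}
               (a∈ : Subfield._∈S S a) (a≉0 : ¬ (DiscreteField._≈_ F a (DiscreteField.0# F))) where
  open DiscreteField F
  open Subfield S
  open PolynomialRing 𝔽
  open Field F
  open Powers 𝔽
  private module P = CommutativeRing polyRing

  private
    eval : Poly → Carrier → Carrier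
    eval = ev (idHom {𝔽})

    evalHom : Carrier → Hom polyRing 𝔽
    evalHom = Evaluation.evHom (idHom {𝔽})

    M-monic : ∀ q → Monic.IsMonic 𝔽 (length q) (M 𝔽 q)
    M-monic = Monic.M-isMonic 𝔽

    binomial-∈ : (T : Subfield F) → let open Subfield T renaming (_∈S to _∈T) in
                 ∀ n {z} → z ∈T → All _∈T (binomial 𝔽 n z)
    binomial-∈ T zero    z∈ = []
    binomial-∈ T (suc n) z∈ = Subfield.neg-∈ T z∈ ∷ zeros n
      where
      zeros : ∀ n → All (Subfield._∈S T) (replicate n 0#)
      zeros zero    = []
      zeros (suc n) = 0-∈ T ∷ zeros n

    monic-multiple≋0 : ∀ t q → t *ₚ M 𝔽 q ≋ [] → t ≋ []
    monic-multiple≋0 t q eq = Monic.monic-multiple 𝔽 (M-monic q) t (λ {i} _ → at eq i)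

    monicPart-vanishes : (T : Subfield F) → ∀ {p x} (mp : MonicPart T p) → eval p x ≈ 0# →
                         eval (M 𝔽 (MonicPart.part mp)) x ≈ 0#
    monicPart-vanishes T {p} {x} mp px≈0 with field-product product≈0
      where
      open MonicPart mp
      open Hom (evalHom x)
      product≈0 : lead * eval (M 𝔽 part) x ≈ 0#
      product≈0 = trans (*-congʳ (sym (Evaluation.ev-const (idHom {𝔽}) lead x)))
        (trans (sym (*-homo (lead ∷ []) (M 𝔽 part))) (trans (sym (cong equation)) px≈0))
    ... | inj₂ eq     = eq
    ... | inj₁ lead≈0 = ⊥-elim (1≉0 (trans (sym inverse) (trans (*-congʳ lead≈0) (zeroˡ _))))
      where open MonicPart mp

  Xⁿ-a : ℕ → Poly
  Xⁿ-a n = M 𝔽 (binomial 𝔽 n a)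

  -- With xⁿ = a, this says that Xⁿ - a is the minimal polynomial of x over `S`. The annihilator
  -- form avoids degrees of extensions; the cofactor may have coefficients anywhere in `F`.
  Minimal : Carrier → ℕ → Set
  Minimal x n = ∀ {h} → All _∈S h → eval h x ≈ 0# → ∃[ t ] h ≋ t *ₚ Xⁿ-a n

  private
    open ≈-Reasoning setoid

    inverse-power : ∀ {b b′} n → b * b′ ≈ 1# → b ^ n * b′ ^ n ≈ 1#
    inverse-power n eq = trans (sym (^-distrib-* _ _ n)) (trans (^-congˡ n eq) (1^n≈1 n))

    quotient-power : ∀ p {z A B B′} → A ^ p ≈ z * B ^ p → B * B′ ≈ 1# → (A * B′) ^ p ≈ z
    quotient-power p {z} {A} {B} {B′} eq BB′≈1 = begin
      (A * B′) ^ p ≈⟨ ^-distrib-* A B′ p ⟩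
      A ^ p * B′ ^ p ≈⟨ *-congʳ eq ⟩
      z * B ^ p * B′ ^ p ≈⟨ *-assoc _ _ _ ⟩
      z * (B ^ p * B′ ^ p) ≈⟨ *-congˡ (inverse-power p BB′≈1) ⟩
      z * 1# ≈⟨ *-identityʳ z ⟩
      z ∎

  -- By Bézout, since i is prime to p.
  power-descent : ∀ {p i c z} → Prime p → 0 < i → i < p → c ∈S → z ∈S → ¬ z ≈ 0# →
                  c ^ p ≈ z ^ i → ∃[ b ] b ∈S × b ^ p ≈ z
  power-descent {p} {i} {c} {z} p-prime 0<i i<p c∈ z∈ z≉0 cᵖ≈zⁱ
    with zeroOrInverse z | zeroOrInverse c
  ... | inj₁ z≈0 | _ = ⊥-elim (z≉0 z≈0)
  ... | _ | inj₁ c≈0 = ⊥-elim (z≉0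
    (field-power i (trans (sym cᵖ≈zⁱ) (trans (^-congˡ p c≈0) (0^ p (ℕ.<-≤-trans 0<i (ℕ.<⇒≤ i<p)))))))
    where
    0^ : ∀ n → 0 < n → 0# ^ n ≈ 0#
    0^ (suc n) _ = zeroˡ _
  ... | inj₂ (z′ , zz′≈1) | inj₂ (c′ , cc′≈1)
    with coprime-Bézout (prime⇒coprime p-prime {{ℕ.>-nonZero 0<i}} i<p)
  ...   | Bézout.+- x y eq = z ^ x * c′ ^ y , *-∈ (^-∈ S x z∈) (^-∈ S y (inv-∈ cc′≈1 c∈)) ,
          quotient-power p (begin
            (z ^ x) ^ p ≈⟨ ^-assocʳ z x p ⟩
            z ^ (x ℕ.* p) ≡⟨ ≡.cong (z ^_) (≡.sym eq) ⟩
            z * z ^ (y ℕ.* i) ≈⟨ *-congˡ (^-assocʳ z y i) ⟨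
            z * (z ^ y) ^ i ≈⟨ *-congˡ (^-swap z y i) ⟩
            z * (z ^ i) ^ y ≈⟨ *-congˡ (^-congˡ y cᵖ≈zⁱ) ⟨
            z * (c ^ p) ^ y ≈⟨ *-congˡ (^-swap c p y) ⟩
            z * (c ^ y) ^ p ∎) (inverse-power y cc′≈1)
  ...   | Bézout.-+ x y eq = c ^ y * z′ ^ x , *-∈ (^-∈ S y c∈) (^-∈ S x (inv-∈ zz′≈1 z∈)) ,
          quotient-power p (begin
            (c ^ y) ^ p ≈⟨ ^-swap c y p ⟩
            (c ^ p) ^ y ≈⟨ ^-congˡ y cᵖ≈zⁱ ⟩
            (z ^ i) ^ y ≈⟨ ^-swap z i y ⟩
            (z ^ y) ^ i ≈⟨ ^-assocʳ z y i ⟩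
            z ^ (y ℕ.* i) ≡⟨ ≡.cong (z ^_) (≡.sym eq) ⟩
            z * z ^ (x ℕ.* p) ≈⟨ *-congˡ (^-assocʳ z x p) ⟨
            z * (z ^ x) ^ p ∎) (inverse-power x zz′≈1)

  -- i and c are the degree and the constant term of the minimal polynomial of x over T.
  constant-term : (T : Subfield F) → let open Subfield T renaming (_∈S to _∈T) in
    ∀ {p x y} → Odd p → x ^ p ≈ y → y ∈T → ∀ {g} → All _∈T g → length g < p → eval (M 𝔽 g) x ≈ 0# →
    ∃[ i ] ∃[ c ] 0 < i × i < p × c ∈T × c ^ p ≈ (- y) ^ i
  constant-term T {p} {x} {y} odd@(t , ≡.refl) xᵖ≈y y∈ {g} = go (length g) g ℕ.≤-refl
    where
    open Subfield T using () renaming (_∈S to _∈T)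
    q : List Carrier
    q = binomial 𝔽 p y
    qx≈0 : eval (M 𝔽 q) x ≈ 0#
    qx≈0 = trans (ev-binomial 𝔽 (idHom {𝔽}) p y x) (trans (+-congʳ xᵖ≈y) (-‿inverseʳ y))

    -- Every root b of a divisor of Xᵖ - y satisfies bᵖ = y, hence (-b)ᵖ = -y because p is odd. The
    -- constant term is the product of the -b, one for each degree.
    factor : ∀ g → All _∈T g → 0 < length g → length g < p → (∃[ t ] M 𝔽 q ≋ t *ₚ M 𝔽 g) →
             ∃[ i ] ∃[ c ] 0 < i × i < p × c ∈T × c ^ p ≈ (- y) ^ i
    factor g g∈ 0<|g| |g|<p (t , q≋tg) = length g , c , 0<|g| , |g|<p , ev-∈ T (M-∈ T g∈) (0-∈ T) ,
        Hom.injective φ φ-injective (R.begin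
          φ.⟦ c ^ p ⟧ R.≈⟨ φ.^-homo c p ⟩
          φ.⟦ c ⟧ ^ᴰ p R.≈⟨ D^.^-congˡ p φc≈ ⟩
          prod D (λ b → D.0# D.- b) roots ^ᴰ p R.≈⟨ Product.prod-^ D p _ roots ⟨
          prod D (λ b → (D.0# D.- b) ^ᴰ p) roots
            R.≈⟨ Product.prod-cong D (All.map (λ {b} → root-power b) (splits-roots φ {g} {roots} splits)) ⟩
          prod D (λ _ → φ.⟦ - y ⟧) roots R.≈⟨ Product.prod-const D _ roots ⟩
          φ.⟦ - y ⟧ ^ᴰ length roots R.≡⟨ ≡.cong (φ.⟦ - y ⟧ ^ᴰ_) length-roots ⟩
          φ.⟦ - y ⟧ ^ᴰ length g R.≈⟨ φ.^-homo (- y) (length g) ⟨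
          φ.⟦ (- y) ^ length g ⟧                   R.∎)
      where
      open SplittingRing (splittingRing {𝔽} g) renaming (ring to D)
      module D = CommutativeRing D
      module φ = Hom φ
      module R = ≈-Reasoning D.setoid
      module D^ = Powers D
      open D^ using () renaming (_^_ to _^ᴰ_)
      c : Carrier
      c = eval (M 𝔽 g) 0#
      φc≈ : φ.⟦ c ⟧ D.≈ prod D (λ b → D.0# D.- b) roots
      φc≈ = D.trans (ev-hom φ (idHom {𝔽}) (M 𝔽 g) 0#) (D.trans
        (ev-agree (φ ∘ʰ idHom {𝔽}) φ (λ _ → D.refl) (M 𝔽 g) φ.⟦ 0# ⟧) (D.trans
        (Evaluation.ev-cong φ (M 𝔽 g) (M 𝔽 g) (λ _ → refl) φ.0-homo) (D.trans
        (splits-ev φ {g} {roots} splits D.0#) (linearProduct-prod (idHom {D}) roots D.0#))))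
      root-power : ∀ b → ev φ (M 𝔽 g) b D.≈ D.0# → (D.0# D.- b) ^ᴰ p D.≈ φ.⟦ - y ⟧
      root-power b gb≈0 = R.begin
        (D.0# D.- b) ^ᴰ p R.≈⟨ D^.^-congˡ p (D.+-identityˡ _) ⟩
        (D.- b) ^ᴰ p R.≈⟨ D^.^-neg-odd odd b ⟩
        D.- (b ^ᴰ p) R.≈⟨ D.-‿cong (x∙y⁻¹≈ε⇒x≈y _ _ bᵖ-y≈0) ⟩
        D.- φ.⟦ y ⟧ R.≈⟨ φ.-‿homo y ⟨
        φ.⟦ - y ⟧           R.∎
        where
        open RingProperties D.ring using (x∙y⁻¹≈ε⇒x≈y)
        module evφ = Hom (Evaluation.evHom φ b)
        bᵖ-y≈0 : b ^ᴰ p D.- φ.⟦ y ⟧ D.≈ D.0#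
        bᵖ-y≈0 = D.trans (D.sym (ev-binomial 𝔽 φ p y b)) (D.trans (evφ.cong q≋tg) (D.trans
          (evφ.*-homo t (M 𝔽 g)) (D.trans (D.*-congˡ gb≈0) (D.zeroʳ _))))

    -- If g does not divide Xᵖ - y, the remainder also vanishes at x and has smaller degree; the
    -- descent ends at a divisor, since the constant polynomial 1 vanishes nowhere.
    go : ∀ n g → length g ≤ n → All _∈T g → length g < p → eval (M 𝔽 g) x ≈ 0# →
         ∃[ i ] ∃[ c ] 0 < i × i < p × c ∈T × c ^ p ≈ (- y) ^ i
    go n []        _     _  _     1≈0  =
      ⊥-elim (1≉0 (trans (sym (Evaluation.ev-const (idHom {𝔽}) 1# x)) 1≈0))
    go (suc n) g@(_ ∷ _) |g|≤ g∈ |g|<p gx≈0 with divide T (M-∈ T (binomial-∈ T p y∈)) g∈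
    ... | division with normalise T (Division.rem-∈ division)
    ...   | inj₁ r≋0 = factor g g∈ (s≤s z≤n) |g|<p
            (quot , P.trans equation (P.trans (P.+-congˡ {quot *ₚ M 𝔽 g} r≋0) (P.+-identityʳ _)))
      where open Division division
    ...   | inj₂ mp = go n part (ℕ.≤-pred (ℕ.≤-trans |part|<|g| |g|≤)) part-∈ (ℕ.<-trans |part|<|g| |g|<p)
            (monicPart-vanishes T mp rx≈0)
      where
      open MonicPart mp using (part; part-∈; |part|)
      open Division division
      open Hom (evalHom x)
      |part|<|g| : length part < length g
      |part|<|g| = ≡.subst (length part ℕ.<_) |rem| |part|
      rx≈0 : eval rem x ≈ 0#
      rx≈0 = begin
        eval rem x ≈⟨ +-identityˡ _ ⟨
        0# + eval rem x ≈⟨ +-congʳ (trans (*-congˡ gx≈0) (zeroʳ _)) ⟨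
        eval quot x * eval (M 𝔽 g) x + eval rem x ≈⟨ +-congʳ (*-homo quot (M 𝔽 g)) ⟨
        eval (quot *ₚ M 𝔽 g) x + eval rem x ≈⟨ +-homo (quot *ₚ M 𝔽 g) rem ⟨
        eval (quot *ₚ M 𝔽 g +ₚ rem) x ≈⟨ cong equation ⟨
        eval (M 𝔽 q) x ≈⟨ qx≈0 ⟩
        0# ∎

  module Generated {y : Carrier} {k : ℕ} .{{_ : ℕ.NonZero k}} (yᵏ≈a : y ^ k ≈ a) (min : Minimal y k) where
    private
      q : List Carrier
      q = binomial 𝔽 k a

      q∈ : All _∈S q
      q∈ = binomial-∈ S k a∈

      qy≈0 : eval (M 𝔽 q) y ≈ 0#
      qy≈0 = trans (ev-binomial 𝔽 (idHom {𝔽}) k a y) (trans (+-congʳ yᵏ≈a) (-‿inverseʳ a))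

      1≉0ₚ : ¬ P.1# ≋ []
      1≉0ₚ eq = 1≉0 (at eq 0)

    -- One of two factors vanishes at y and is thus a multiple of q by minimality. For b its degree
    -- is too small; for t = u q, cancelling the monic q leaves u b = 1 with b nonconstant.
    irreducible : IrreducibleOver S q
    irreducible b t b∈ t∈ 0<|b| |b|<|q| q≋tb with field-product ty*by≈0
      where
      open Hom (evalHom y)
      ty*by≈0 : eval t y * eval (M 𝔽 b) y ≈ 0#
      ty*by≈0 = trans (sym (*-homo t (M 𝔽 b))) (trans (sym (cong q≋tb)) qy≈0)
    ... | inj₂ by≈0 with u , b≋uq ← min (M-∈ S b∈) by≈0 =
      1≉0 (trans (sym (proj₁ (M-monic b))) (at b≋0 (length b)))
      where
      u≋0 : u ≋ []
      u≋0 = Monic.monic-multiple 𝔽 (M-monic q) u λ {i} |q|≤i →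
        trans (sym (at b≋uq i)) (proj₂ (M-monic b) (ℕ.<-≤-trans |b|<|q| |q|≤i))
      b≋0 : M 𝔽 b ≋ []
      b≋0 = P.trans b≋uq (P.trans (P.*-congʳ {M 𝔽 q} u≋0) (P.zeroˡ (M 𝔽 q)))
    ... | inj₁ ty≈0 with u , t≋uq ← min t∈ ty≈0 =
      1≉0ₚ (P.trans (P.sym ub≋1) (P.trans (P.*-congʳ {mb} {u} {[]} u≋0) (P.zeroˡ mb)))
      where
      open IntegerSolver polyRing
      mb mq : Poly
      mb = M 𝔽 b
      mq = M 𝔽 q
      ub-1≋0 : u *ₚ mb P.- P.1# ≋ []
      ub-1≋0 = monic-multiple≋0 _ q (P.trans
        (solve 3 (λ u b q → (u :* b :- con (+ 1)) :* q := u :* q :* b :- q) P.refl u mb mq)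
        (P.trans (P.+-cong (P.*-congʳ {mb} (P.sym t≋uq)) (P.-‿cong q≋tb)) (P.-‿inverseʳ (t *ₚ mb))))
      ub≋1 : u *ₚ mb ≋ P.1#
      ub≋1 = x∙y⁻¹≈ε⇒x≈y (u *ₚ mb) P.1# ub-1≋0
        where open RingProperties P.ring using (x∙y⁻¹≈ε⇒x≈y)
      u≋0 : u ≋ []
      u≋0 = Monic.monic-multiple 𝔽 (M-monic b) u λ { {zero} |b|≤0 → ⊥-elim (ℕ.<⇒≱ 0<|b| |b|≤0) ; {suc i} _ →
        at ub≋1 (suc i) }

    -- Membership asks for some polynomial over `S` with the given value at y, with no chosen
    -- representative; inverses come from Bézout modulo q, where `irreducible` enters.
    generated : Subfield F
    generated = record
      { _∈S   = λ z → ∃[ g ] All _∈S g × z ≈ eval g y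
      ; resp  = λ { z≈w (g , g∈ , eq) → g , g∈ , trans (sym z≈w) eq }
      ; 1-∈   = P.1# , 1-∈ ∷ [] , sym 1-homo
      ; +-∈   = λ { (g , g∈ , eq) (h , h∈ , eq′) → g +ₚ h , +ₚ-∈ S g∈ h∈ ,
        trans (+-cong eq eq′) (sym (+-homo g h)) }
      ; *-∈   = λ { (g , g∈ , eq) (h , h∈ , eq′) → g *ₚ h , *ₚ-∈ S g∈ h∈ ,
        trans (*-cong eq eq′) (sym (*-homo g h)) }
      ; neg-∈ = λ { (g , g∈ , eq) → -ₚ g , -ₚ-∈ S g∈ , trans (-‿cong eq) (sym (-‿homo g)) }
      ; inv-∈ = inverse-∈
      }
      where
      open Hom (evalHom y)
      inverse-∈ : ∀ {z w} → z * w ≈ 1# → (∃[ g ] All _∈S g × z ≈ eval g y) → ∃[ g ] All _∈S g × w ≈ eval g y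
      inverse-∈ {z} {w} zw≈1 (g , g∈ , z≈g) with zeroOrInverse-mod S q∈ irreducible g∈
      ... | inj₁ (t , g≋tq) = ⊥-elim (1≉0 (trans (sym zw≈1) (trans (*-congʳ z≈0) (zeroˡ w))))
        where
        z≈0 : z ≈ 0#
        z≈0 = trans z≈g (trans (cong g≋tq) (trans (*-homo t (M 𝔽 q)) (trans (*-congˡ qy≈0) (zeroʳ _))))
      ... | inj₂ (s , s∈ , u , sg≋1) = s , s∈ , (begin
        w ≈⟨ *-identityˡ w ⟨
        1# * w ≈⟨ *-congʳ sz≈1 ⟨
        eval s y * z * w ≈⟨ *-assoc _ _ _ ⟩
        eval s y * (z * w) ≈⟨ *-congˡ zw≈1 ⟩
        eval s y * 1# ≈⟨ *-identityʳ _ ⟩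
        eval s y ∎)
        where
        sz≈1 : eval s y * z ≈ 1#
        sz≈1 = begin
          eval s y * z ≈⟨ *-congˡ z≈g ⟩
          eval s y * eval g y ≈⟨ *-homo s g ⟨
          eval (s *ₚ g) y ≈⟨ cong sg≋1 ⟩
          eval (P.1# +ₚ u *ₚ M 𝔽 q) y ≈⟨ +-homo P.1# (u *ₚ M 𝔽 q) ⟩
          eval P.1# y + eval (u *ₚ M 𝔽 q) y
            ≈⟨ +-cong 1-homo (trans (*-homo u (M 𝔽 q)) (trans (*-congˡ qy≈0) (zeroʳ _))) ⟩
          1# + 0# ≈⟨ +-identityʳ 1# ⟩
          1# ∎

    open Subfield generated public using () renaming (_∈S to _∈S[y])

    generator-∈ : y ∈S[y]
    generator-∈ = X , 0-∈ S ∷ 1-∈ ∷ [] , sym (Evaluation.ev-X (idHom {𝔽}) y)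

    -- With z = g(y), the equation is a polynomial relation over `S` satisfied by y, hence a
    -- multiple of q and valid at every conjugate b of y. Its product over all b has N(z)ᵖ on the
    -- left and the i-th power of the product of the -b on the right; that product is q(0) = -a
    -- whatever the parity of k.
    norm-descent : ∀ p i {z} → z ∈S[y] → z ^ p ≈ (- y) ^ i → ∃[ c ] c ∈S × c ^ p ≈ (- a) ^ i
    norm-descent p i {z} (g , g∈ , z≈g) zᵖ≈ with Norm.resultant F S g∈ q∈
    ... | c , c∈ , norm = c , c∈ , Hom.injective φ φ-injective (R.begin
        φ.⟦ c ^ p ⟧ R.≈⟨ φ.^-homo c p ⟩
        φ.⟦ c ⟧ ^ᴰ p R.≈⟨ D^.^-congˡ p (norm φ roots length-roots splits) ⟨
        prod D (ev φ g) roots ^ᴰ p R.≈⟨ Product.prod-^ D p _ roots ⟨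
        prod D (λ b → ev φ g b ^ᴰ p) roots
          R.≈⟨ Product.prod-cong D (All.map (λ {b} → conjugate b) (splits-roots φ {q} {roots} splits)) ⟩
        prod D (λ b → (D.0# D.- b) ^ᴰ i) roots R.≈⟨ Product.prod-^ D i _ roots ⟩
        prod D (λ b → D.0# D.- b) roots ^ᴰ i R.≈⟨ D^.^-congˡ i norm-y ⟩
        φ.⟦ - a ⟧ ^ᴰ i R.≈⟨ φ.^-homo (- a) i ⟨
        φ.⟦ (- a) ^ i ⟧                           R.∎)
      where
      open SplittingRing (splittingRing {𝔽} q) renaming (ring to D)
      module D = CommutativeRing D
      module φ = Hom φ
      module R = ≈-Reasoning D.setoid
      module D^ = Powers D
      open D^ using () renaming (_^_ to _^ᴰ_)
      module P^ = Powers polyRing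
      open P^ using () renaming (_^_ to _^ₚ_)

      ^ₚ-∈ : ∀ {h} n → All _∈S h → All _∈S (h ^ₚ n)
      ^ₚ-∈ zero    h∈ = 1-∈ ∷ []
      ^ₚ-∈ (suc n) h∈ = *ₚ-∈ S h∈ (^ₚ-∈ n h∈)

      relation : Poly
      relation = g ^ₚ p +ₚ -ₚ ((-ₚ X) ^ₚ i)

      ev-relation : ∀ {B} (ψ : Hom 𝔽 B) w → let module B = CommutativeRing B in
        ev ψ relation w B.≈ Powers._^_ B (ev ψ g w) p B.- Powers._^_ B (B.- w) i
      ev-relation {B} ψ w = B.trans (+-homo (g ^ₚ p) (-ₚ ((-ₚ X) ^ₚ i))) (B.+-cong (^-homo g p)
        (B.trans (-‿homo ((-ₚ X) ^ₚ i))
          (B.-‿cong (B.trans (^-homo (-ₚ X) i) (Powers.^-congˡ B i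
          (B.trans (-‿homo X) (B.-‿cong (Evaluation.ev-X ψ w))))))))
        where
        module B = CommutativeRing B
        open Hom (Evaluation.evHom ψ w)

      multiple : ∃[ t ] relation ≋ t *ₚ M 𝔽 q
      multiple = min (+ₚ-∈ S (^ₚ-∈ p g∈) (-ₚ-∈ S (^ₚ-∈ i (-ₚ-∈ S (0-∈ S ∷ 1-∈ ∷ [])))))
        (trans (ev-relation (idHom {𝔽}) y) (trans (+-congʳ (trans (^-congˡ p (sym z≈g)) zᵖ≈))
          (-‿inverseʳ _)))

      conjugate : ∀ b → ev φ (M 𝔽 q) b D.≈ D.0# → ev φ g b ^ᴰ p D.≈ (D.0# D.- b) ^ᴰ i
      conjugate b qb≈0 = D.trans (x∙y⁻¹≈ε⇒x≈y _ _ (D.trans (D.sym (ev-relation φ b))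
        (D.trans (evφ.cong (proj₂ multiple))
        (D.trans (evφ.*-homo (proj₁ multiple) (M 𝔽 q)) (D.trans (D.*-congˡ qb≈0) (D.zeroʳ _))))))
        (D^.^-congˡ i (D.sym (D.+-identityˡ _)))
        where
        open RingProperties D.ring using (x∙y⁻¹≈ε⇒x≈y)
        module evφ = Hom (Evaluation.evHom φ b)

      norm-y : prod D (λ b → D.0# D.- b) roots D.≈ φ.⟦ - a ⟧
      norm-y = R.begin
        prod D (λ b → D.0# D.- b) roots R.≈⟨ linearProduct-prod (idHom {D}) roots D.0# ⟨
        linearProduct (idHom {D}) roots D.0# R.≈⟨ splits-ev φ {q} {roots} splits D.0# ⟨
        ev φ (M 𝔽 q) D.0# R.≈⟨ ev-binomial 𝔽 φ k a D.0# ⟩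
        D.0# ^ᴰ k D.- φ.⟦ a ⟧ R.≈⟨ D.+-congʳ (0^ k) ⟩
        D.0# D.- φ.⟦ a ⟧ R.≈⟨ D.+-identityˡ _ ⟩
        D.- φ.⟦ a ⟧ R.≈⟨ φ.-‿homo a ⟨
        φ.⟦ - a ⟧                                 R.∎
        where
        0^ : ∀ n .{{_ : ℕ.NonZero n}} → D.0# ^ᴰ n D.≈ D.0#
        0^ (suc n) = D.zeroˡ _

  -- Sorting h by exponents modulo p makes h(x) a polynomial in x of length p over S[y], with
  -- coefficients gᵢ(y). If all of these vanish, Xᵏ - a divides each gᵢ and substituting Xᵖ gives
  -- the claim; otherwise x has degree below p over S[y], and `constant-term`, `norm-descent` and
  -- `power-descent` make -a a p-th power.
  prime-step : ∀ {p k} → Prime p → Odd p → .{{_ : ℕ.NonZero k}} → ¬ (∃[ b ] b ∈S × b ^ p ≈ a) →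
               ∀ {x} → (x ^ p) ^ k ≈ a → Minimal (x ^ p) k → Minimal x (p ℕ.* k)
  prime-step {p} {k} p-prime odd not-power {x} yᵏ≈a min {h} h∈ hx≈0
    = conclude (deinterleave 𝔽 p {{prime⇒nonZero p-prime}} h∈)
    where
    open Generated yᵏ≈a min
    open Powers polyRing using () renaming (_^_ to _^ₚ_; ^-assocʳ to ^ₚ-assocʳ)
    y : Carrier
    y = x ^ p

    value : Poly → Carrier
    value g = eval g y

    values-∈ : ∀ {gs} → All (All _∈S) gs → All _∈S[y] (map value gs)
    values-∈ []          = []
    values-∈ (g∈ ∷ gs∈) = (_ , g∈ , refl) ∷ values-∈ gs∈

    Xᵖ : Poly
    Xᵖ = X ^ₚ p

    eval-interleave : ∀ gs → eval (interleave 𝔽 p gs) x ≈ eval (map value gs) x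
    eval-interleave []       = refl
    eval-interleave (g ∷ gs) = begin
      eval (ev const g Xᵖ +ₚ X *ₚ I) x ≈⟨ +-homo (ev const g Xᵖ) (X *ₚ I) ⟩
      eval (ev const g Xᵖ) x + eval (X *ₚ I) x
        ≈⟨ +-cong subst-eval (trans (*-homo X I) (*-cong (Evaluation.ev-X (idHom {𝔽}) x)
          (eval-interleave gs))) ⟩
      eval g y + x * eval (map value gs) x ∎
      where
      open Hom (evalHom x)
      I : Poly
      I = interleave 𝔽 p gs
      subst-eval : eval (ev const g Xᵖ) x ≈ eval g y
      subst-eval = trans (ev-hom (evalHom x) const g Xᵖ) (trans
        (ev-agree (evalHom x ∘ʰ const) (idHom {𝔽}) (λ c → Evaluation.ev-const (idHom {𝔽}) c x) g _)
        (Evaluation.ev-cong (idHom {𝔽}) g g (λ _ → refl) (trans (^-homo X p)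
          (^-congˡ p (Evaluation.ev-X (idHom {𝔽}) x)))))

    binomial-subst : ev const (Xⁿ-a k) Xᵖ ≋ Xⁿ-a (p ℕ.* k)
    binomial-subst = P.trans (ev-binomial 𝔽 const k a Xᵖ) (P.trans
      (P.+-congʳ {P.- (a ∷ [])} (^ₚ-assocʳ X p k))
      (P.sym (binomial-≋ 𝔽 (p ℕ.* k) {{ℕ.m*n≢0 p k {{prime⇒nonZero p-prime}}}} a)))

    interleave-divisible : ∀ {gs} → All (All _∈S) gs → map value gs ≋ [] →
      ∃[ t ] interleave 𝔽 p gs ≋ t *ₚ Xⁿ-a (p ℕ.* k)
    interleave-divisible [] _ = [] , P.refl
    interleave-divisible {g ∷ gs} (g∈ ∷ gs∈) zero-values
      with t , g≋ ← min g∈ (at zero-values 0)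
      with t′ , gs≋ ← interleave-divisible gs∈ ⟨ (λ i → at zero-values (suc i)) ⟩
      = ev const t Xᵖ +ₚ X *ₚ t′ , P.trans (P.+-cong
          (P.trans (cong g≋) (P.trans (*-homo t (Xⁿ-a k)) (P.*-congˡ {ev const t Xᵖ} binomial-subst)))
          (P.*-congˡ {X} gs≋))
          (solve 4 (λ t x t′ b → t :* b :+ x :* (t′ :* b) := (t :+ x :* t′) :* b) P.refl (ev const t Xᵖ) X
            t′ (Xⁿ-a (p ℕ.* k)))
      where
      open Hom (Evaluation.evHom const Xᵖ)
      open IntegerSolver polyRing

    open RingProperties ring using (-‿involutive; -0#≈0#)

    -a≉0 : ¬ - a ≈ 0#
    -a≉0 eq = a≉0 (trans (sym (-‿involutive a)) (trans (-‿cong eq) -0#≈0#))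

    -a-not-power : ∃[ b ] b ∈S × b ^ p ≈ - a → ⊥
    -a-not-power (b , b∈ , bᵖ≈-a) =
      not-power (- b , neg-∈ b∈ , trans (^-neg-odd odd b) (trans (-‿cong bᵖ≈-a) (-‿involutive a)))

    no-proper-factor : ∀ {g} → All _∈S[y] g → length g < p → ¬ eval (M 𝔽 g) x ≈ 0#
    no-proper-factor g∈ |g|<p gx≈0 = descend (constant-term generated odd refl generator-∈ g∈ |g|<p gx≈0)
      where
      descend : ∃[ i ] ∃[ c ] 0 < i × i < p × c ∈S[y] × c ^ p ≈ (- y) ^ i → ⊥
      descend (i , c , 0<i , i<p , c∈ , cᵖ≈) = descend′ (norm-descent p i c∈ cᵖ≈)
        where
        descend′ : ∃[ d ] d ∈S × d ^ p ≈ (- a) ^ i → ⊥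
        descend′ (d , d∈ , dᵖ≈) = -a-not-power (power-descent p-prime 0<i i<p d∈ (neg-∈ a∈) -a≉0 dᵖ≈)

    conclude : ∃[ gs ] All (All _∈S) gs × length gs ≡ p × h ≋ interleave 𝔽 p gs →
               ∃[ t ] h ≋ t *ₚ Xⁿ-a (p ℕ.* k)
    conclude (gs , gs∈ , |gs| , h≋) = cases (normalise generated (values-∈ gs∈))
      where
      divisible : ∃[ t ] interleave 𝔽 p gs ≋ t *ₚ Xⁿ-a (p ℕ.* k) →
                  ∃[ t ] h ≋ t *ₚ Xⁿ-a (p ℕ.* k)
      divisible (t , eq) = t , P.trans h≋ eq

      gsx≈0 : eval (map value gs) x ≈ 0#
      gsx≈0 = trans (sym (eval-interleave gs)) (trans (sym (Hom.cong (evalHom x) h≋)) hx≈0)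

      cases : map value gs ≋ [] ⊎ MonicPart generated (map value gs) →
              ∃[ t ] h ≋ t *ₚ Xⁿ-a (p ℕ.* k)
      cases (inj₁ zero-values) = divisible (interleave-divisible gs∈ zero-values)
      cases (inj₂ mp) = ⊥-elim (no-proper-factor (MonicPart.part-∈ mp)
        (≡.subst (length (MonicPart.part mp) ℕ.<_) (≡.trans (length-map value gs) |gs|)
          (MonicPart.|part| mp))
        (monicPart-vanishes generated mp gsx≈0))

  capelli : ∀ {ps} → All (λ p → Prime p × Odd p × ¬ (∃[ b ] b ∈S × b ^ p ≈ a)) ps →
            ∀ {x} → x ^ product ps ≈ a → Minimal x (product ps)
  -- For n = 1 the divisor is X - a, and the constant remainder equals h(x) = 0.
  capelli [] {x} x≈a {h} h∈ hx≈0
    with divide S h∈ (binomial-∈ S 1 a∈)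
  ... | record { quot = t ; rem = r ∷ [] ; equation = eq } = t , P.trans eq (P.trans (P.+-congˡ {t *ₚ q}
          ⟨ (λ { zero → r≈0 ; (suc i) → refl }) ⟩) (P.+-identityʳ _))
    where
    open Hom (evalHom x)
    q : Poly
    q = M 𝔽 (binomial 𝔽 1 a)
    r≈0 : r ≈ 0#
    r≈0 = begin
      r ≈⟨ +-identityˡ r ⟨
      0# + r ≈⟨ +-cong (trans (*-congˡ qx≈0) (zeroʳ _)) (Evaluation.ev-const (idHom {𝔽}) r x) ⟨
      eval t x * eval q x + eval (r ∷ []) x ≈⟨ +-congʳ (*-homo t q) ⟨
      eval (t *ₚ q) x + eval (r ∷ []) x ≈⟨ +-homo (t *ₚ q) (r ∷ []) ⟨
      eval (t *ₚ q +ₚ (r ∷ [])) x ≈⟨ cong eq ⟨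
      eval h x ≈⟨ hx≈0 ⟩
      0# ∎
      where
      qx≈0 : eval q x ≈ 0#
      qx≈0 = trans (ev-binomial 𝔽 (idHom {𝔽}) 1 a x) (trans (+-congʳ x≈a) (-‿inverseʳ a))
  capelli {p ∷ ps} ((p-prime , odd , not-power) ∷ rest) {x} xⁿ≈a =
    prime-step p-prime odd {{ℕ.>-nonZero (productOfPrimes≥1 (All.map proj₁ rest))}} not-power yᵏ≈a
      (capelli rest yᵏ≈a)
    where
    yᵏ≈a : (x ^ p) ^ product ps ≈ a
    yᵏ≈a = trans (^-assocʳ x p (product ps)) xⁿ≈a

-- Dickson polynomials

open Defs using (ℚ[Z]; ℚ[Z]-rawSemiring; F-coeff; f)

-- The coefficient of c^j z^(n-2j) in the n-th Dickson polynomial, up to sign.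
lucas : ℕ → ℕ → ℕ
lucas 0             0       = 2
lucas 0             (suc j) = 0
lucas 1             0       = 1
lucas 1             (suc j) = 0
lucas (suc (suc n)) 0       = lucas (suc n) 0
lucas (suc (suc n)) (suc j) = lucas (suc n) (suc j) ℕ.+ lucas n j

lucas-vanishes : ∀ n j → n < 2 ℕ.* j → lucas n j ≡ 0
lucas-vanishes 0             (suc j) _ = ≡.refl
lucas-vanishes 1             (suc j) _ = ≡.refl
lucas-vanishes (suc (suc n)) (suc j) n<2j = ≡.cong₂ ℕ._+_
  (lucas-vanishes (suc n) (suc j) (ℕ.<-trans (ℕ.n<1+n _) n<2j))
  (lucas-vanishes n j (ℕ.≤-pred (ℕ.≤-pred (≡.subst (3 ℕ.+ n ℕ.≤_) (ℕ.*-suc 2 j) n<2j))))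

lucas-0 : ∀ n → lucas (suc n) 0 ≡ 1
lucas-0 zero    = ≡.refl
lucas-0 (suc n) = lucas-0 n

private
  nC0≡1 : ∀ n → n choose 0 ≡ 1
  nC0≡1 zero    = ≡.refl
  nC0≡1 (suc n) = ≡.refl

-- With l = n - j, the coefficient (l + j)/l · binom(l, j) has the division-free form binom(l, j) +
-- binom(l - 1, j - 1), on which Pascal's rule reproduces the recurrence of `lucas`.
lucas-closed : ∀ n j → lucas (suc n ℕ.+ suc j) (suc j) ≡ suc n choose suc j ℕ.+ n choose j
lucas-closed zero    zero    = ≡.refl
lucas-closed zero    (suc j) = ≡.trans (lucas-vanishes (3 ℕ.+ j) (2 ℕ.+ j)
    (≡.subst (4 ℕ.+ j ℕ.≤_) (solve 1 (λ j → con 4 :+ j :+ j := con 2 :* (con 2 :+ j)) ≡.refl j)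
      (ℕ.m≤m+n (4 ℕ.+ j) j)))
  (≡.sym (≡.cong₂ ℕ._+_ (k>n⇒nCk≡0 {1} {2 ℕ.+ j} (s≤s (s≤s z≤n))) (k>n⇒nCk≡0 {0} {suc j} (s≤s z≤n))))
  where open ℕSolver
lucas-closed (suc n) zero    = begin
  lucas (suc n ℕ.+ 1) 1 ℕ.+ lucas (n ℕ.+ 1) 0
    ≡⟨ ≡.cong₂ ℕ._+_ (lucas-closed n 0) (≡.trans (≡.cong (λ k → lucas k 0) (ℕ.+-comm n 1)) (lucas-0 n)) ⟩
  suc n choose 1 ℕ.+ n choose 0 ℕ.+ 1 ≡⟨ ≡.cong (λ k → suc n choose 1 ℕ.+ k ℕ.+ 1) (nC0≡1 n) ⟩
  suc n choose 1 ℕ.+ 1 ℕ.+ 1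
    ≡⟨ ≡.cong (ℕ._+ 1) (≡.trans (ℕ.+-comm _ 1) (nCk+nC[k+1]≡[n+1]C[k+1] (suc n) 0)) ⟩
  suc (suc n) choose 1 ℕ.+ 1 ∎
  where open ≡.≡-Reasoning
lucas-closed (suc n) (suc j) = begin
  lucas (suc n ℕ.+ suc (suc j)) (suc (suc j)) ℕ.+ lucas (n ℕ.+ suc (suc j)) (suc j)
    ≡⟨ ≡.cong₂ ℕ._+_ (lucas-closed n (suc j)) (≡.trans (≡.cong (λ k → lucas k (suc j)) (ℕ.+-suc n (suc j)))
      (lucas-closed n j)) ⟩
  suc n choose suc (suc j) ℕ.+ n choose suc j ℕ.+ (suc n choose suc j ℕ.+ n choose j)
    ≡⟨ solve 4 (λ a b c d → a :+ b :+ (c :+ d) := (c :+ a) :+ (d :+ b)) ≡.refl (suc n choose suc (suc j))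
      (n choose suc j) (suc n choose suc j) (n choose j) ⟩
  (suc n choose suc j ℕ.+ suc n choose suc (suc j)) ℕ.+ (n choose j ℕ.+ n choose suc j)
    ≡⟨ ≡.cong₂ ℕ._+_ (nCk+nC[k+1]≡[n+1]C[k+1] (suc n) (suc j)) (nCk+nC[k+1]≡[n+1]C[k+1] n j) ⟩
  suc (suc n) choose suc (suc j) ℕ.+ suc n choose suc j ∎
  where
  open ≡.≡-Reasoning
  open ℕSolver

C-absorption : ∀ n k → suc n ℕ.* (n choose k) ≡ suc k ℕ.* (suc n choose suc k)
C-absorption n zero = begin
  suc n ℕ.* (n choose 0) ≡⟨ ≡.cong (suc n ℕ.*_) (nC0≡1 n) ⟩
  suc n ℕ.* 1 ≡⟨ ℕ.*-comm (suc n) 1 ⟩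
  1 ℕ.* suc n ≡⟨ ≡.cong (1 ℕ.*_) (≡.sym (nC1≡n (suc n))) ⟩
  1 ℕ.* (suc n choose 1) ∎
  where open ≡.≡-Reasoning
C-absorption zero (suc k) = ≡.trans (≡.cong (1 ℕ.*_) (k>n⇒nCk≡0 {0} {suc k} (s≤s z≤n))) (≡.sym
  (≡.trans (≡.cong (suc (suc k) ℕ.*_) (k>n⇒nCk≡0 {1} {2 ℕ.+ k} (s≤s (s≤s z≤n)))) (ℕ.*-zeroʳ (suc (suc k)))))
C-absorption (suc n) (suc k) = begin
  suc m ℕ.* a ≡⟨ ≡.cong (λ a → suc m ℕ.* a) (≡.sym pascal) ⟩
  suc m ℕ.* (n choose k ℕ.+ n choose suc k)
    ≡⟨ solve 3 (λ m x y → (con 1 :+ m) :* (x :+ y) := (x :+ y) :+ (m :* x :+ m :* y)) ≡.refl m (n choose k)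
      (n choose suc k) ⟩
  (n choose k ℕ.+ n choose suc k) ℕ.+ (m ℕ.* (n choose k) ℕ.+ m ℕ.* (n choose suc k))
    ≡⟨ ≡.cong₂ ℕ._+_ pascal (≡.cong₂ ℕ._+_ (C-absorption n k) (C-absorption n (suc k))) ⟩
  a ℕ.+ (suc k ℕ.* a ℕ.+ suc (suc k) ℕ.* b)
    ≡⟨ solve 3 (λ k a b → a :+ ((con 1 :+ k) :* a :+ (con 2 :+ k) :* b) := (con 2 :+ k) :* (a :+ b)) ≡.refl
      k a b ⟩
  suc (suc k) ℕ.* (a ℕ.+ b) ≡⟨ ≡.cong (suc (suc k) ℕ.*_) (nCk+nC[k+1]≡[n+1]C[k+1] m (suc k)) ⟩
  suc (suc k) ℕ.* (suc m choose suc (suc k)) ∎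
  where
  open ≡.≡-Reasoning
  open ℕSolver
  m a b : ℕ
  m = suc n
  a = m choose suc k
  b = m choose suc (suc k)
  pascal : n choose k ℕ.+ n choose suc k ≡ a
  pascal = nCk+nC[k+1]≡[n+1]C[k+1] n k

lucas-C : ∀ n j → suc n ℕ.* lucas (suc n ℕ.+ j) j ≡ (suc n ℕ.+ j) ℕ.* (suc n choose j)
lucas-C n zero    = ≡.cong₂ ℕ._*_ (≡.sym (ℕ.+-identityʳ (suc n))) (lucas-0 (n ℕ.+ 0))
lucas-C n (suc j) = begin
  suc n ℕ.* lucas (suc n ℕ.+ suc j) (suc j) ≡⟨ ≡.cong (suc n ℕ.*_) (lucas-closed n j) ⟩
  suc n ℕ.* (suc n choose suc j ℕ.+ n choose j)
    ≡⟨ ℕ.*-distribˡ-+ (suc n) (suc n choose suc j) (n choose j) ⟩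
  suc n ℕ.* (suc n choose suc j) ℕ.+ suc n ℕ.* (n choose j)
    ≡⟨ ≡.cong (suc n ℕ.* (suc n choose suc j) ℕ.+_) (C-absorption n j) ⟩
  suc n ℕ.* (suc n choose suc j) ℕ.+ suc j ℕ.* (suc n choose suc j)
    ≡⟨ ℕ.*-distribʳ-+ (suc n choose suc j) (suc n) (suc j) ⟨
  (suc n ℕ.+ suc j) ℕ.* (suc n choose suc j) ∎
  where open ≡.≡-Reasoning

ℚ-ring : CRing
ℚ-ring = ℚ.+-*-commutativeRing

module ℚ^ = Exp (CommutativeRing.commutativeSemiring ℚ-ring)

F-coeff-lucas : ∀ k j .{{_ : ℕ.NonZero (k ∸ j)}} →
                F-coeff k j ≡ (ℚ.- 1ℚ) ℚ^.^ j ℚ.* (+ lucas k j ℚ./ 1)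
F-coeff-lucas k j {{nz}} = ≡.trans (ℚ.*-assoc ((ℚ.- 1ℚ) ℚ^.^ j) (+ k ℚ./ (k ∸ j))
  (+ ((k ∸ j) choose j) ℚ./ 1)) (≡.cong ((ℚ.- 1ℚ) ℚ^.^ j ℚ.*_) (go (k ∸ j) ≡.refl))
  where
  go : ∀ l .{{_ : ℕ.NonZero l}} → k ∸ j ≡ l →
       (+ k ℚ./ l) ℚ.* (+ (l choose j) ℚ./ 1) ≡ + lucas k j ℚ./ 1
  -- Unnormalised fractions avoid the gcd in `_/_` and reduce the claim to a cross multiplication of
  -- naturals.
  go (suc l) eq = ℚ.toℚᵘ-injective (begin
    toℚᵘ ((+ k ℚ./ suc l) ℚ.* (+ c ℚ./ 1)) ≈⟨ ℚ.toℚᵘ-homo-* (+ k ℚ./ suc l) (+ c ℚ./ 1) ⟩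
    toℚᵘ (+ k ℚ./ suc l) ℚᵘ.* toℚᵘ (+ c ℚ./ 1)
      ≈⟨ ℚᵘ.*-cong (ℚ.toℚᵘ-fromℚᵘ (mkℚᵘ (+ k) l)) (ℚ.toℚᵘ-fromℚᵘ (mkℚᵘ (+ c) 0)) ⟩
    mkℚᵘ (+ k) l ℚᵘ.* mkℚᵘ (+ c) 0 ≈⟨ *≡* numerators ⟩
    mkℚᵘ (+ lucas k j) 0 ≈⟨ ℚ.toℚᵘ-fromℚᵘ (mkℚᵘ (+ lucas k j) 0) ⟨
    toℚᵘ (+ lucas k j ℚ./ 1) ∎)
    where
    open ≈-Reasoning ℚᵘ.≃-setoid
    c : ℕ
    c = suc l choose j
    -- A nonzero truncated difference forces j < k, so it is the true difference.
    k≡ : k ≡ suc l ℕ.+ j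
    k≡ = ≡.trans (≡.sym (ℕ.m∸n+n≡m {k} {j}
      (ℕ.<⇒≤ (ℕ.m∸n≢0⇒n<m {k} {j} λ eq′ → case (≡.trans (≡.sym eq′) eq))))) (≡.cong (ℕ._+ j) eq)
      where
      case : ¬ 0 ≡ suc l
      case ()
    naturals : k ℕ.* c ≡ lucas k j ℕ.* suc l
    naturals = ≡.subst (λ k → k ℕ.* c ≡ lucas k j ℕ.* suc l) (≡.sym k≡)
      (≡.trans (≡.sym (lucas-C l j)) (ℕ.*-comm (suc l) _))
    numerators : (+ k ℤ.* + c) ℤ.* + 1 ≡ + lucas k j ℤ.* + (suc l ℕ.* 1)
    numerators = ≡.trans (ℤ.*-identityʳ _) (≡.trans (≡.sym (ℤ.pos-* k c)) (≡.trans (≡.cong +_ naturals)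
      (≡.trans (≡.cong (λ x → + (lucas k j ℕ.* x)) (≡.sym (ℕ.*-identityʳ (suc l))))
        (ℤ.pos-* (lucas k j) (suc l ℕ.* 1)))))

/1-+ : ∀ m n → + (m ℕ.+ n) ℚ./ 1 ≡ (+ m ℚ./ 1) ℚ.+ (+ n ℚ./ 1)
/1-+ m n = ℚ.toℚᵘ-injective (begin
  toℚᵘ (+ (m ℕ.+ n) ℚ./ 1) ≈⟨ ℚ.toℚᵘ-fromℚᵘ (mkℚᵘ (+ (m ℕ.+ n)) 0) ⟩
  mkℚᵘ (+ (m ℕ.+ n)) 0
    ≈⟨ *≡* (≡.cong (ℤ._* + 1) (≡.cong₂ ℤ._+_ (≡.sym (ℤ.*-identityʳ (+ m))) (≡.sym (ℤ.*-identityʳ (+ n))))) ⟩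
  mkℚᵘ (+ m) 0 ℚᵘ.+ mkℚᵘ (+ n) 0
    ≈⟨ ℚᵘ.+-cong (ℚ.toℚᵘ-fromℚᵘ (mkℚᵘ (+ m) 0)) (ℚ.toℚᵘ-fromℚᵘ (mkℚᵘ (+ n) 0)) ⟨
  toℚᵘ (+ m ℚ./ 1) ℚᵘ.+ toℚᵘ (+ n ℚ./ 1) ≈⟨ ℚ.toℚᵘ-homo-+ (+ m ℚ./ 1) (+ n ℚ./ 1) ⟨
  toℚᵘ ((+ m ℚ./ 1) ℚ.+ (+ n ℚ./ 1)) ∎)
  where open ≈-Reasoning ℚᵘ.≃-setoid

module _ (A : CRing) where
  open CommutativeRing A

  -- The n-th Dickson polynomial at z: u^n + v^n for u + v = z and uv = c.
  dickson : Carrier → Carrier → ℕ → Carrier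
  dickson c z 0             = 1# + 1#
  dickson c z 1             = z
  dickson c z (suc (suc n)) = z * dickson c z (suc n) - c * dickson c z n

module _ {A B : CRing} (φ : Hom A B) where
  open CommutativeRing B
  open Hom φ

  dickson-homo : ∀ c z n → ⟦ dickson A c z n ⟧ ≈ dickson B ⟦ c ⟧ ⟦ z ⟧ n
  dickson-homo c z 0             = trans (+-homo _ _) (+-cong 1-homo 1-homo)
  dickson-homo c z 1             = refl
  dickson-homo c z (suc (suc n)) = trans (+-homo _ _) (+-cong
    (trans (*-homo _ _) (*-congˡ (dickson-homo c z (suc n))))
    (trans (-‿homo _) (-‿cong (trans (*-homo _ _) (*-congˡ (dickson-homo c z n))))))

module DicksonProperties (A : CRing) where
  open CommutativeRing A
  open Powers A
  open IntegerSolver A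
  open ≈-Reasoning setoid

  dickson-cong : ∀ {c d z w} → c ≈ d → z ≈ w → ∀ n → dickson A c z n ≈ dickson A d w n
  dickson-cong c≈d z≈w 0             = refl
  dickson-cong c≈d z≈w 1             = z≈w
  dickson-cong c≈d z≈w (suc (suc n)) = +-cong (*-cong z≈w (dickson-cong c≈d z≈w (suc n)))
    (-‿cong (*-cong c≈d (dickson-cong c≈d z≈w n)))

  dickson-power-sum : ∀ u v n → dickson A (u * v) (u + v) n ≈ u ^ n + v ^ n
  dickson-power-sum u v 0             = refl
  dickson-power-sum u v 1             = +-cong (sym (*-identityʳ u)) (sym (*-identityʳ v))
  dickson-power-sum u v (suc (suc n)) = begin
    (u + v) * dickson A (u * v) (u + v) (suc n) - u * v * dickson A (u * v) (u + v) n
      ≈⟨ +-cong (*-congˡ (dickson-power-sum u v (suc n))) (-‿cong (*-congˡ (dickson-power-sum u v n))) ⟩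
    (u + v) * (u * u ^ n + v * v ^ n) - u * v * (u ^ n + v ^ n)
      ≈⟨ solve 4 (λ u v x y → (u :+ v) :* (u :* x :+ v :* y) :- u :* v :* (x :+ y) := u :* (u :* x) :+ v :*
        (v :* y)) refl u v (u ^ n) (v ^ n) ⟩
    u * (u * u ^ n) + v * (v * v ^ n) ∎

  dickson-factor : ∀ c x y n → ∃[ q ] dickson A c x n - dickson A c y n ≈ (x - y) * q
  dickson-factor c x y 0 = 0# , trans (-‿inverseʳ _) (sym (zeroʳ _))
  dickson-factor c x y 1 = 1# , sym (*-identityʳ _)
  dickson-factor c x y (suc (suc n)) with dickson-factor c x y (suc n) | dickson-factor c x y n
  ... | q , eq | r , eq′ = y * q + dickson A c x (suc n) - c * r , (begin
    x * a - c * b - (y * a′ - c * b′)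
      ≈⟨ solve 7 (λ x y c a b a′ b′ → x :* a :- c :* b :- (y :* a′ :- c :* b′) := y :* (a :- a′) :+ (x :- y)
        :* a :- c :* (b :- b′))
           refl x y c a b a′ b′ ⟩
    y * (a - a′) + (x - y) * a - c * (b - b′)
      ≈⟨ +-cong (+-congʳ (*-congˡ eq)) (-‿cong (*-congˡ eq′)) ⟩
    y * ((x - y) * q) + (x - y) * a - c * ((x - y) * r)
      ≈⟨ solve 6 (λ x y c a q r → y :* ((x :- y) :* q) :+ (x :- y) :* a :- c :* ((x :- y) :* r) := (x :- y)
        :* (y :* q :+ a :- c :* r))
           refl x y c a q r ⟩
    (x - y) * (y * q + a - c * r) ∎)
    where
    a b a′ b′ : Carrier
    a  = dickson A c x (suc n)
    b  = dickson A c x n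
    a′ = dickson A c y (suc n)
    b′ = dickson A c y n

-- Adjoining the roots of T² - zT + c makes both sides sums of powers.
dickson-∘ : ∀ A c z k n → let open CommutativeRing A in
            dickson A (Powers._^_ A c k) (dickson A c z k) n ≈ dickson A c z (k ℕ.* n)
dickson-∘ A c z k n with splittingRing {A} (c ∷ CommutativeRing.-_ A z ∷ [])
... | record { ring = E ; φ = φ ; φ-injective = inj ; roots = u ∷ v ∷ [] ; splits = splits } =
  Hom.injective φ inj (begin
  φ.⟦ dickson A (c A^.^ k) (dickson A c z k) n ⟧ ≈⟨ dickson-homo φ (c A^.^ k) (dickson A c z k) n ⟩
  dickson E φ.⟦ c A^.^ k ⟧ φ.⟦ dickson A c z k ⟧ n
    ≈⟨ dickson-cong (trans (φ.^-homo c k) (trans (^-congˡ k c≈) (^-distrib-* u v k))) (power-sum k) n ⟩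
  dickson E (u ^ k * v ^ k) (u ^ k + v ^ k) n ≈⟨ dickson-power-sum (u ^ k) (v ^ k) n ⟩
  (u ^ k) ^ n + (v ^ k) ^ n ≈⟨ +-cong (^-assocʳ u k n) (^-assocʳ v k n) ⟩
  u ^ (k ℕ.* n) + v ^ (k ℕ.* n) ≈⟨ power-sum (k ℕ.* n) ⟨
  φ.⟦ dickson A c z (k ℕ.* n) ⟧ ∎)
  where
  module A = CommutativeRing A
  module A^ = Powers A
  module φ = Hom φ
  open CommutativeRing E
  open Powers E
  open DicksonProperties E
  open IntegerSolver E
  open ≈-Reasoning setoid
  factored : ∀ x → φ.⟦ c ⟧ + x * (φ.⟦ A.- z ⟧ + x * (φ.⟦ A.1# ⟧ + x * 0#)) ≈ (x - u) * ((x - v) * 1#)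
  factored x = splits (idHom {E}) x
  -- The coefficients are recovered from values: 0 gives the product of the roots, and 1 then gives
  -- their sum.
  c≈ : φ.⟦ c ⟧ ≈ u * v
  c≈ = trans (solve 2 (λ c t → c := c :+ con (+ 0) :* t) refl φ.⟦ c ⟧ _)
    (trans (factored 0#) (solve 2 (λ u v → (con (+ 0) :- u) :* ((con (+ 0) :- v) :* con (+ 1)) := u :* v)
      refl u v))
  z≈ : φ.⟦ z ⟧ ≈ u + v
  z≈ = begin
    φ.⟦ z ⟧
      ≈⟨ solve 2 (λ c z → z := c :+ con (+ 1) :- (c :+ con (+ 1) :*
        (:- z :+ con (+ 1) :* (con (+ 1) :+ con (+ 1) :* con (+ 0))))) refl φ.⟦ c ⟧ φ.⟦ z ⟧ ⟩
    φ.⟦ c ⟧ + 1# - (φ.⟦ c ⟧ + 1# * (- φ.⟦ z ⟧ + 1# * (1# + 1# * 0#)))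
      ≈⟨ +-congˡ (-‿cong (+-congˡ (*-congˡ (+-cong (φ.-‿homo z) (*-congˡ (+-congʳ φ.1-homo)))))) ⟨
    φ.⟦ c ⟧ + 1# - (φ.⟦ c ⟧ + 1# * (φ.⟦ A.- z ⟧ + 1# * (φ.⟦ A.1# ⟧ + 1# * 0#)))
      ≈⟨ +-cong (+-congʳ c≈) (-‿cong (factored 1#)) ⟩
    u * v + 1# - (1# - u) * ((1# - v) * 1#)
      ≈⟨ solve 2 (λ u v → u :* v :+ con (+ 1) :- (con (+ 1) :- u) :* ((con (+ 1) :- v) :* con (+ 1)) := u :+
        v) refl u v ⟩
    u + v ∎
  power-sum : ∀ j → φ.⟦ dickson A c z j ⟧ ≈ u ^ j + v ^ j
  power-sum j = trans (dickson-homo φ c z j) (trans (dickson-cong c≈ z≈ j) (dickson-power-sum u v j))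

module _ (A : CRing) where
  open CommutativeRing A
  open PolynomialRing A
  open Monic A
  private module P = CommutativeRing polyRing
  open Hom const using (⟦_⟧)

  -- Shared by the Dickson recurrence and by `homogenise`. Only a degree bound on q is asked,
  -- because the Dickson polynomial of degree 0 is 2 and not monic.
  IsMonic-next : ∀ {n p q} c → IsMonic (suc n) p → (∀ {i} → n < i → coeff q i ≈ 0#) →
                 IsMonic (suc (suc n)) (X *ₚ p P.- ⟦ c ⟧ *ₚ q)
  IsMonic-next {n} {p} {q} c (lead , top) low = IsMonic-resp {q = X *ₚ p P.- ⟦ c ⟧ *ₚ q}
      (P.+-cong (P.sym (X-* A p)) (P.-‿cong {map (c *_) q} scale-≋))
      ( trans (coefficient (suc n)) (trans (+-cong lead (-‿cong (vanish (ℕ.m<n⇒m<1+n (ℕ.n<1+n n)))))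
        (trans (+-congˡ -0#≈0#) (+-identityʳ _)))
      , λ { {suc i} (s≤s n<i) → trans (coefficient i) (trans
        (+-cong (top n<i) (-‿cong (vanish (ℕ.m<n⇒m<1+n (ℕ.<-trans (ℕ.n<1+n n) n<i))))) (-‿inverseʳ 0#)) } )
    where
    open RingProperties ring using (-0#≈0#)
    coefficient : ∀ i → coeff ((0# ∷ p) P.- map (c *_) q) (suc i) ≈ coeff p i - c * coeff q (suc i)
    coefficient i = trans (coeff-+ (0# ∷ p) (-ₚ map (c *_) q) (suc i))
      (+-congˡ (trans (coeff-neg (map (c *_) q) (suc i)) (-‿cong (coeff-scale c q (suc i)))))
    vanish : ∀ {i} → n < i → c * coeff q i ≈ 0#
    vanish n<i = trans (*-congˡ (low n<i)) (zeroʳ c)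
    scale-≋ : map (c *_) q ≋ ⟦ c ⟧ *ₚ q
    scale-≋ = ⟨ (λ i → sym (trans (coeff-∷* c [] q i) (trans (+-congˡ (shifted i))
      (trans (+-identityʳ _) (sym (coeff-scale c q i)))))) ⟩
      where
      shifted : ∀ i → coeff (0# ∷ []) i ≈ 0#
      shifted zero    = refl
      shifted (suc i) = refl

  dickson-isMonic : ∀ c n → IsMonic (suc n) (dickson polyRing ⟦ c ⟧ X (suc n))
  dickson-isMonic c 0             = refl , λ { (s≤s (s≤s _)) → refl }
  dickson-isMonic c 1             = IsMonic-next {0} {X} {P.1# P.+ P.1#} c (dickson-isMonic c 0) λ
    { (s≤s _) → refl }
  dickson-isMonic c (suc (suc n)) = IsMonic-next {suc n} {dickson polyRing ⟦ c ⟧ X (suc (suc n))}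
    {dickson polyRing ⟦ c ⟧ X (suc n)} c
    (dickson-isMonic c (suc n)) (proj₂ (dickson-isMonic c n))

  IsMonic-sub-const : ∀ {n p} c → IsMonic (suc n) p → IsMonic (suc n) (p P.- ⟦ c ⟧)
  IsMonic-sub-const {n} {p} c (lead , top) = trans (coefficient n) lead ,
    λ { {suc i} n<i → trans (coefficient i) (top n<i) }
    where
    open RingProperties ring using (-0#≈0#)
    coefficient : ∀ i → coeff (p P.- ⟦ c ⟧) (suc i) ≈ coeff p (suc i)
    coefficient i = trans (coeff-+ p (-ₚ ⟦ c ⟧) (suc i)) (+-identityʳ _)

-- Coefficients of Dickson polynomials and their relation to f

module DicksonExpansion {B : CRing} (φ : Hom ℚ-ring B) where
  open CommutativeRing B
  open Powers B
  open IntegerSolver B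
  open ≈-Reasoning setoid
  private module φ = Hom φ

  fromℕ : ℕ → Carrier
  fromℕ n = φ.⟦ + n ℚ./ 1 ⟧

  fromℕ-+ : ∀ m n → fromℕ (m ℕ.+ n) ≈ fromℕ m + fromℕ n
  fromℕ-+ m n = trans (φ.cong (/1-+ m n)) (φ.+-homo _ _)

  sumBelow : ℕ → (ℕ → Carrier) → Carrier
  sumBelow zero    g = 0#
  sumBelow (suc n) g = g 0 + sumBelow n (λ j → g (suc j))

  sumBelow-cong : ∀ {g h} n → (∀ j → g j ≈ h j) → sumBelow n g ≈ sumBelow n h
  sumBelow-cong zero    eq = refl
  sumBelow-cong (suc n) eq = +-cong (eq 0) (sumBelow-cong n (λ j → eq (suc j)))

  sumBelow-zero : ∀ {g} n → (∀ j → g j ≈ 0#) → sumBelow n g ≈ 0#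
  sumBelow-zero zero    eq = refl
  sumBelow-zero (suc n) eq = trans (+-cong (eq 0) (sumBelow-zero n (λ j → eq (suc j)))) (+-identityˡ 0#)

  sumBelow-linear : ∀ a b g h n → sumBelow n (λ j → a * g j + b * h j) ≈ a * sumBelow n g + b * sumBelow n h
  sumBelow-linear a b g h zero    = solve 2 (λ a b → con (+ 0) := a :* con (+ 0) :+ b :* con (+ 0)) refl a b
  sumBelow-linear a b g h (suc n) =
    trans (+-congˡ (sumBelow-linear a b (λ j → g (suc j)) (λ j → h (suc j)) n))
    (solve 6 (λ a b x y s t → a :* x :+ b :* y :+ (a :* s :+ b :* t) := a :* (x :+ s) :+ b :* (y :+ t)) refl
      a b (g 0) (h 0) _ _)

  module _ (c z : Carrier) where
    -- The signs are absorbed into powers of -c. For 2j > n the exponent is truncated to 0, which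
    -- does no harm since `lucas n j` is then 0.
    term : ℕ → ℕ → Carrier
    term n j = fromℕ (lucas n j) * (- c) ^ j * z ^ (n ∸ 2 ℕ.* j)

    private
      term-vanishes : ∀ n j → lucas n j ≡ 0 → term n j ≈ 0#
      term-vanishes n j eq = trans (*-congʳ (trans (*-congʳ (trans (reflexive (≡.cong fromℕ eq)) φ.0-homo))
        (zeroˡ _))) (zeroˡ _)

      -- The two exponents of z differ by exactly one unless the subtraction on the right truncates,
      -- and then the common coefficient vanishes.
      shift : ∀ n j → fromℕ (lucas (suc n) (suc j)) * (- c) ^ suc j * z ^ (n ∸ 2 ℕ.* j) ≈ z * term (suc n)
        (suc j)
      shift n j with 2 ℕ.* suc j ℕ.≤? suc n
      ... | yes 2j≤n = begin
        ℓ * w * z ^ (n ∸ 2 ℕ.* j) ≡⟨ ≡.cong (λ e → ℓ * w * z ^ e) exponent ⟩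
        ℓ * w * (z * z ^ (suc n ∸ 2 ℕ.* suc j))
          ≈⟨ solve 4 (λ l w z x → l :* w :* (z :* x) := z :* (l :* w :* x)) refl ℓ w z _ ⟩
        z * (ℓ * w * z ^ (suc n ∸ 2 ℕ.* suc j)) ∎
        where
        ℓ w : Carrier
        ℓ = fromℕ (lucas (suc n) (suc j))
        w = (- c) ^ suc j
        exponent : n ∸ 2 ℕ.* j ≡ suc (suc n ∸ 2 ℕ.* suc j)
        exponent = ≡.trans (≡.cong (suc (suc n) ∸_) (≡.sym (ℕ.*-suc 2 j))) (ℕ.+-∸-assoc 1 2j≤n)
      ... | no 2j≰n = trans
        (trans (*-congʳ (trans (*-congʳ (trans (reflexive (≡.cong fromℕ vanish)) φ.0-homo)) (zeroˡ _)))
          (zeroˡ _))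
        (sym (trans (*-congˡ (term-vanishes (suc n) (suc j) vanish)) (zeroʳ z)))
        where
        vanish : lucas (suc n) (suc j) ≡ 0
        vanish = lucas-vanishes (suc n) (suc j) (ℕ.≰⇒> 2j≰n)

      term-suc : ∀ n j → term (suc (suc n)) (suc j) ≈ z * term (suc n) (suc j) + - c * term n j
      term-suc n j = begin
        fromℕ (lucas (suc n) (suc j) ℕ.+ lucas n j) * w * z ^ (suc (suc n) ∸ 2 ℕ.* suc j)
          ≡⟨ ≡.cong (λ e → fromℕ (lucas (suc n) (suc j) ℕ.+ lucas n j) * w * z ^ (suc (suc n) ∸ e))
            (ℕ.*-suc 2 j) ⟩
        fromℕ (lucas (suc n) (suc j) ℕ.+ lucas n j) * w * Z
          ≈⟨ *-congʳ (*-congʳ (fromℕ-+ (lucas (suc n) (suc j)) (lucas n j))) ⟩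
        (fromℕ (lucas (suc n) (suc j)) + fromℕ (lucas n j)) * w * Z
          ≈⟨ solve 5 (λ k l c w Z → (k :+ l) :* (c :* w) :* Z := k :* (c :* w) :* Z :+ c :* (l :* w :* Z))
            refl (fromℕ (lucas (suc n) (suc j))) (fromℕ (lucas n j)) (- c) ((- c) ^ j) Z ⟩
        fromℕ (lucas (suc n) (suc j)) * w * Z + - c * term n j
          ≈⟨ +-congʳ (shift n j) ⟩
        z * term (suc n) (suc j) + - c * term n j ∎
        where
        w Z : Carrier
        w = (- c) ^ suc j
        Z = z ^ (n ∸ 2 ℕ.* j)

    -- The number J of terms is free beyond n/2, so the sums for n + 2, n + 1 and n can be cut at J
    -- + 1, J + 1 and J and then combined term by term.
    dickson-expansion : ∀ n J → n < 2 ℕ.* J → dickson B c z n ≈ sumBelow J (term n)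
    dickson-expansion 0 (suc J) _ = begin
      1# + 1#
        ≈⟨ solve 0 (con (+ 1) :+ con (+ 1) := (con (+ 1) :+ con (+ 1)) :* con (+ 1) :* con (+ 1) :+ con
          (+ 0)) refl ⟩
      (1# + 1#) * 1# * 1# + 0#
        ≈⟨ +-cong (*-congʳ (*-congʳ (trans (fromℕ-+ 1 1) (+-cong φ.1-homo φ.1-homo))))
          (sumBelow-zero J (λ j → term-vanishes 0 (suc j) ≡.refl)) ⟨
      sumBelow (suc J) (term 0) ∎
    dickson-expansion 1 (suc J) _ = begin
      z ≈⟨ solve 1 (λ z → z := con (+ 1) :* con (+ 1) :* (z :* con (+ 1)) :+ con (+ 0)) refl z ⟩
      1# * 1# * (z * 1#) + 0#
        ≈⟨ +-cong (*-congʳ (*-congʳ φ.1-homo)) (sumBelow-zero J (λ j → term-vanishes 1 (suc j) ≡.refl)) ⟨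
      sumBelow (suc J) (term 1) ∎
    dickson-expansion (suc (suc n)) (suc J) n<2J = begin
      z * dickson B c z (suc n) - c * dickson B c z n
        ≈⟨ +-cong (*-congˡ (dickson-expansion (suc n) (suc J) (ℕ.<-trans (ℕ.n<1+n _) n<2J)))
             (-‿cong (*-congˡ (dickson-expansion n J (ℕ.≤-pred
               (ℕ.≤-pred (≡.subst (3 ℕ.+ n ℕ.≤_) (ℕ.*-suc 2 J) n<2J)))))) ⟩
      z * (term (suc n) 0 + S₁) - c * S₀
        ≈⟨ solve 6 (λ z c l x s t → z :* (l :* con (+ 1) :* x :+ s) :- c :* t := l :* con (+ 1) :* (z :* x)
          :+ (z :* s :+ (:- c) :* t))
             refl z c (fromℕ (lucas (suc n) 0)) (z ^ suc n) S₁ S₀ ⟩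
      term (suc (suc n)) 0 + (z * S₁ + - c * S₀)
        ≈⟨ +-congˡ (trans (sumBelow-cong J (term-suc n)) (sumBelow-linear z (- c)
          (λ j → term (suc n) (suc j)) (term n) J)) ⟨
      sumBelow (suc J) (term (suc (suc n))) ∎
      where
      S₁ S₀ : Carrier
      S₁ = sumBelow J (λ j → term (suc n) (suc j))
      S₀ = sumBelow J (term n)

  open Algebra.Definitions.RawSemiring ℚ[Z]-rawSemiring using (sum)
  open Evaluation φ using (ev-+)

  ev-sum : ∀ n (p : Fin n → ℚ[Z]) z g → (∀ j → ev φ (p j) z ≈ g (toℕ j)) → ev φ (sum p) z ≈ sumBelow n g
  ev-sum zero    p z g eq = refl
  ev-sum (suc n) p z g eq = trans (ev-+ (p fzero) _ z)
    (+-cong (eq fzero) (ev-sum n (λ j → p (fsuc j)) z (λ j → g (suc j)) (λ j → eq (fsuc j))))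

  ev-monomial : ∀ a k z → ev φ (Defs.monomial a k) z ≈ φ.⟦ a ⟧ * z ^ k
  ev-monomial a zero    z = trans (Evaluation.ev-const φ a z) (sym (*-identityʳ _))
  ev-monomial a (suc k) z = trans (+-cong φ.0-homo (*-congˡ (ev-monomial a k z)))
    (solve 3 (λ a z x → con (+ 0) :+ z :* (a :* x) := a :* (z :* x)) refl φ.⟦ a ⟧ z (z ^ k))

  private
    coefficient-term : ∀ n j c z .{{_ : ℕ.NonZero (n ∸ j)}} →
      φ.⟦ F-coeff n j ℚ.* c ℚ^.^ j ⟧ * z ^ (n ∸ 2 ℕ.* j) ≈ term φ.⟦ c ⟧ z n j
    coefficient-term n j c z = *-congʳ (begin
      φ.⟦ F-coeff n j ℚ.* c ℚ^.^ j ⟧ ≈⟨ φ.cong (≡.cong (ℚ._* c ℚ^.^ j) (F-coeff-lucas n j)) ⟩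
      φ.⟦ (ℚ.- 1ℚ) ℚ^.^ j ℚ.* (+ lucas n j ℚ./ 1) ℚ.* c ℚ^.^ j ⟧
        ≈⟨ trans (φ.*-homo _ _) (*-cong (trans (φ.*-homo _ _) (*-congʳ (φ.^-homo _ j))) (φ.^-homo c j)) ⟩
      φ.⟦ ℚ.- 1ℚ ⟧ ^ j * fromℕ (lucas n j) * φ.⟦ c ⟧ ^ j
        ≈⟨ *-congʳ (*-congʳ (^-congˡ j (trans (φ.-‿homo 1ℚ) (-‿cong φ.1-homo)))) ⟩
      (- 1#) ^ j * fromℕ (lucas n j) * φ.⟦ c ⟧ ^ j
        ≈⟨ solve 3 (λ a l b → a :* l :* b := l :* (a :* b)) refl _ _ _ ⟩
      fromℕ (lucas n j) * ((- 1#) ^ j * φ.⟦ c ⟧ ^ j) ≈⟨ *-congˡ (^-distrib-* (- 1#) φ.⟦ c ⟧ j) ⟨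
      fromℕ (lucas n j) * (- 1# * φ.⟦ c ⟧) ^ j
        ≈⟨ *-congˡ (^-congˡ j (solve 1 (λ c → (:- con (+ 1)) :* c := :- c) refl φ.⟦ c ⟧)) ⟩
      fromℕ (lucas n j) * (- φ.⟦ c ⟧) ^ j ∎)

  -- Stated for an arbitrary ℚ-algebra to serve twice: at the generic point it describes f as a
  -- polynomial, and in an extension field it turns a root of f into a Dickson equation.
  ev-f : ∀ m .(3≤n : 3 ≤ 1 ℕ.+ 2 ℕ.* m) d R z → let D = d ℚ.* d ℚ.- R in
         ev φ (f (1 ℕ.+ 2 ℕ.* m) 3≤n d R) z ≈
           dickson B φ.⟦ D ⟧ z (1 ℕ.+ 2 ℕ.* m) - φ.⟦ (+ 2 ℚ./ 1) ℚ.* d ℚ.* D ℚ^.^ m ⟧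
  ev-f m 3≤n d R z = begin
    ev φ (f n 3≤n d R) z
      ≈⟨ ev-+ (sum p) (Defs.monomial (ℚ.- e) 0) z ⟩
    ev φ (sum p) z + ev φ (Defs.monomial (ℚ.- e) 0) z
      ≈⟨ +-cong (ev-sum (suc m′) p z (term φ.⟦ D ⟧ z n) (λ j →
        trans (ev-monomial _ (n ∸ 2 ℕ.* toℕ j) z) (coefficient-term n (toℕ j) D z {{nonZero j}})))
           (trans (Evaluation.ev-const φ (ℚ.- e) z) (trans (φ.-‿homo e)
             (-‿cong (φ.cong (≡.cong (λ i → (+ 2 ℚ./ 1) ℚ.* d ℚ.* D ℚ^.^ i) m′≡m))))) ⟩
    sumBelow (suc m′) (term φ.⟦ D ⟧ z n) - φ.⟦ (+ 2 ℚ./ 1) ℚ.* d ℚ.* D ℚ^.^ m ⟧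
      ≡⟨ ≡.cong (λ i → sumBelow (suc i) (term φ.⟦ D ⟧ z n) - φ.⟦ (+ 2 ℚ./ 1) ℚ.* d ℚ.* D ℚ^.^ m ⟧) m′≡m ⟩
    sumBelow (suc m) (term φ.⟦ D ⟧ z n) - φ.⟦ (+ 2 ℚ./ 1) ℚ.* d ℚ.* D ℚ^.^ m ⟧
      ≈⟨ +-congʳ (dickson-expansion φ.⟦ D ⟧ z n (suc m) (≡.subst (n ℕ.<_) (≡.sym (ℕ.*-suc 2 m)) ℕ.≤-refl)) ⟨
    dickson B φ.⟦ D ⟧ z n - φ.⟦ (+ 2 ℚ./ 1) ℚ.* d ℚ.* D ℚ^.^ m ⟧ ∎
    where
    n m′ : ℕ
    n = 1 ℕ.+ 2 ℕ.* m
    m′ = (n ∸ 1) ℕ./ 2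
    m′≡m : m′ ≡ m
    m′≡m = ≡.trans (≡.cong (ℕ._/ 2) (ℕ.*-comm 2 m)) (m*n/n≡m m 2)
    D e : ℚ
    D = d ℚ.* d ℚ.- R
    e = (+ 2 ℚ./ 1) ℚ.* d ℚ.* D ℚ^.^ m′
    nonZero : (j : Fin (suc m′)) → ℕ.NonZero (n ∸ toℕ j)
    nonZero j = ℕ.>-nonZero (ℕ.m<n⇒0<n∸m (s≤s (ℕ.≤-trans (toℕ≤pred[n] j) (m/n≤m (2 ℕ.* m) 2))))
    p : Fin (suc m′) → ℚ[Z]
    p j = Defs.monomial (F-coeff n (toℕ j) {{nonZero j}} ℚ.* D ℚ^.^ toℕ j) (n ∸ 2 ℕ.* toℕ j)

-- Quadratic fields

open Defs using (Irreducible; ℚ⟨√_⟩; _+_√; re; im; _+√_; _*√_; 0√; 1√; IsSquare; _^√_; inverse√; inverse√-inverseʳ; conjugateRatio)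

ℚ-field : DiscreteField
ℚ-field = record
  { 𝔽      = ℚ-ring
  ; 1≉0           = λ ()
  ; zeroOrInverse = λ x → dichotomy x
  }
  where
  dichotomy : ∀ x → x ≡ 0ℚ ⊎ (∃[ y ] x ℚ.* y ≡ 1ℚ)
  dichotomy x with x ℚ.≟ 0ℚ
  ... | yes x≡0 = inj₁ x≡0
  ... | no  x≢0 = inj₂ (ℚ.1/_ x {{ℚ.≢-nonZero x≢0}} , ℚ.*-inverseʳ x {{ℚ.≢-nonZero x≢0}})

module Quadratic (R : ℚ) where
  private
    K : Set
    K = ℚ⟨√ R ⟩
  open CommutativeRing ℚ-ring using (_+_; _*_; -_; _-_)
  open IntegerSolver ℚ-ring

  -√_ : K → K
  -√ (a + b √) = (- a) + (- b) √

  K-ring : CRing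
  K-ring = record
    { Carrier = K
    ; _≈_     = _≡_
    ; _+_     = _+√_
    ; _*_     = _*√_
    ; -_      = -√_
    ; 0#      = 0√
    ; 1#      = 1√
    ; isCommutativeRing = record
      { isRing = record
        { +-isAbelianGroup = record
          { isGroup = record
            { isMonoid = record
              { isSemigroup = record
                { isMagma = record { isEquivalence = ≡.isEquivalence ; ∙-cong = ≡.cong₂ _+√_ }
                ; assoc = λ { (a + b √) (c + e √) (g + h √) →
                  ≡.cong₂ _+_√ (ℚ.+-assoc a c g) (ℚ.+-assoc b e h) }
                }
              ; identity = (λ { (a + b √) → ≡.cong₂ _+_√ (ℚ.+-identityˡ a) (ℚ.+-identityˡ b) })
                         , (λ { (a + b √) → ≡.cong₂ _+_√ (ℚ.+-identityʳ a) (ℚ.+-identityʳ b) })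
              }
            ; inverse = (λ { (a + b √) → ≡.cong₂ _+_√ (ℚ.+-inverseˡ a) (ℚ.+-inverseˡ b) })
                      , (λ { (a + b √) → ≡.cong₂ _+_√ (ℚ.+-inverseʳ a) (ℚ.+-inverseʳ b) })
            ; ⁻¹-cong = ≡.cong -√_
            }
          ; comm = λ { (a + b √) (c + e √) → ≡.cong₂ _+_√ (ℚ.+-comm a c) (ℚ.+-comm b e) }
          }
        ; *-cong     = ≡.cong₂ _*√_
        ; *-assoc    = λ { (a + b √) (c + e √) (g + h √) → ≡.cong₂ _+_√
            (solve 7 (λ R a b c e g h → (a :* c :+ R :* (b :* e)) :* g :+ R :* ((a :* e :+ b :* c) :* h) :=
              a :* (c :* g :+ R :* (e :* h)) :+ R :* (b :* (c :* h :+ e :* g))) ≡.refl R a b c e g h)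
            (solve 7 (λ R a b c e g h → (a :* c :+ R :* (b :* e)) :* h :+ (a :* e :+ b :* c) :* g :=
              a :* (c :* h :+ e :* g) :+ b :* (c :* g :+ R :* (e :* h))) ≡.refl R a b c e g h) }
        ; *-identity = (λ { (a + b √) → ≡.cong₂ _+_√
                          (solve 3 (λ R a b → con (+ 1) :* a :+ R :* (con (+ 0) :* b) := a) ≡.refl R a b)
                          (solve 2 (λ a b → con (+ 1) :* b :+ con (+ 0) :* a := b) ≡.refl a b) })
                     , (λ { (a + b √) → ≡.cong₂ _+_√
                          (solve 3 (λ R a b → a :* con (+ 1) :+ R :* (b :* con (+ 0)) := a) ≡.refl R a b)
                          (solve 2 (λ a b → a :* con (+ 0) :+ b :* con (+ 1) := b) ≡.refl a b) })
        ; distrib    = (λ { (a + b √) (c + e √) (g + h √) → ≡.cong₂ _+_√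
                          (solve 7 (λ R a b c e g h → a :* (c :+ g) :+ R :* (b :* (e :+ h)) :=
                            a :* c :+ R :* (b :* e) :+ (a :* g :+ R :* (b :* h))) ≡.refl R a b c e g h)
                          (solve 6 (λ a b c e g h → a :* (e :+ h) :+ b :* (c :+ g) :=
                            a :* e :+ b :* c :+ (a :* h :+ b :* g)) ≡.refl a b c e g h) })
                     , (λ { (a + b √) (c + e √) (g + h √) → ≡.cong₂ _+_√
                          (solve 7 (λ R a b c e g h → (c :+ g) :* a :+ R :* ((e :+ h) :* b) :=
                            c :* a :+ R :* (e :* b) :+ (g :* a :+ R :* (h :* b))) ≡.refl R a b c e g h)
                          (solve 6 (λ a b c e g h → (c :+ g) :* b :+ (e :+ h) :* a :=
                            c :* b :+ e :* a :+ (g :* b :+ h :* a)) ≡.refl a b c e g h) })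
        }
      ; *-comm = λ { (a + b √) (c + e √) → ≡.cong₂ _+_√
          (solve 5 (λ R a b c e → a :* c :+ R :* (b :* e) := c :* a :+ R :* (e :* b)) ≡.refl R a b c e)
          (solve 4 (λ a b c e → a :* e :+ b :* c := c :* b :+ e :* a) ≡.refl a b c e) }
      }
    }

  rational : Hom ℚ-ring K-ring
  rational = record
    { ⟦_⟧    = λ a → a + 0ℚ √
    ; cong   = ≡.cong (_+ 0ℚ √)
    ; +-homo = λ a b → ≡.refl
    ; *-homo = λ a b → ≡.cong₂ _+_√
        (solve 3 (λ R a b → a :* b := a :* b :+ R :* (con (+ 0) :* con (+ 0))) ≡.refl R a b)
        (solve 2 (λ a b → con (+ 0) := a :* con (+ 0) :+ con (+ 0) :* b) ≡.refl a b)
    ; 1-homo = ≡.refl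
    }

  conj : Hom K-ring K-ring
  conj = record
    { ⟦_⟧    = λ z → re z + (- im z) √
    ; cong   = ≡.cong (λ z → re z + (- im z) √)
    ; +-homo = λ { (a + b √) (c + e √) → ≡.cong ((a + c) +_√)
      (solve 2 (λ b e → :- (b :+ e) := :- b :+ (:- e)) ≡.refl b e) }
    ; *-homo = λ { (a + b √) (c + e √) → ≡.cong₂ _+_√
        (solve 5 (λ R a b c e → a :* c :+ R :* (b :* e) := a :* c :+ R :* ((:- b) :* (:- e))) ≡.refl R a b c
          e)
        (solve 4 (λ a b c e → :- (a :* e :+ b :* c) := a :* (:- e) :+ (:- b) :* c) ≡.refl a b c e) }
    ; 1-homo = ≡.refl
    }

  conj-involutive : ∀ z → Hom.⟦ conj ⟧ (Hom.⟦ conj ⟧ z) ≡ z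
  conj-involutive (a + b √) = ≡.cong (a +_√) (solve 1 (λ b → :- (:- b) := b) ≡.refl b)

  trace : ∀ z → z +√ Hom.⟦ conj ⟧ z ≡ Hom.⟦ rational ⟧ (re z + re z)
  trace (a + b √) = ≡.cong ((a + a) +_√) (ℚ.+-inverseʳ b)

  K-field : ¬ IsSquare R → DiscreteField
  K-field R≠□ = record
    { 𝔽      = K-ring
    ; 1≉0           = λ ()
    ; zeroOrInverse = dichotomy
    }
    where
    dichotomy : ∀ z → z ≡ 0√ ⊎ (∃[ w ] z *√ w ≡ 1√)
    dichotomy z@(a + b √) with a ℚ.≟ 0ℚ | b ℚ.≟ 0ℚ
    ... | yes a≡0 | yes b≡0 = inj₁ (≡.cong₂ _+_√ a≡0 b≡0)
    ... | no a≢0  | _       = inj₂ (inverse√ R≠□ z z≢0 , inverse√-inverseʳ R≠□ z z≢0)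
      where
      z≢0 : z ≢ 0√
      z≢0 eq = a≢0 (≡.cong re eq)
    ... | _       | no b≢0  = inj₂ (inverse√ R≠□ z z≢0 , inverse√-inverseʳ R≠□ z z≢0)
      where
      z≢0 : z ≢ 0√
      z≢0 eq = b≢0 (≡.cong im eq)

≡-ring : ∀ {K _+_ _*_ -_ 0# 1#} → IsCommutativeRing {A = K} _≡_ _+_ _*_ -_ 0# 1# → CRing
≡-ring isCommutativeRing = record { isCommutativeRing = isCommutativeRing }

-- Stated for abstract operations, because those of ℚ(√R) would unfold at every step.
module ConjugateRatio
  {K : Set} {_⊕_ _⊗_ : K → K → K} {⊝_ : K → K} {0K 1K : K} (isCommutativeRing :
    IsCommutativeRing _≡_ _⊕_ _⊗_ ⊝_ 0K 1K)
  where
  private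
    A : CRing
    A = ≡-ring isCommutativeRing
  open CommutativeRing A hiding (isCommutativeRing)

  module Powers-of-ratio
    (1≢0 : 1# ≢ 0#) (inverse? : ∀ x → x ≡ 0# ⊎ (∃[ y ] x * y ≡ 1#))
    (conj : Hom A A) (conj-involutive : ∀ x → Hom.⟦ conj ⟧ (Hom.⟦ conj ⟧ x) ≡ x)
    {x α ᾱ ρ : Carrier} (x≢0 : x ≢ 0#) (ᾱ≢0 : ᾱ ≢ 0#) (cx≡x : Hom.⟦ conj ⟧ x ≡ x)
      (cα≡ᾱ : Hom.⟦ conj ⟧ α ≡ ᾱ)
    (α*ᾱ : α * ᾱ ≡ x) (ρ*ᾱ : ρ * ᾱ ≡ α)
    where
    private
      module c = Hom conj
      F : DiscreteField
      F = record { 𝔽 = A ; 1≉0 = 1≢0 ; zeroOrInverse = inverse? }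
    open Field F
    open Powers A
    open IntegerSolver A
    open ≡.≡-Reasoning

    cᾱ≡α : c.⟦ ᾱ ⟧ ≡ α
    cᾱ≡α = trans (≡.cong c.⟦_⟧ (sym cα≡ᾱ)) (conj-involutive α)

    cρ*α : c.⟦ ρ ⟧ * α ≡ ᾱ
    cρ*α = trans (≡.cong (c.⟦ ρ ⟧ *_) (sym cᾱ≡α)) (trans (sym (c.*-homo ρ ᾱ))
      (trans (≡.cong c.⟦_⟧ ρ*ᾱ) cα≡ᾱ))

    cancel : ∀ {y w z} → z ≢ 0# → y * z ≡ w * z → y ≡ w
    cancel {y} {w} {z} z≢0 eq with inverse? z
    ... | inj₁ z≡0 = ⊥-elim (z≢0 z≡0)
    ... | inj₂ (z′ , zz′≡1) = begin
      y ≡⟨ *-identityʳ y ⟨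
      y * 1# ≡⟨ ≡.cong (y *_) zz′≡1 ⟨
      y * (z * z′) ≡⟨ *-assoc y z z′ ⟨
      y * z * z′ ≡⟨ ≡.cong (_* z′) eq ⟩
      w * z * z′ ≡⟨ *-assoc w z z′ ⟩
      w * (z * z′) ≡⟨ ≡.cong (w *_) zz′≡1 ⟩
      w * 1# ≡⟨ *-identityʳ w ⟩
      w ∎

    ρ*cρ : ρ * c.⟦ ρ ⟧ ≡ 1#
    ρ*cρ = cancel x≢0 (begin
      ρ * c.⟦ ρ ⟧ * x ≡⟨ ≡.cong (ρ * c.⟦ ρ ⟧ *_) α*ᾱ ⟨
      ρ * c.⟦ ρ ⟧ * (α * ᾱ)
        ≡⟨ solve 4 (λ r s a b → r :* s :* (a :* b) := (r :* b) :* (s :* a)) ≡.refl ρ c.⟦ ρ ⟧ α ᾱ ⟩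
      ρ * ᾱ * (c.⟦ ρ ⟧ * α) ≡⟨ ≡.cong₂ _*_ ρ*ᾱ cρ*α ⟩
      α * ᾱ ≡⟨ α*ᾱ ⟩
      x ≡⟨ *-identityˡ x ⟨
      1# * x ∎)

    -- D^m α = u^n and D^m ᾱ = (D/u)^n at a root Z = u + D/u of f.
    α′ ᾱ′ : ℕ → Carrier
    α′ m = x ^ m * α
    ᾱ′ m = x ^ m * ᾱ

    ᾱ′≢0 : ∀ m → ᾱ′ m ≢ 0#
    ᾱ′≢0 m eq with field-product eq
    ... | inj₁ Dᵐ≡0 = x≢0 (field-power m Dᵐ≡0)
    ... | inj₂ ᾱ≡0  = ᾱ≢0 ᾱ≡0

    cα′ : ∀ m → c.⟦ α′ m ⟧ ≡ ᾱ′ m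
    cα′ m = trans (c.*-homo (x ^ m) α) (≡.cong₂ _*_ (trans (c.^-homo x m) (≡.cong (_^ m) cx≡x)) cα≡ᾱ)

    α′≢0 : ∀ m → α′ m ≢ 0#
    α′≢0 m eq = ᾱ′≢0 m (trans (sym (cα′ m)) (trans (≡.cong c.⟦_⟧ eq) c.0-homo))

    -- The factor Dᵐ cancels in the quotient of conjugates `α′ m / ᾱ′ m` = ρ, so κ divided by its
    -- conjugate is a p-th root of ρ.
    power-ratio : ∀ m p .{{_ : ℕ.NonZero p}} κ → κ ^ p ≡ α′ m → ∃[ γ ] γ ^ p ≡ ρ
    power-ratio m p@(suc _) κ κᵖ≡ with inverse? c.⟦ κ ⟧
    ... | inj₁ cκ≡0 = ⊥-elim (ᾱ′≢0 m (trans (sym cκᵖ) (trans (≡.cong (_^ p) cκ≡0) (zeroˡ _))))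
      where
      cκᵖ : c.⟦ κ ⟧ ^ p ≡ ᾱ′ m
      cκᵖ = trans (sym (c.^-homo κ p)) (trans (≡.cong c.⟦_⟧ κᵖ≡) (cα′ m))
    ... | inj₂ (i , cκi≡1) = κ * i , cancel (ᾱ′≢0 m) (begin
      (κ * i) ^ p * ᾱ′ m ≡⟨ ≡.cong ((κ * i) ^ p *_) cκᵖ ⟨
      (κ * i) ^ p * c.⟦ κ ⟧ ^ p ≡⟨ ^-distrib-* (κ * i) c.⟦ κ ⟧ p ⟨
      (κ * i * c.⟦ κ ⟧) ^ p
        ≡⟨ ≡.cong (_^ p) (trans (*-assoc κ i _) (trans (≡.cong (κ *_) (trans (*-comm i _) cκi≡1))
          (*-identityʳ κ))) ⟩
      κ ^ p ≡⟨ κᵖ≡ ⟩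
      x ^ m * α ≡⟨ ≡.cong (x ^ m *_) ρ*ᾱ ⟨
      x ^ m * (ρ * ᾱ) ≡⟨ solve 3 (λ x r a → x :* (r :* a) := r :* (x :* a)) ≡.refl (x ^ m) ρ ᾱ ⟩
      ρ * ᾱ′ m ∎)
      where
      cκᵖ : c.⟦ κ ⟧ ^ p ≡ ᾱ′ m
      cκᵖ = trans (sym (c.^-homo κ p)) (trans (≡.cong c.⟦_⟧ κᵖ≡) (cα′ m))

    -- ε = γ̄/γ, written without division since γ γ̄ is a root of unity of odd order.
    norm-one-root : ∀ t γ → let p = 1 ℕ.+ 2 ℕ.* t in γ ^ p ≡ ρ →
                    ∃[ δ ] δ ^ p ≡ ρ × δ * c.⟦ δ ⟧ ≡ 1#
    -- As ρ has norm 1, εᵖ = ρ̄/ρ = ρ⁻², and p = 1 + 2t gives (ρ εᵗ)ᵖ = ρᵖ⁻²ᵗ = ρ; both ρ and ε have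
    -- norm 1.
    norm-one-root t γ γᵖ≡ρ = ρ * ε ^ t , (begin
        (ρ * ε ^ t) ^ p ≡⟨ ^-distrib-* ρ (ε ^ t) p ⟩
        ρ ^ p * (ε ^ t) ^ p ≡⟨ ≡.cong₂ _*_ (≡.cong (ρ *_) (sym (^-assocʳ ρ 2 t))) (^-swap ε t p) ⟩
        ρ * (ρ ^ 2) ^ t * (ε ^ p) ^ t
          ≡⟨ trans (*-assoc ρ _ _) (≡.cong (ρ *_) (sym (^-distrib-* (ρ ^ 2) (ε ^ p) t))) ⟩
        ρ * (ρ ^ 2 * ε ^ p) ^ t ≡⟨ ≡.cong (λ x → ρ * (ρ ^ 2 * x) ^ t) εᵖ ⟩
        ρ * (ρ ^ 2 * (cρ * cρ)) ^ t
          ≡⟨ ≡.cong (λ x → ρ * x ^ t) (trans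
            (solve 2 (λ r s → r :* (r :* con (+ 1)) :* (s :* s) := (r :* s) :* (r :* s)) ≡.refl ρ cρ)
                                                      (trans (≡.cong₂ _*_ ρ*cρ ρ*cρ) (*-identityˡ 1#))) ⟩
        ρ * 1# ^ t ≡⟨ trans (≡.cong (ρ *_) (1^n≈1 t)) (*-identityʳ ρ) ⟩
        ρ ∎) , (begin
        ρ * ε ^ t * c.⟦ ρ * ε ^ t ⟧
          ≡⟨ ≡.cong (ρ * ε ^ t *_) (trans (c.*-homo ρ (ε ^ t)) (≡.cong (cρ *_) (c.^-homo ε t))) ⟩
        ρ * ε ^ t * (cρ * cε ^ t)
          ≡⟨ solve 4 (λ r x s y → r :* x :* (s :* y) := r :* s :* (x :* y)) ≡.refl ρ (ε ^ t) cρ (cε ^ t) ⟩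
        ρ * cρ * (ε ^ t * cε ^ t) ≡⟨ ≡.cong₂ _*_ ρ*cρ (sym (^-distrib-* ε cε t)) ⟩
        1# * (ε * cε) ^ t ≡⟨ trans (*-identityˡ _) (trans (≡.cong (_^ t) ε*cε) (1^n≈1 t)) ⟩
        1# ∎)
      where
      p : ℕ
      p = 1 ℕ.+ 2 ℕ.* t
      cγ ν ε cρ cε : Carrier
      cγ = c.⟦ γ ⟧
      ν  = γ * cγ
      ε  = cγ * cγ * ν ^ (2 ℕ.* t)
      cρ = c.⟦ ρ ⟧
      cε = c.⟦ ε ⟧
      cγᵖ : cγ ^ p ≡ cρ
      cγᵖ = trans (sym (c.^-homo γ p)) (≡.cong c.⟦_⟧ γᵖ≡ρ)
      νᵖ : ν ^ p ≡ 1#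
      νᵖ = trans (^-distrib-* γ cγ p) (trans (≡.cong₂ _*_ γᵖ≡ρ cγᵖ) ρ*cρ)
      ε*γ : ε * γ ≡ cγ
      ε*γ = begin
        cγ * cγ * ν ^ (2 ℕ.* t) * γ
          ≡⟨ solve 3 (λ x y z → x :* x :* y :* z := x :* (z :* x :* y)) ≡.refl cγ (ν ^ (2 ℕ.* t)) γ ⟩
        cγ * ν ^ p ≡⟨ trans (≡.cong (cγ *_) νᵖ) (*-identityʳ cγ) ⟩
        cγ ∎
      εᵖ : ε ^ p ≡ cρ * cρ
      εᵖ = begin
        ε ^ p ≡⟨ *-identityʳ _ ⟨
        ε ^ p * 1# ≡⟨ ≡.cong (ε ^ p *_) ρ*cρ ⟨
        ε ^ p * (ρ * cρ) ≡⟨ *-assoc _ ρ cρ ⟨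
        ε ^ p * ρ * cρ ≡⟨ ≡.cong (λ x → ε ^ p * x * cρ) γᵖ≡ρ ⟨
        ε ^ p * γ ^ p * cρ ≡⟨ ≡.cong (_* cρ) (trans (sym (^-distrib-* ε γ p)) (≡.cong (_^ p) ε*γ)) ⟩
        cγ ^ p * cρ ≡⟨ ≡.cong (_* cρ) cγᵖ ⟩
        cρ * cρ ∎
      cε*cγ : cε * cγ ≡ γ
      cε*cγ = trans (sym (c.*-homo ε γ)) (trans (≡.cong c.⟦_⟧ ε*γ) (conj-involutive γ))
      ε*cε : ε * cε ≡ 1#
      ε*cε = begin
        ε * cε ≡⟨ *-identityʳ _ ⟨
        ε * cε * 1# ≡⟨ ≡.cong (ε * cε *_) νᵖ ⟨
        ε * cε * (ν * ν ^ (2 ℕ.* t))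
          ≡⟨ solve 5 (λ e f x y z → e :* f :* (x :* y :* z) := (e :* x) :* (f :* y) :* z) ≡.refl ε cε γ cγ _
            ⟩
        ε * γ * (cε * cγ) * ν ^ (2 ℕ.* t)
          ≡⟨ ≡.cong (_* ν ^ (2 ℕ.* t)) (trans (≡.cong₂ _*_ ε*γ cε*cγ) (*-comm cγ γ)) ⟩
        ν ^ p ≡⟨ νᵖ ⟩
        1# ∎

    -- For δ of norm 1 with δᵖ = ρ, take w = Dˡ α δ̄ᵗ. Since α² ρ̄ = α ᾱ = D, the power wᵖ = Dˡᵖ α
    -- (α² ρ̄)ᵗ is Dˡᵖ⁺ᵗ α, and the norm of w is D²ˡ · D. When n = (1 + 2l) p, the exponent l p + t
    -- is m.
    root-of-α′ : ∀ l t γ → let p = 1 ℕ.+ 2 ℕ.* t in γ ^ p ≡ ρ →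
                 ∃[ w ] w ^ p ≡ α′ (l ℕ.* p ℕ.+ t) × w * c.⟦ w ⟧ ≡ x ^ (1 ℕ.+ 2 ℕ.* l)
    root-of-α′ l t γ γᵖ≡ρ = from-norm-one (norm-one-root t γ γᵖ≡ρ)
     where
     p : ℕ
     p = 1 ℕ.+ 2 ℕ.* t
     from-norm-one : ∃[ δ ] δ ^ p ≡ ρ × δ * c.⟦ δ ⟧ ≡ 1# →
       ∃[ w ] w ^ p ≡ α′ (l ℕ.* p ℕ.+ t) × w * c.⟦ w ⟧ ≡ x ^ (1 ℕ.+ 2 ℕ.* l)
     from-norm-one (δ , δᵖ≡ρ , δcδ≡1) = x ^ l * α * cδ ^ t , (begin
        (x ^ l * α * cδ ^ t) ^ p
          ≡⟨ trans (^-distrib-* (x ^ l * α) (cδ ^ t) p) (≡.cong (_* (cδ ^ t) ^ p) (^-distrib-* (x ^ l) α p))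
            ⟩
        (x ^ l) ^ p * α ^ p * (cδ ^ t) ^ p
          ≡⟨ ≡.cong₂ _*_ (≡.cong₂ _*_ (^-assocʳ x l p) (≡.cong (α *_) (sym (^-assocʳ α 2 t))))
            (^-swap cδ t p) ⟩
        x ^ (l ℕ.* p) * (α * (α ^ 2) ^ t) * (cδ ^ p) ^ t
          ≡⟨ ≡.cong (λ y → x ^ (l ℕ.* p) * (α * (α ^ 2) ^ t) * y ^ t) cδᵖ ⟩
        x ^ (l ℕ.* p) * (α * (α ^ 2) ^ t) * c.⟦ ρ ⟧ ^ t
          ≡⟨ solve 4 (λ x a y z → x :* (a :* y) :* z := x :* (y :* z) :* a) ≡.refl (x ^ (l ℕ.* p)) α
            ((α ^ 2) ^ t) (c.⟦ ρ ⟧ ^ t) ⟩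
        x ^ (l ℕ.* p) * ((α ^ 2) ^ t * c.⟦ ρ ⟧ ^ t) * α
          ≡⟨ ≡.cong (λ y → x ^ (l ℕ.* p) * y * α) (trans (sym (^-distrib-* (α ^ 2) c.⟦ ρ ⟧ t))
            (≡.cong (_^ t) α²cρ)) ⟩
        x ^ (l ℕ.* p) * x ^ t * α ≡⟨ ≡.cong (_* α) (^-homo-* x (l ℕ.* p) t) ⟨
        x ^ (l ℕ.* p ℕ.+ t) * α ∎) , (begin
        x ^ l * α * cδ ^ t * c.⟦ x ^ l * α * cδ ^ t ⟧
          ≡⟨ ≡.cong (x ^ l * α * cδ ^ t *_) (trans (c.*-homo (x ^ l * α) (cδ ^ t)) (≡.cong₂ _*_
               (trans (c.*-homo (x ^ l) α) (≡.cong₂ _*_ (trans (c.^-homo x l) (≡.cong (_^ l) cx≡x)) cα≡ᾱ))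
               (trans (c.^-homo cδ t) (≡.cong (_^ t) (conj-involutive δ))))) ⟩
        x ^ l * α * cδ ^ t * (x ^ l * ᾱ * δ ^ t)
          ≡⟨ solve 5 (λ x a b y z → x :* a :* y :* (x :* b :* z) := a :* b :* (x :* (x :* con (+ 1))) :*
            (z :* y)) ≡.refl (x ^ l) α ᾱ (cδ ^ t) (δ ^ t) ⟩
        α * ᾱ * (x ^ l) ^ 2 * (δ ^ t * cδ ^ t)
          ≡⟨ ≡.cong₂ _*_ (≡.cong₂ _*_ α*ᾱ (trans (^-swap x l 2) (^-assocʳ x 2 l)))
            (trans (sym (^-distrib-* δ cδ t)) (trans (≡.cong (_^ t) δcδ≡1) (1^n≈1 t))) ⟩
        x * x ^ (2 ℕ.* l) * 1# ≡⟨ *-identityʳ _ ⟩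
        x ^ (1 ℕ.+ 2 ℕ.* l) ∎)
      where
      cδ : Carrier
      cδ = c.⟦ δ ⟧
      cδᵖ : cδ ^ p ≡ c.⟦ ρ ⟧
      cδᵖ = trans (sym (c.^-homo δ p)) (≡.cong c.⟦_⟧ δᵖ≡ρ)
      α²cρ : α ^ 2 * c.⟦ ρ ⟧ ≡ x
      α²cρ = trans (solve 2 (λ a s → a :* (a :* con (+ 1)) :* s := a :* (s :* a)) ≡.refl α c.⟦ ρ ⟧)
        (trans (≡.cong (α *_) cρ*α) α*ᾱ)

    dickson-rational : ∀ k p m {w} → w ^ p ≡ α′ m → w * c.⟦ w ⟧ ≡ x ^ k →
                       dickson A (x ^ k) (w + c.⟦ w ⟧) p ≡ x ^ m * (α + ᾱ)
    dickson-rational k p m {w} wᵖ≡ wcw≡ = begin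
      dickson A (x ^ k) (w + c.⟦ w ⟧) p ≡⟨ ≡.cong (λ y → dickson A y (w + c.⟦ w ⟧) p) wcw≡ ⟨
      dickson A (w * c.⟦ w ⟧) (w + c.⟦ w ⟧) p ≡⟨ DicksonProperties.dickson-power-sum A w c.⟦ w ⟧ p ⟩
      w ^ p + c.⟦ w ⟧ ^ p
        ≡⟨ ≡.cong₂ _+_ wᵖ≡ (trans (sym (c.^-homo w p)) (trans (≡.cong c.⟦_⟧ wᵖ≡) (cα′ m))) ⟩
      α′ m + ᾱ′ m ≡⟨ distribˡ (x ^ m) α ᾱ ⟨
      x ^ m * (α + ᾱ) ∎

module Ratio (d R : ℚ) (R≠□ : ¬ IsSquare R) where
  open Quadratic R public
  open DiscreteField (K-field R≠□)
  open ≡.≡-Reasoning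
  private
    module ι = Hom rational

  D : ℚ
  D = d ℚ.* d ℚ.- R

  α ᾱ ρ : Carrier
  α = d + 1ℚ √
  ᾱ = d + ℚ.- 1ℚ √
  ρ = conjugateRatio d R R≠□

  D≢0 : D ≢ 0ℚ
  D≢0 D≡0 = R≠□ (d , x∙y⁻¹≈ε⇒x≈y (d ℚ.* d) R D≡0)
    where open RingProperties (CommutativeRing.ring ℚ-ring) using (x∙y⁻¹≈ε⇒x≈y)

  α*ᾱ : α * ᾱ ≡ ι.⟦ D ⟧
  α*ᾱ = ≡.cong₂ _+_√
    (ℚS.solve 2 (λ d R → d ℚS.:* d ℚS.:+ R ℚS.:* (ℚS.con (+ 1) ℚS.:* (ℚS.:- ℚS.con (+ 1))) ℚS.:= d ℚS.:* d
      ℚS.:- R) ≡.refl d R)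
    (ℚS.solve 1 (λ d → d ℚS.:* (ℚS.:- ℚS.con (+ 1)) ℚS.:+ ℚS.con (+ 1) ℚS.:* d ℚS.:= ℚS.con (+ 0)) ≡.refl d)
    where module ℚS = IntegerSolver ℚ-ring

  ᾱ≢0 : ᾱ ≢ 0#
  ᾱ≢0 eq with () ← ≡.cong im eq

  ρ*ᾱ : ρ * ᾱ ≡ α
  ρ*ᾱ = begin
    α * inverse√ R≠□ ᾱ ᾱ≢0 * ᾱ ≡⟨ *-assoc α _ ᾱ ⟩
    α * (inverse√ R≠□ ᾱ ᾱ≢0 * ᾱ) ≡⟨ ≡.cong (α *_) (≡.trans (*-comm _ ᾱ) (inverse√-inverseʳ R≠□ ᾱ ᾱ≢0)) ⟩
    α * 1# ≡⟨ *-identityʳ α ⟩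
    α ∎

  ιD≢0 : ι.⟦ D ⟧ ≢ 0#
  ιD≢0 eq = D≢0 (≡.cong re eq)

  open ConjugateRatio.Powers-of-ratio isCommutativeRing 1≉0 zeroOrInverse conj conj-involutive
    {ι.⟦ D ⟧} {α} {ᾱ} {ρ} ιD≢0 ᾱ≢0 ≡.refl ≡.refl α*ᾱ ρ*ᾱ public
    using (α′; α′≢0; power-ratio; root-of-α′; dickson-rational)

parity : ∀ n → 2 ∣ n ⊎ Odd n
parity zero = inj₁ (divides 0 ≡.refl)
parity (suc n) with parity n
... | inj₁ (divides q eq) = inj₂ (q , ≡.cong suc (≡.trans eq (ℕ.*-comm q 2)))
... | inj₂ (t , eq)       = inj₁ (divides (suc t) (≡.cong suc (≡.trans eq (≡.cong suc (ℕ.*-comm 2 t)))))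

¬2∣⇒odd : ∀ {n} → ¬ 2 ∣ n → Odd n
¬2∣⇒odd {n} ¬2∣n with parity n
... | inj₁ 2∣n = ⊥-elim (¬2∣n 2∣n)
... | inj₂ odd = odd

odd-half : ∀ l t m → 1 ℕ.+ 2 ℕ.* m ≡ (1 ℕ.+ 2 ℕ.* l) ℕ.* (1 ℕ.+ 2 ℕ.* t) → m ≡ l ℕ.* (1 ℕ.+ 2 ℕ.* t) ℕ.+ t
odd-half l t m eq = ℕ.*-cancelˡ-≡ m _ 2 (ℕ.suc-injective (≡.trans eq
  (solve 2 (λ l t → (con 1 :+ con 2 :* l) :* (con 1 :+ con 2 :* t) := con 1 :+ con 2 :*
    (l :* (con 1 :+ con 2 :* t) :+ t)) ≡.refl l t)))
  where open ℕSolver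

-- Irreducibility of f

-- Provides the copy of ℚ(√R) inside a root field over which Capelli's theorem is applied.
imageSubfield : (K F : DiscreteField) → Hom (DiscreteField.𝔽 K) (DiscreteField.𝔽 F) → Subfield F
imageSubfield K F σ = record
  { _∈S   = λ z → ∃[ κ ] z ≈ ⟦ κ ⟧
  ; resp  = λ { z≈w (κ , eq) → κ , trans (sym z≈w) eq }
  ; 1-∈   = K.1# , sym 1-homo
  ; +-∈   = λ { (κ , eq) (μ , eq′) → κ K.+ μ , trans (+-cong eq eq′) (sym (+-homo κ μ)) }
  ; *-∈   = λ { (κ , eq) (μ , eq′) → κ K.* μ , trans (*-cong eq eq′) (sym (*-homo κ μ)) }
  ; neg-∈ = λ { (κ , eq) → K.- κ , trans (-‿cong eq) (sym (-‿homo κ)) }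
  ; inv-∈ = inverse
  }
  where
  open Hom σ
  module K = DiscreteField K
  open DiscreteField F
  inverse : ∀ {z w} → z * w ≈ 1# → (∃[ κ ] z ≈ ⟦ κ ⟧) → ∃[ μ ] w ≈ ⟦ μ ⟧
  inverse {z} {w} zw≈1 (κ , z≈κ) with K.zeroOrInverse κ
  ... | inj₁ κ≈0 = ⊥-elim (1≉0 (trans (sym zw≈1) (trans (*-congʳ (trans z≈κ (trans (cong κ≈0) 0-homo)))
    (zeroˡ w))))
  ... | inj₂ (μ , κμ≈1) = μ , (begin
    w ≈⟨ *-identityˡ w ⟨
    1# * w ≈⟨ *-congʳ (trans (sym 1-homo) (trans (sym (cong κμ≈1)) (*-homo κ μ))) ⟩
    ⟦ κ ⟧ * ⟦ μ ⟧ * w ≈⟨ *-congʳ (*-congʳ (sym z≈κ)) ⟩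
    z * ⟦ μ ⟧ * w ≈⟨ solve 3 (λ z m w → z :* m :* w := z :* w :* m) refl z ⟦ μ ⟧ w ⟩
    z * w * ⟦ μ ⟧ ≈⟨ *-congʳ zw≈1 ⟩
    1# * ⟦ μ ⟧ ≈⟨ *-identityˡ ⟦ μ ⟧ ⟩
    ⟦ μ ⟧ ∎)
    where
    open ≈-Reasoning setoid
    open IntegerSolver 𝔽

odd⇒¬2∣ : ∀ m → ¬ 2 ∣ 1 ℕ.+ 2 ℕ.* m
odd⇒¬2∣ m (divides q eq) = ℕ.even≢odd q m (≡.trans (ℕ.*-comm 2 q) (≡.sym eq))

-- V = u^n satisfies V + D^n/V = 2dD^m, so s = V/D^m - d is a square root of R and V = D^m (d + s).
module RootField
  (m : ℕ) (d R : ℚ) (R≠□ : ¬ IsSquare R) (not-power : ∀ p → Prime p → p ∣ 1 ℕ.+ 2 ℕ.* m →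
    ¬ (∃[ γ ] γ ^√ p ≡ conjugateRatio d R R≠□))
  (F : DiscreteField) (φ : Hom ℚ-ring (DiscreteField.𝔽 F))
  where
  private
    D : ℚ
    D = d ℚ.* d ℚ.- R
    n : ℕ
    n = 1 ℕ.+ 2 ℕ.* m
    module φ = Hom φ
  open DiscreteField F

  module AtRoot {u v : Carrier} (uv≈D : u * v ≈ φ.⟦ D ⟧)
    (root : dickson 𝔽 φ.⟦ D ⟧ (u + v) n ≈ φ.⟦ (+ 2 ℚ./ 1) ℚ.* d ℚ.* D ℚ^.^ m ⟧)
    where
    private
      open Powers 𝔽
      open IntegerSolver 𝔽
      open ≈-Reasoning setoid
      open PolynomialRing 𝔽 using (_≋_; at; _*ₚ_; *-zeroˡ′; coeff)
      open RingProperties ring using (x∙y⁻¹≈ε⇒x≈y)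
      module Rt = Ratio d R R≠□

      V W x : Carrier
      V = u ^ n
      W = v ^ n
      x = φ.⟦ D ⟧ ^ m

      inverse-x : ∃[ δ ] x * δ ≈ 1#
      inverse-x with zeroOrInverse x
      ... | inj₂ inverse = inverse
      ... | inj₁ x≈0     = ⊥-elim (Rt.D≢0 (fieldHom-injective ℚ-field φ 1≉0 (Field.field-power F m x≈0)))

      δ s : Carrier
      δ = proj₁ inverse-x
      s = V * δ - φ.⟦ d ⟧

      sum≈ : V + W ≈ (φ.⟦ d ⟧ + φ.⟦ d ⟧) * x
      sum≈ = begin
        u ^ n + v ^ n ≈⟨ DicksonProperties.dickson-power-sum 𝔽 u v n ⟨
        dickson 𝔽 (u * v) (u + v) n ≈⟨ DicksonProperties.dickson-cong 𝔽 uv≈D refl n ⟩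
        dickson 𝔽 φ.⟦ D ⟧ (u + v) n ≈⟨ root ⟩
        φ.⟦ (+ 2 ℚ./ 1) ℚ.* d ℚ.* D ℚ^.^ m ⟧ ≈⟨ φ.*-homo ((+ 2 ℚ./ 1) ℚ.* d) (D ℚ^.^ m) ⟩
        φ.⟦ (+ 2 ℚ./ 1) ℚ.* d ⟧ * φ.⟦ D ℚ^.^ m ⟧
          ≈⟨ *-cong (φ.cong (ℚS.solve 1 (λ d → ℚS.con (+ 2) ℚS.:* d ℚS.:= d ℚS.:+ d) ≡.refl d))
            (φ.^-homo D m) ⟩
        φ.⟦ d ℚ.+ d ⟧ * x ≈⟨ *-congʳ (φ.+-homo d d) ⟩
        (φ.⟦ d ⟧ + φ.⟦ d ⟧) * x ∎
        where module ℚS = IntegerSolver ℚ-ring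

      product≈ : V * W ≈ φ.⟦ D ⟧ * (x * x)
      product≈ = begin
        u ^ n * v ^ n ≈⟨ ^-distrib-* u v n ⟨
        (u * v) ^ n ≈⟨ ^-congˡ n uv≈D ⟩
        φ.⟦ D ⟧ * φ.⟦ D ⟧ ^ (2 ℕ.* m) ≈⟨ *-congˡ (trans (sym (^-assocʳ φ.⟦ D ⟧ 2 m)) (^-swap φ.⟦ D ⟧ 2 m)) ⟩
        φ.⟦ D ⟧ * (x * (x * 1#)) ≈⟨ *-congˡ (*-congˡ (*-identityʳ x)) ⟩
        φ.⟦ D ⟧ * (x * x) ∎

      -- By `sum≈` and `product≈`, V/Dᵐ is a root of T² - 2dT + D; completing the square leaves d² -
      -- D = R.
      s² : s * s ≈ φ.⟦ R ⟧
      s² = begin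
        (V * δ - e) * (V * δ - e)
          ≈⟨ solve 4 (λ V W δ e → (V :* δ :- e) :* (V :* δ :- e) := (V :* (V :+ W) :- V :* W) :* (δ :* δ) :-
            (e :+ e) :* V :* δ :+ e :* e) refl V W δ e ⟩
        (V * (V + W) - V * W) * (δ * δ) - (e + e) * V * δ + e * e
          ≈⟨ +-congʳ (+-congʳ (*-congʳ (+-cong (*-congˡ sum≈) (-‿cong product≈)))) ⟩
        (V * ((e + e) * x) - y * (x * x)) * (δ * δ) - (e + e) * V * δ + e * e
          ≈⟨ solve 5 (λ V x y δ e → (V :* ((e :+ e) :* x) :- y :* (x :* x)) :* (δ :* δ) :- (e :+ e) :* V :*
            δ :+ e :* e :=
               (e :+ e) :* V :* δ :* (x :* δ) :- y :* ((x :* δ) :* (x :* δ)) :- (e :+ e) :* V :* δ :+ e :*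
                 e) refl V x y δ e ⟩
        (e + e) * V * δ * (x * δ) - y * ((x * δ) * (x * δ)) - (e + e) * V * δ + e * e
          ≈⟨ +-congʳ (+-congʳ (+-cong (*-congˡ xδ≈1) (-‿cong (*-congˡ (*-cong xδ≈1 xδ≈1))))) ⟩
        (e + e) * V * δ * 1# - y * (1# * 1#) - (e + e) * V * δ + e * e
          ≈⟨ solve 4 (λ V y δ e → (e :+ e) :* V :* δ :* con (+ 1) :- y :* (con (+ 1) :* con (+ 1)) :-
            (e :+ e) :* V :* δ :+ e :* e := e :* e :- y) refl V y δ e ⟩
        e * e - y
          ≈⟨ +-congˡ (-‿cong (trans (φ.+-homo (d ℚ.* d) (ℚ.- R)) (+-cong (φ.*-homo d d) (φ.-‿homo R)))) ⟩
        e * e - (e * e - φ.⟦ R ⟧)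
          ≈⟨ solve 2 (λ e r → e :* e :- (e :* e :- r) := r) refl e φ.⟦ R ⟧ ⟩
        φ.⟦ R ⟧ ∎
        where
        e y : Carrier
        e = φ.⟦ d ⟧
        y = φ.⟦ D ⟧
        xδ≈1 : x * δ ≈ 1#
        xδ≈1 = proj₂ inverse-x

      σ : Hom Rt.K-ring 𝔽
      σ = record
        { ⟦_⟧    = λ z → φ.⟦ re z ⟧ + φ.⟦ im z ⟧ * s
        ; cong   = λ { ≡.refl → refl }
        ; +-homo = λ { (a + b √) (c + e √) → trans (+-cong (φ.+-homo a c) (*-congʳ (φ.+-homo b e)))
            (solve 5 (λ a b c e s → a :+ c :+ (b :+ e) :* s := a :+ b :* s :+ (c :+ e :* s)) refl φ.⟦ a ⟧
              φ.⟦ b ⟧ φ.⟦ c ⟧ φ.⟦ e ⟧ s) }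
        ; *-homo = λ { (a + b √) (c + e √) → begin
            φ.⟦ a ℚ.* c ℚ.+ R ℚ.* (b ℚ.* e) ⟧ + φ.⟦ a ℚ.* e ℚ.+ b ℚ.* c ⟧ * s
              ≈⟨ +-cong (trans (φ.+-homo _ _) (+-cong (φ.*-homo a c)
                (trans (φ.*-homo R _) (*-cong (sym s²) (φ.*-homo b e)))))
                   (*-congʳ (trans (φ.+-homo _ _) (+-cong (φ.*-homo a e) (φ.*-homo b c)))) ⟩
            φ.⟦ a ⟧ * φ.⟦ c ⟧ + s * s * (φ.⟦ b ⟧ * φ.⟦ e ⟧) + (φ.⟦ a ⟧ * φ.⟦ e ⟧ + φ.⟦ b ⟧ * φ.⟦ c ⟧) * s
              ≈⟨ solve 5 (λ a b c e s → a :* c :+ s :* s :* (b :* e) :+ (a :* e :+ b :* c) :* s :=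
                (a :+ b :* s) :* (c :+ e :* s))
                   refl φ.⟦ a ⟧ φ.⟦ b ⟧ φ.⟦ c ⟧ φ.⟦ e ⟧ s ⟩
            (φ.⟦ a ⟧ + φ.⟦ b ⟧ * s) * (φ.⟦ c ⟧ + φ.⟦ e ⟧ * s) ∎ }
        ; 1-homo = σ-rational 1ℚ φ.1-homo
        }
        where
        σ-rational : ∀ q {z} → φ.⟦ q ⟧ ≈ z → φ.⟦ q ⟧ + φ.⟦ 0ℚ ⟧ * s ≈ z
        σ-rational q eq = trans (+-cong eq (trans (*-congʳ φ.0-homo) (zeroˡ s))) (+-identityʳ _)

      module σ = Hom σ

      σ-rational : ∀ q → σ.⟦ Hom.⟦ Rt.rational ⟧ q ⟧ ≈ φ.⟦ q ⟧
      σ-rational q = trans (+-congˡ (trans (*-congʳ φ.0-homo) (zeroˡ s))) (+-identityʳ _)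

      σα′ : σ.⟦ Rt.α′ m ⟧ ≈ V
      σα′ = begin
        σ.⟦ Rt.α′ m ⟧ ≈⟨ σ.*-homo (Powers._^_ Rt.K-ring (Hom.⟦ Rt.rational ⟧ D) m) Rt.α ⟩
        σ.⟦ Powers._^_ Rt.K-ring (Hom.⟦ Rt.rational ⟧ D) m ⟧ * σ.⟦ Rt.α ⟧
          ≈⟨ *-cong (trans (σ.^-homo (Hom.⟦ Rt.rational ⟧ D) m) (^-congˡ m (σ-rational D)))
            (+-congˡ (*-congʳ φ.1-homo)) ⟩
        x * (φ.⟦ d ⟧ + 1# * (V * δ - φ.⟦ d ⟧))
          ≈⟨ solve 4 (λ x e V δ → x :* (e :+ con (+ 1) :* (V :* δ :- e)) := V :* (x :* δ)) refl x φ.⟦ d ⟧ V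
            δ ⟩
        V * (x * δ) ≈⟨ *-congˡ (proj₂ inverse-x) ⟩
        V * 1# ≈⟨ *-identityʳ V ⟩
        V ∎

      S : Subfield F
      S = imageSubfield (Rt.K-field R≠□) F σ

      open Subfield S using (_∈S)

      σ-injective : Hom.Injective σ
      σ-injective = fieldHom-injective (Rt.K-field R≠□) σ 1≉0

      a≉0 : ¬ σ.⟦ Rt.α′ m ⟧ ≈ 0#
      a≉0 eq = Rt.α′≢0 m (σ-injective eq)

      open Capelli F S {σ.⟦ Rt.α′ m ⟧} (Rt.α′ m , refl) a≉0

      factorisation : PrimeFactorisation n
      factorisation = factorise n

      open PrimeFactorisation factorisation

      conditions : ∀ {p} → Prime p → p ∣ n → Prime p × Odd p × ¬ (∃[ b ] b ∈S × b ^ p ≈ σ.⟦ Rt.α′ m ⟧)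
      conditions {p} p-prime p∣n = p-prime , ¬2∣⇒odd (λ 2∣p → odd⇒¬2∣ m (∣-trans 2∣p p∣n)) , no-root
        where
        no-root : ¬ (∃[ b ] b ∈S × b ^ p ≈ σ.⟦ Rt.α′ m ⟧)
        no-root (b , (κ , b≈κ) , bᵖ≈) = not-power p p-prime p∣n
          (Rt.power-ratio m p {{prime⇒nonZero p-prime}} κ
          (Hom.injective σ σ-injective (trans (σ.^-homo κ p) (trans (^-congˡ p (sym b≈κ)) bᵖ≈))))

      minimal : Minimal u n
      minimal = ≡.subst (Minimal u) (≡.sym isFactorisation) (capelli
        (All.tabulate λ {p} p∈ → conditions (All.lookup factorsPrime p∈)
          (≡.subst (p ∣_) (≡.sym isFactorisation) (∈⇒∣product p∈)))
        (trans (reflexive (≡.cong (u ^_) (≡.sym isFactorisation))) (sym σα′)))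

    -- By `minimal`, u has degree n over the copy of ℚ(√R), which contains the rational coefficients
    -- of b, so a monic b of smaller degree cannot vanish at u.
    no-small-root : ∀ b → length b < n → ¬ ev φ (M ℚ-ring b) u ≈ 0#
    no-small-root b |b|<n bu≈0 = contradict (minimal {M 𝔽 b′} (Field.M-∈ F S (b′∈ b)) b′u≈0)
      where
      b′ : List Carrier
      b′ = map φ.⟦_⟧ b
      q : List Carrier
      q = binomial 𝔽 n σ.⟦ Rt.α′ m ⟧
      b′∈ : ∀ b → All _∈S (map φ.⟦_⟧ b)
      b′∈ []      = []
      b′∈ (a ∷ b) = (Hom.⟦ Rt.rational ⟧ a , sym (σ-rational a)) ∷ b′∈ b
      b′u≈0 : ev (idHom {𝔽}) (M 𝔽 b′) u ≈ 0#
      b′u≈0 = trans (ev-M-map φ (idHom {𝔽}) b u)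
        (trans (ev-agree (idHom {𝔽} ∘ʰ φ) φ (λ _ → refl) (M ℚ-ring b) u) bu≈0)
      contradict : ¬ (∃[ t ] M 𝔽 b′ ≋ t *ₚ M 𝔽 q)
      contradict (t , eq) = 1≉0 (trans (sym (proj₁ (M-isMonic b′)))
        (trans (at eq (length b′)) (*-zeroˡ′ t (M 𝔽 q) (at t≋0) (length b′))))
        where
        open Monic 𝔽 using (M-isMonic; monic-multiple)
        t≋0 : t ≋ []
        t≋0 = monic-multiple (M-isMonic q) t λ {i} |q|≤i → trans (sym (at eq i)) (proj₂ (M-isMonic b′)
          (≡.subst₂ _<_ (≡.sym (length-map φ.⟦_⟧ b)) ≡.refl (ℕ.<-≤-trans |b|<n
            (≡.subst (_≤ i) (length-binomial 𝔽 n σ.⟦ Rt.α′ m ⟧) |q|≤i))))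

-- Monic products and the substitution Z = u + c/u

module _ (A : CRing) where
  open CommutativeRing A
  open PolynomialRing A
  open Monic A hiding (M)
  private module P = CommutativeRing polyRing
  open Powers polyRing using () renaming (_^_ to _^ₚ_)

  IsMonic-X* : ∀ {n p} → IsMonic n p → IsMonic (suc n) (X *ₚ p)
  IsMonic-X* {n} {p} (lead , top) = IsMonic-resp {q = X *ₚ p} (P.sym (X-* A p))
    (lead , λ { (s≤s n<i) → top n<i })

  IsMonic-X^ : ∀ n → IsMonic n (X ^ₚ n)
  IsMonic-X^ zero    = refl , λ { (s≤s _) → refl }
  IsMonic-X^ (suc n) = IsMonic-X* {n} {X ^ₚ n} (IsMonic-X^ n)

  IsMonic-+ : ∀ {n p q} → IsMonic n p → (∀ {i} → n ≤ i → coeff q i ≈ 0#) → IsMonic n (p +ₚ q)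
  IsMonic-+ {n} {p} {q} (lead , top) low =
    trans (coeff-+ p q n) (trans (+-cong lead (low ℕ.≤-refl)) (+-identityʳ 1#)) ,
    λ {i} n<i → trans (coeff-+ p q i) (trans (+-cong (top n<i) (low (ℕ.<⇒≤ n<i))) (+-identityʳ 0#))

  M-*-isMonic : ∀ q {k p} → IsMonic k p → IsMonic (length q ℕ.+ k) (M A q *ₚ p)
  M-*-isMonic []      {k} {p} mon = IsMonic-resp {q = M A [] *ₚ p} (P.sym (P.*-identityˡ p)) mon
  M-*-isMonic (a ∷ q) {k} {p} mon@(_ , top) =
      trans (shift (length q ℕ.+ k) (s≤s (ℕ.m≤n+m k (length q)))) (proj₁ rec)
    , λ { {suc i} (s≤s l<i) → trans (shift i (ℕ.<-trans (s≤s (ℕ.m≤n+m k (length q))) (s≤s l<i)))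
      (proj₂ rec l<i) }
    where
    rec : IsMonic (length q ℕ.+ k) (M A q *ₚ p)
    rec = M-*-isMonic q {k} {p} mon
    shift : ∀ i → k < suc i → coeff (M A (a ∷ q) *ₚ p) (suc i) ≈ coeff (M A q *ₚ p) i
    shift i k<i = trans (coeff-∷* a (M A q) p (suc i)) (trans
      (+-congʳ (trans (*-congˡ (top k<i)) (zeroʳ a))) (+-identityˡ _))

  -- u^|q| M q (u + c/u) as a polynomial in u.
  homogenise : Carrier → List Carrier → Poly
  homogenise c []      = P.1#
  -- The factor X² + c is written as a difference with `- c` to have the shape handled by
  -- `IsMonic-next`.
  homogenise c (a ∷ q) = (X *ₚ (X *ₚ homogenise c q) P.- (- c ∷ []) *ₚ homogenise c q) +ₚ (a ∷ []) *ₚ X ^ₚ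
    suc (length q)

  homogenise-isMonic : ∀ c q → IsMonic (2 ℕ.* length q) (homogenise c q)
  homogenise-isMonic c []      = refl , λ { (s≤s _) → refl }
  homogenise-isMonic c (a ∷ q) = ≡.subst (λ k → IsMonic k (homogenise c (a ∷ q))) (≡.sym (ℕ.*-suc 2 l))
    (IsMonic-+ {2 ℕ.+ 2 ℕ.* l} {X *ₚ (X *ₚ H) P.- (- c ∷ []) *ₚ H} {(a ∷ []) *ₚ X ^ₚ suc l}
      (IsMonic-next A {2 ℕ.* l} {X *ₚ H} {H} (- c) (IsMonic-X* {2 ℕ.* l} {H} (homogenise-isMonic c q))
        (proj₂ (homogenise-isMonic c q)))
      λ {i} 2+2l≤i → trans (coeff-∷* a [] (X ^ₚ suc l) i) (trans
        (+-cong (trans (*-congˡ (proj₂ (IsMonic-X^ (suc l)) (ℕ.≤-trans (s≤s (s≤s (ℕ.m≤m+n l _))) 2+2l≤i)))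
        (zeroʳ a)) (at 0∷[] i)) (+-identityʳ 0#)))
    where
    l : ℕ
    l = length q
    H : Poly
    H = homogenise c q
    0∷[] : 0# ∷ [] ≋ []
    0∷[] = ⟨ (λ { zero → refl ; (suc i) → refl }) ⟩

module _ {A B : CRing} (φ : Hom A B) where
  private
    module A = CommutativeRing A
    module φ = Hom φ
  open CommutativeRing B
  open PolynomialRing A
  open Powers B
  open IntegerSolver B
  open ≈-Reasoning setoid

  ev-homogenise-∷ : ∀ c a q u → ev φ (homogenise A c (a ∷ q)) u ≈
                    (u * u + φ.⟦ c ⟧) * ev φ (homogenise A c q) u + φ.⟦ a ⟧ * u ^ suc (length q)
  ev-homogenise-∷ c a q u = begin
    ev φ (homogenise A c (a ∷ q)) u
      ≈⟨ +-homo (X *ₚ (X *ₚ H) +ₚ -ₚ ((A.- c ∷ []) *ₚ H)) ((a ∷ []) *ₚ X ^ₚ suc (length q)) ⟩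
    ev φ (X *ₚ (X *ₚ H) +ₚ -ₚ ((A.- c ∷ []) *ₚ H)) u + ev φ ((a ∷ []) *ₚ X ^ₚ suc (length q)) u
      ≈⟨ +-cong (trans (+-homo (X *ₚ (X *ₚ H)) (-ₚ ((A.- c ∷ []) *ₚ H))) (+-cong
           (trans (*-homo X (X *ₚ H)) (*-cong evX (trans (*-homo X H) (*-congʳ evX))))
           (trans (-‿homo ((A.- c ∷ []) *ₚ H))
             (-‿cong (trans (*-homo (A.- c ∷ []) H) (*-congʳ
             (trans (Evaluation.ev-const φ (A.- c) u) (φ.-‿homo c))))))))
           (trans (*-homo (a ∷ []) (X ^ₚ suc (length q))) (*-cong (Evaluation.ev-const φ a u)
             (trans (^-homo X (suc (length q))) (^-congˡ (suc (length q)) evX)))) ⟩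
    u * (u * E) - - φ.⟦ c ⟧ * E + φ.⟦ a ⟧ * u ^ suc (length q)
      ≈⟨ +-congʳ (solve 3 (λ u c E → u :* (u :* E) :- (:- c) :* E := (u :* u :+ c) :* E) refl u φ.⟦ c ⟧ E) ⟩
    (u * u + φ.⟦ c ⟧) * E + φ.⟦ a ⟧ * u ^ suc (length q) ∎
    where
    open Hom (Evaluation.evHom φ u)
    open Powers polyRing using () renaming (_^_ to _^ₚ_)
    H : Poly
    H = homogenise A c q
    E : Carrier
    E = ev φ H u
    evX : ev φ X u ≈ u
    evX = Evaluation.ev-X φ u

  -- The hypothesis is z = u + c/u with the denominator cleared, so the identity holds in any
  -- commutative ring by Horner's scheme.
  ev-homogenise : ∀ {c u z} → u * z ≈ u * u + φ.⟦ c ⟧ → ∀ q →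
    ev φ (homogenise A c q) u ≈ u ^ length q * ev φ (M A q) z
  ev-homogenise {c} {u} {z} uz≈ []      =
    trans (trans (Evaluation.ev-const φ A.1# u) (sym (Evaluation.ev-const φ A.1# z))) (sym (*-identityˡ _))
  ev-homogenise {c} {u} {z} uz≈ (a ∷ q) = begin
    ev φ (homogenise A c (a ∷ q)) u
      ≈⟨ ev-homogenise-∷ c a q u ⟩
    (u * u + φ.⟦ c ⟧) * ev φ (homogenise A c q) u + φ.⟦ a ⟧ * (u * u ^ l)
      ≈⟨ +-congʳ (*-cong (sym uz≈) (ev-homogenise uz≈ q)) ⟩
    u * z * (u ^ l * E) + φ.⟦ a ⟧ * (u * u ^ l)
      ≈⟨ solve 5 (λ u z x E a → u :* z :* (x :* E) :+ a :* (u :* x) := u :* x :* (a :+ z :* E)) refl u z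
        (u ^ l) E φ.⟦ a ⟧ ⟩
    u * u ^ l * (φ.⟦ a ⟧ + z * E) ∎
    where
    l : ℕ
    l = length q
    E : Carrier
    E = ev φ (M A q) z

  -- Rules out u = 0 as a root when c is nonzero in a field, so that c/u can be formed at a root.
  ev-homogenise-0 : ∀ c q {u} → u ≈ 0# → ev φ (homogenise A c q) u ≈ φ.⟦ c ⟧ ^ length q
  ev-homogenise-0 c []      u≈0 = trans (Evaluation.ev-const φ A.1# _) φ.1-homo
  ev-homogenise-0 c (a ∷ q) {u} u≈0 = begin
    ev φ (homogenise A c (a ∷ q)) u
      ≈⟨ ev-homogenise-∷ c a q u ⟩
    (u * u + φ.⟦ c ⟧) * ev φ (homogenise A c q) u + φ.⟦ a ⟧ * (u * u ^ l)
      ≈⟨ +-cong (*-cong (+-congʳ (*-congʳ u≈0)) (ev-homogenise-0 c q u≈0)) (*-congˡ (*-congʳ u≈0)) ⟩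
    (0# * u + φ.⟦ c ⟧) * φ.⟦ c ⟧ ^ l + φ.⟦ a ⟧ * (0# * u ^ l)
      ≈⟨ solve 5 (λ u c x a y → (con (+ 0) :* u :+ c) :* x :+ a :* (con (+ 0) :* y) := c :* x) refl u
        φ.⟦ c ⟧ (φ.⟦ c ⟧ ^ l) φ.⟦ a ⟧ (u ^ l) ⟩
    φ.⟦ c ⟧ * φ.⟦ c ⟧ ^ l ∎
    where
    l : ℕ
    l = length q

-- Divisibility in ℚ[Z]

open PolynomialRing ℚ-ring
open Algebra.Definitions.RawMagma (RawMonoid.rawMagma (RawSemiring.*-rawMonoid ℚ[Z]-rawSemiring))
  using () renaming (_∣_ to _∣ₚ_; _,_ to divides-by)
private
  module P = CommutativeRing polyRing
  module const = Hom const
open Monic ℚ-ring using (IsMonic; IsMonic-resp; monic-multiple; M-isMonic; takeCoeffs; length-takeCoeffs; IsMonic⇒M)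

1≢0 : 1ℚ ≢ 0ℚ
1≢0 ()

monic∤1 : ∀ {k p} → 0 < k → IsMonic k p → ¬ p ∣ₚ P.1#
monic∤1 {k} {p} 0<k mon (divides-by t tp≈1) = 1≢0 (≡.trans (≡.sym (tp≈1 0)) (*-zeroˡ′ t p (at t≋[]) 0))
  where
  t≋[] : t ≋ []
  t≋[] = monic-multiple mon t λ { {zero} k≤0 → ⊥-elim (ℕ.<⇒≱ 0<k k≤0) ; {suc i} _ → tp≈1 (suc i) }

module _ (m : ℕ) (d R : ℚ) where
  private
    n : ℕ
    n = 1 ℕ.+ 2 ℕ.* m
    D e : ℚ
    D = d ℚ.* d ℚ.- R
    e = (+ 2 ℚ./ 1) ℚ.* d ℚ.* D ℚ^.^ m

  f-dickson : .(3≤n : 3 ≤ n) → f n 3≤n d R ≋ dickson polyRing const.⟦ D ⟧ X n P.- const.⟦ e ⟧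
  f-dickson 3≤n = P.trans (P.sym (ev-generic ℚ-ring (f n 3≤n d R)))
    (DicksonExpansion.ev-f const m 3≤n d R X)

  f-isMonic : .(3≤n : 3 ≤ n) → IsMonic n (f n 3≤n d R)
  f-isMonic 3≤n = IsMonic-resp (P.sym (f-dickson 3≤n)) (IsMonic-sub-const ℚ-ring
    {p = dickson polyRing const.⟦ D ⟧ X n} e (dickson-isMonic ℚ-ring D (2 ℕ.* m)))

-- A p-th power makes f reducible

module Reducible (m : ℕ) (d R : ℚ) (R≠□ : ¬ IsSquare R) where
  open Ratio d R R≠□
  private
    n : ℕ
    n = 1 ℕ.+ 2 ℕ.* m
    e : ℚ
    e = (+ 2 ℚ./ 1) ℚ.* d ℚ.* D ℚ^.^ m
    module ι = Hom rational
    open Powers polyRing using () renaming (_^_ to _^ₚ_)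

  rational-value : ∀ l t → n ≡ (1 ℕ.+ 2 ℕ.* l) ℕ.* (1 ℕ.+ 2 ℕ.* t) → ∃[ γ ] γ ^√ (1 ℕ.+ 2 ℕ.* t) ≡ ρ →
                   ∃[ y ] dickson ℚ-ring (D ℚ^.^ (1 ℕ.+ 2 ℕ.* l)) y (1 ℕ.+ 2 ℕ.* t) ≡ e
  rational-value l t n≡kp (γ , γᵖ≡ρ) = from-root (root-of-α′ l t γ γᵖ≡ρ)
    where
    open Powers K-ring
    k p : ℕ
    k = 1 ℕ.+ 2 ℕ.* l
    p = 1 ℕ.+ 2 ℕ.* t
    from-root : ∃[ w ] w ^ p ≡ α′ (l ℕ.* p ℕ.+ t) × w *√ Hom.⟦ conj ⟧ w ≡ ι.⟦ D ⟧ ^ k →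
      ∃[ y ] dickson ℚ-ring (D ℚ^.^ k) y p ≡ e
    -- The equation is proved in ℚ(√R), where w exists, and its rational part is taken; y is the
    -- trace of w.
    from-root (w , wᵖ≡ , wcw≡) = y , ≡.cong re (begin
      ι.⟦ dickson ℚ-ring (D ℚ^.^ k) y p ⟧ ≡⟨ dickson-homo rational (D ℚ^.^ k) y p ⟩
      dickson K-ring ι.⟦ D ℚ^.^ k ⟧ ι.⟦ y ⟧ p
        ≡⟨ ≡.cong₂ (λ a b → dickson K-ring a b p) (ι.^-homo D k) (≡.sym (trace w)) ⟩
      dickson K-ring (ι.⟦ D ⟧ ^ k) (w +√ Hom.⟦ conj ⟧ w) p
        ≡⟨ dickson-rational k p (l ℕ.* p ℕ.+ t) {w} wᵖ≡ wcw≡ ⟩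
      ι.⟦ D ⟧ ^ (l ℕ.* p ℕ.+ t) *√ (α +√ ᾱ)
        ≡⟨ ≡.cong₂ (λ i z → ι.⟦ D ⟧ ^ i *√ z) (≡.sym (odd-half l t m n≡kp)) (trace α) ⟩
      ι.⟦ D ⟧ ^ m *√ ι.⟦ d ℚ.+ d ⟧ ≡⟨ ≡.cong (_*√ ι.⟦ d ℚ.+ d ⟧) (ι.^-homo D m) ⟨
      ι.⟦ D ℚ^.^ m ⟧ *√ ι.⟦ d ℚ.+ d ⟧ ≡⟨ ι.*-homo (D ℚ^.^ m) (d ℚ.+ d) ⟨
      ι.⟦ D ℚ^.^ m ℚ.* (d ℚ.+ d) ⟧
        ≡⟨ ≡.cong ι.⟦_⟧ (solve 2 (λ x d → x :* (d :+ d) := con (+ 2) :* d :* x) ≡.refl (D ℚ^.^ m) d) ⟩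
      ι.⟦ e ⟧ ∎)
      where
      open ≡.≡-Reasoning
      open IntegerSolver ℚ-ring
      y : ℚ
      y = re w ℚ.+ re w

  factorisation : ∀ k p y → n ≡ suc k ℕ.* p → dickson ℚ-ring (D ℚ^.^ suc k) y p ≡ e →
    .(3≤n : 3 ≤ n) → ∃[ h ] ∃[ q ] IsMonic (suc k) h × f n 3≤n d R ≋ h *ₚ q
  factorisation k p y n≡kp value 3≤n = from-factor (dickson-factor (const.⟦ D ⟧ ^ₚ suc k) Dₖ const.⟦ y ⟧ p)
    where
    open DicksonProperties polyRing using (dickson-factor; dickson-cong)
    open ≈-Reasoning P.setoid
    Dₖ : Poly
    Dₖ = dickson polyRing const.⟦ D ⟧ X (suc k)
    from-factor : ∃[ q ] dickson polyRing (const.⟦ D ⟧ ^ₚ suc k) Dₖ p P.- dickson polyRing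
      (const.⟦ D ⟧ ^ₚ suc k) const.⟦ y ⟧ p ≋ (Dₖ P.- const.⟦ y ⟧) *ₚ q →
                  ∃[ h ] ∃[ q ] IsMonic (suc k) h × f n 3≤n d R ≋ h *ₚ q
    from-factor (q , eq) = Dₖ P.- const.⟦ y ⟧ , q , IsMonic-sub-const ℚ-ring {p = Dₖ} y
      (dickson-isMonic ℚ-ring D k) , (begin
      f n 3≤n d R
        ≈⟨ f-dickson m d R 3≤n ⟩
      dickson polyRing const.⟦ D ⟧ X n P.- const.⟦ e ⟧
        ≡⟨ ≡.cong (λ i → dickson polyRing const.⟦ D ⟧ X i P.- const.⟦ e ⟧) n≡kp ⟩
      dickson polyRing const.⟦ D ⟧ X (suc k ℕ.* p) P.- const.⟦ e ⟧
        ≈⟨ P.+-cong (P.sym (dickson-∘ polyRing const.⟦ D ⟧ X (suc k) p)) (P.-‿cong const-e) ⟩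
      dickson polyRing (const.⟦ D ⟧ ^ₚ suc k) Dₖ p P.- dickson polyRing (const.⟦ D ⟧ ^ₚ suc k) const.⟦ y ⟧ p
        ≈⟨ eq ⟩
      (Dₖ P.- const.⟦ y ⟧) *ₚ q ∎)
      where
      const-e : const.⟦ e ⟧ ≋ dickson polyRing (const.⟦ D ⟧ ^ₚ suc k) const.⟦ y ⟧ p
      const-e = P.trans (const.cong (≡.sym value)) (P.trans (dickson-homo const (D ℚ^.^ suc k) y p)
        (dickson-cong (const.^-homo D (suc k)) P.refl p))

  irreducible⇒¬power : .(3≤n : 3 ≤ n) → Irreducible (f n 3≤n d R) →
                       ∀ k p → 1 < p → n ≡ suc k ℕ.* p → ∀ y → ¬ dickson ℚ-ring (D ℚ^.^ suc k) y p ≡ e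
  irreducible⇒¬power 3≤n irr k p 1<p n≡kp y value = contradict (factorisation k p y n≡kp value 3≤n)
    where
    k<n : suc k < n
    k<n = ≡.subst (suc k ℕ.<_) (≡.sym n≡kp) (ℕ.m<m*n (suc k) p 1<p)
    contradict : ¬ (∃[ h ] ∃[ q ] IsMonic (suc k) h × f n 3≤n d R ≋ h *ₚ q)
    contradict (h , q , h-monic , f≋hq) = cases (Irreducible.split-∣1 irr {h} {q} (at f≋hq))
      where
      open Defs using (module Irreducible)
      cases : ¬ (h ∣ₚ P.1# ⊎ q ∣ₚ P.1#)
      cases (inj₁ h∣1) = monic∤1 (s≤s z≤n) h-monic h∣1
      -- If t inverts the cofactor, then t f = h has degree below n, which is impossible for a
      -- nonzero multiple of the monic f.
      cases (inj₂ (divides-by t tq≈1)) =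
        1≢0 (≡.trans (≡.sym (proj₁ h-monic)) (≡.trans (at (P.sym tf≋h) (suc k))
        (*-zeroˡ′ t (f n 3≤n d R) (at t≋[]) (suc k))))
        where
        open IntegerSolver polyRing
        tf≋h : t *ₚ f n 3≤n d R ≋ h
        tf≋h = P.trans (P.*-congˡ {t} f≋hq)
          (P.trans (solve 3 (λ t h q → t :* (h :* q) := t :* q :* h) P.refl t h q)
          (P.trans (P.*-congʳ {h} {t *ₚ q} {P.1#} ⟨ tq≈1 ⟩) (P.*-identityˡ h)))
        t≋[] : t ≋ []
        t≋[] = monic-multiple (f-isMonic m d R 3≤n) t λ {i} n≤i →
          ≡.trans (at tf≋h i) (proj₂ h-monic (ℕ.<-≤-trans k<n n≤i))

-- Irreducibility of f in the absence of p-th powers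

module _ (m : ℕ) (d R : ℚ) (R≠□ : ¬ IsSquare R) .(3≤n : 3 ≤ 1 ℕ.+ 2 ℕ.* m)
         (not-power : ∀ p → Prime p → p ∣ 1 ℕ.+ 2 ℕ.* m → ¬ (∃[ γ ] γ ^√ p ≡ conjugateRatio d R R≠□)) where
  private
    n : ℕ
    n = 1 ℕ.+ 2 ℕ.* m
    D : ℚ
    D = d ℚ.* d ℚ.- R

  -- The value of the homogenised factor at 0 is a power of D ≠ 0, so u is invertible and v = D/u
  -- exists. Then u + v is a root of the factor, hence of f, and `no-small-root` applies. The field
  -- is arbitrary so that a root of any irreducible factor can be used.
  no-root-of-factor : ∀ q t → f n 3≤n d R ≋ t *ₚ M ℚ-ring q →
    (F : DiscreteField) (φ : Hom ℚ-ring (DiscreteField.𝔽 F)) →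
    let open DiscreteField F in ∀ {u} → ev φ (homogenise ℚ-ring D q) u ≈ 0# →
    ∀ b → length b < n → ¬ ev φ (M ℚ-ring b) u ≈ 0#
  no-root-of-factor q t f≋tq F φ {u} Hu≈0 = invertible (zeroOrInverse u)
    where
    open DiscreteField F
    open Field F using (field-power; field-product)
    open Powers 𝔽
    open ≈-Reasoning setoid
    open RingProperties ring using (x∙y⁻¹≈ε⇒x≈y)
    module φ = Hom φ
    Conclusion : Set
    Conclusion = ∀ b → length b < n → ¬ ev φ (M ℚ-ring b) u ≈ 0#
    φD≉0 : ¬ φ.⟦ D ⟧ ≈ 0#
    φD≉0 eq = Ratio.D≢0 d R R≠□ (fieldHom-injective ℚ-field φ 1≉0 eq)
    invertible : u ≈ 0# ⊎ (∃[ u′ ] u * u′ ≈ 1#) → Conclusion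
    invertible (inj₁ u≈0)          =
      ⊥-elim (φD≉0 (field-power (length q) (trans (sym (ev-homogenise-0 φ D q u≈0)) Hu≈0)))
    invertible (inj₂ (u′ , uu′≈1)) = RootField.AtRoot.no-small-root m d R R≠□ not-power F φ {u} {v} uv≈D
      root
      where
      v z : Carrier
      v = φ.⟦ D ⟧ * u′
      z = u + v
      uv≈D : u * v ≈ φ.⟦ D ⟧
      uv≈D = begin
        u * (φ.⟦ D ⟧ * u′) ≈⟨ solve 3 (λ u x w → u :* (x :* w) := x :* (u :* w)) refl u φ.⟦ D ⟧ u′ ⟩
        φ.⟦ D ⟧ * (u * u′) ≈⟨ *-congˡ uu′≈1 ⟩
        φ.⟦ D ⟧ * 1# ≈⟨ *-identityʳ _ ⟩
        φ.⟦ D ⟧ ∎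
        where open IntegerSolver 𝔽
      uz≈ : u * z ≈ u * u + φ.⟦ D ⟧
      uz≈ = trans (distribˡ u u v) (+-congˡ uv≈D)
      u≉0 : ¬ u ≈ 0#
      u≉0 u≈0 = 1≉0 (trans (sym uu′≈1) (trans (*-congʳ u≈0) (zeroˡ u′)))
      qz≈0 : ev φ (M ℚ-ring q) z ≈ 0#
      qz≈0 = cases (field-product (trans (sym (ev-homogenise φ uz≈ q)) Hu≈0))
        where
        cases : u ^ length q ≈ 0# ⊎ ev φ (M ℚ-ring q) z ≈ 0# → ev φ (M ℚ-ring q) z ≈ 0#
        cases (inj₁ uˡ≈0) = ⊥-elim (u≉0 (field-power (length q) uˡ≈0))
        cases (inj₂ eq)   = eq
      fz≈0 : ev φ (f n 3≤n d R) z ≈ 0#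
      fz≈0 = trans (evz.cong f≋tq) (trans (evz.*-homo t (M ℚ-ring q)) (trans (*-congˡ qz≈0) (zeroʳ _)))
        where module evz = Hom (Evaluation.evHom φ z)
      root : dickson 𝔽 φ.⟦ D ⟧ z n ≈ φ.⟦ (+ 2 ℚ./ 1) ℚ.* d ℚ.* D ℚ^.^ m ⟧
      root = x∙y⁻¹≈ε⇒x≈y _ _ (trans (sym (DicksonExpansion.ev-f φ m 3≤n d R z)) fz≈0)

  -- The homogenised factor has degree 2 deg q < n, so each of its irreducible factors would supply
  -- a root u of degree below n over ℚ.
  no-small-factor : ∀ q → 0 < length q → 2 ℕ.* length q < n → ∀ t → ¬ f n 3≤n d R ≋ t *ₚ M ℚ-ring q
  -- The goal is empty, so the doubly negated existence of an irreducible factor suffices.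
  no-small-factor q 0<|q| 2|q|<n t f≋tq = irreducibleFactor g 0<|g| refute
    where
    open Field ℚ-field using (irreducibleFactor; _∣ᴹ_; Irreducible′; rootExtension)
    H : Poly
    H = homogenise ℚ-ring D q
    g : List ℚ
    g = takeCoeffs (2 ℕ.* length q) H
    |g| : length g ≡ 2 ℕ.* length q
    |g| = length-takeCoeffs (2 ℕ.* length q) H
    0<|g| : 0 < length g
    0<|g| = ≡.subst (0 ℕ.<_) (≡.sym |g|) (ℕ.<-≤-trans 0<|q| (ℕ.m≤m+n (length q) _))
    g≋H : M ℚ-ring g ≋ H
    g≋H = IsMonic⇒M (2 ℕ.* length q) H (homogenise-isMonic ℚ-ring D q)
    refute-in : ∀ b → length b ≤ length g → b ∣ᴹ g → (F : DiscreteField)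
      (φ : Hom ℚ-ring (DiscreteField.𝔽 F)) →
      let open DiscreteField F in ∀ u → ¬ ev φ (M ℚ-ring b) u ≈ 0#
    refute-in b |b|≤|g| (s , g≋sb) F φ u bu≈0 =
      no-root-of-factor q t f≋tq F φ Hu≈0 b (ℕ.≤-<-trans |b|≤|g| (≡.subst (_< n) (≡.sym |g|) 2|q|<n)) bu≈0
      where
      open DiscreteField F
      module evu = Hom (Evaluation.evHom φ u)
      Hu≈0 : ev φ H u ≈ 0#
      Hu≈0 = trans (evu.cong (P.trans (P.sym g≋H) g≋sb)) (trans (evu.*-homo s (M ℚ-ring b))
        (trans (*-congˡ bu≈0) (zeroʳ _)))
    refute : ¬ (∃[ b ] 0 < length b × length b ≤ length g × b ∣ᴹ g × Irreducible′ b)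
    refute (b , 0<|b| , |b|≤|g| , b∣g , irr) = refute-in b |b|≤|g| b∣g extensionField φ root root-eq
      where open RootExtension (rootExtension {b} 0<|b| irr)

  ¬power⇒irreducible : Irreducible (f n 3≤n d R)
  ¬power⇒irreducible = record
    { p∤1      = monic∤1 (s≤s z≤n) (f-isMonic m d R 3≤n)
    ; split-∣1 = λ {x} {y} f≈xy → split ⟨ f≈xy ⟩ (normalise (whole ℚ-field) (all-whole x))
      (normalise (whole ℚ-field) (all-whole y))
    }
    where
    open Field ℚ-field using (normalise; all-whole; MonicPart; module MonicPart)
    fₙ : Poly
    fₙ = f n 3≤n d R

    f≢0 : ∀ {x y} → fₙ ≋ x *ₚ y → ¬ x ≋ []
    f≢0 {x} {y} f≋xy x≋0 = 1≢0 (≡.trans (≡.sym (proj₁ (f-isMonic m d R 3≤n)))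
      (≡.trans (at f≋xy n) (*-zeroˡ′ x y (at x≋0) n)))

    unit : ∀ {x} (mp : MonicPart (whole ℚ-field) x) → MonicPart.part mp ≡ [] → x ∣ₚ P.1#
    unit {x} record { lead = c ; lead⁻¹ = c′ ; inverse = cc′≡1 ; part = .[] ; equation = x≋ } ≡.refl =
      divides-by const.⟦ c′ ⟧ (at (begin
      const.⟦ c′ ⟧ *ₚ x ≈⟨ P.*-congˡ {const.⟦ c′ ⟧} (P.trans x≋ (P.*-identityʳ const.⟦ c ⟧)) ⟩
      const.⟦ c′ ⟧ *ₚ const.⟦ c ⟧ ≈⟨ P.sym (const.*-homo c′ c) ⟩
      const.⟦ c′ ℚ.* c ⟧ ≈⟨ const.cong (≡.trans (ℚ.*-comm c′ c) cc′≡1) ⟩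
      P.1# ∎))
      where open ≈-Reasoning P.setoid

    module _ {x y : Poly} (f≋xy : fₙ ≋ x *ₚ y) (mx : MonicPart (whole ℚ-field) x)
      (my : MonicPart (whole ℚ-field) y) where
      private
        module X = MonicPart mx
        module Y = MonicPart my
        open ≈-Reasoning P.setoid
        open IntegerSolver polyRing
        a b : ℕ
        a = length X.part
        b = length Y.part
        c c′ : ℚ
        c  = X.lead ℚ.* Y.lead
        c′ = X.lead⁻¹ ℚ.* Y.lead⁻¹
        Mx My : Poly
        Mx = M ℚ-ring X.part
        My = M ℚ-ring Y.part
        cc′≡1 : c′ ℚ.* c ≡ 1ℚ
        cc′≡1 = ≡.trans (ℚS.solve 4 (λ p q r s → (p ℚS.:* q) ℚS.:* (r ℚS.:* s) ℚS.:= (r ℚS.:* p) ℚS.:*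
          (s ℚS.:* q)) ≡.refl X.lead⁻¹ Y.lead⁻¹ X.lead Y.lead)
          (≡.cong₂ ℚ._*_ X.inverse Y.inverse)
          where module ℚS = IntegerSolver ℚ-ring
        f≋ : fₙ ≋ const.⟦ c ⟧ *ₚ (Mx *ₚ My)
        f≋ = begin
          fₙ ≈⟨ P.trans f≋xy (P.*-cong X.equation Y.equation) ⟩
          (const.⟦ X.lead ⟧ *ₚ Mx) *ₚ (const.⟦ Y.lead ⟧ *ₚ My)
            ≈⟨ solve 4 (λ c p d q → (c :* p) :* (d :* q) := (c :* d) :* (p :* q)) P.refl const.⟦ X.lead ⟧ Mx
              const.⟦ Y.lead ⟧ My ⟩
          (const.⟦ X.lead ⟧ *ₚ const.⟦ Y.lead ⟧) *ₚ (Mx *ₚ My)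
            ≈⟨ P.*-congʳ {Mx *ₚ My} (P.sym (const.*-homo X.lead Y.lead)) ⟩
          const.⟦ c ⟧ *ₚ (Mx *ₚ My) ∎
        product≋ : const.⟦ c′ ⟧ *ₚ fₙ ≋ Mx *ₚ My
        product≋ = begin
          const.⟦ c′ ⟧ *ₚ fₙ ≈⟨ P.*-congˡ {const.⟦ c′ ⟧} f≋ ⟩
          const.⟦ c′ ⟧ *ₚ (const.⟦ c ⟧ *ₚ (Mx *ₚ My))
            ≈⟨ P.sym (P.*-assoc const.⟦ c′ ⟧ const.⟦ c ⟧ (Mx *ₚ My)) ⟩
          const.⟦ c′ ⟧ *ₚ const.⟦ c ⟧ *ₚ (Mx *ₚ My)
            ≈⟨ P.*-congʳ {Mx *ₚ My} (P.trans (P.sym (const.*-homo c′ c)) (const.cong cc′≡1)) ⟩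
          P.1# *ₚ (Mx *ₚ My) ≈⟨ P.*-identityˡ (Mx *ₚ My) ⟩
          Mx *ₚ My ∎

      degrees : a ℕ.+ b ≤ n
      degrees = ℕ.≮⇒≥ λ n<a+b → 1≢0 (≡.trans
        (≡.sym (proj₁ (M-*-isMonic ℚ-ring X.part {b} {My} (M-isMonic Y.part))))
        (≡.trans (at (P.sym product≋) (a ℕ.+ b)) (vanish n<a+b)))
        where
        open Monic ℚ-ring using (coeff-∷*)
        vanish : ∀ {i} → n < i → coeff (const.⟦ c′ ⟧ *ₚ fₙ) i ≡ 0ℚ
        vanish {suc i} n<i = ≡.trans (coeff-∷* c′ [] fₙ (suc i))
          (≡.trans (≡.cong (λ z → c′ ℚ.* z ℚ.+ 0ℚ) (proj₂ (f-isMonic m d R 3≤n) n<i))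
          (≡.trans (ℚ.+-identityʳ _) (ℚ.*-zeroʳ c′)))

      multiple-of-x : ∃[ t ] fₙ ≋ t *ₚ Mx
      multiple-of-x = const.⟦ c ⟧ *ₚ My ,
        P.trans f≋ (solve 3 (λ c p q → c :* (p :* q) := c :* q :* p) P.refl const.⟦ c ⟧ Mx My)

      multiple-of-y : ∃[ t ] fₙ ≋ t *ₚ My
      multiple-of-y = const.⟦ c ⟧ *ₚ Mx , P.trans f≋ (P.sym (P.*-assoc const.⟦ c ⟧ Mx My))

      -- n is odd, so one of the two factors has degree below n/2.
      small : 0 < a → 0 < b → ⊥
      small 0<a 0<b with 2 ℕ.* a ℕ.<? n | 2 ℕ.* b ℕ.<? n
      ... | yes 2a<n | _        = no-small-factor X.part 0<a 2a<n (proj₁ multiple-of-x)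
        (proj₂ multiple-of-x)
      ... | _        | yes 2b<n = no-small-factor Y.part 0<b 2b<n (proj₁ multiple-of-y)
        (proj₂ multiple-of-y)
      ... | no n≤2a  | no n≤2b  = ℕ.<⇒≱ (≡.subst (_≤ a ℕ.+ b) 1+m+1+m≡1+n
        (ℕ.+-mono-≤ (half a n≤2a) (half b n≤2b))) degrees
        where
        1+m+1+m≡1+n : suc m ℕ.+ suc m ≡ suc n
        1+m+1+m≡1+n = ≡.cong suc (≡.trans (ℕ.+-suc m m) (≡.cong (λ k → suc (m ℕ.+ k))
          (≡.sym (ℕ.+-identityʳ m))))
        half : ∀ k → ¬ 2 ℕ.* k < n → suc m ≤ k
        half k 2k≮n = ℕ.≰⇒> λ k≤m → 2k≮n (s≤s (ℕ.*-monoʳ-≤ 2 k≤m))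

    split : ∀ {x y} → fₙ ≋ x *ₚ y → x ≋ [] ⊎ MonicPart (whole ℚ-field) x →
      y ≋ [] ⊎ MonicPart (whole ℚ-field) y → x ∣ₚ P.1# ⊎ y ∣ₚ P.1#
    split {x} {y} f≋xy (inj₁ x≋0) _ = ⊥-elim (f≢0 f≋xy x≋0)
    split {x} {y} f≋xy (inj₂ mx) (inj₁ y≋0) = ⊥-elim (f≢0 (P.trans f≋xy (P.*-comm x y)) y≋0)
    split {x} {y} f≋xy (inj₂ mx) (inj₂ my) = cases (MonicPart.part mx) ≡.refl (MonicPart.part my) ≡.refl
      where
      cases : ∀ p → MonicPart.part mx ≡ p → ∀ q → MonicPart.part my ≡ q → x ∣ₚ P.1# ⊎ y ∣ₚ P.1#
      cases []      eq _       _   = inj₁ (unit mx eq)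
      cases (_ ∷ _) _  []      eq  = inj₂ (unit my eq)
      cases (_ ∷ _) eq (_ ∷ _) eq′ = ⊥-elim (small f≋xy mx my
        (≡.subst (λ p → 0 < length p) (≡.sym eq) (s≤s z≤n)) (≡.subst (λ p → 0 < length p) (≡.sym eq′)
        (s≤s z≤n)))

theorem2 : (n : ℕ) (3≤n : 3 ≤ n) → ¬ (2 ∣ n) →
           (d R : ℚ) → d ≢ 0ℚ → (R≠□ : ¬ IsSquare R) →
           Irreducible (f n 3≤n d R)
             ⇔ (∀ p → Prime p → p ∣ n →
                  ¬ (∃[ γ ] γ ^√ p ≡ conjugateRatio d R R≠□))
theorem2 n 3≤n ¬2∣n d R _ R≠□ = main (¬2∣⇒odd ¬2∣n) 3≤n
  where
  main : ∀ {n} → Odd n → (3≤n : 3 ≤ n) →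
         Irreducible (f n 3≤n d R) ⇔ (∀ p → Prime p → p ∣ n → ¬ (∃[ γ ] γ ^√ p ≡ conjugateRatio d R R≠□))
  main (m , ≡.refl) 3≤n = mk⇔ to (¬power⇒irreducible m d R R≠□ 3≤n)
    where
    to : Irreducible (f (1 ℕ.+ 2 ℕ.* m) 3≤n d R) → ∀ p → Prime p → p ∣ 1 ℕ.+ 2 ℕ.* m →
      ¬ (∃[ γ ] γ ^√ p ≡ conjugateRatio d R R≠□)
    to irr p p-prime p∣n@(divides k n≡kp) power = go (¬2∣⇒odd (λ 2∣p → odd⇒¬2∣ m (∣-trans 2∣p p∣n)))
      (¬2∣⇒odd (λ 2∣k → odd⇒¬2∣ m (∣-trans 2∣k (divides p (≡.trans n≡kp (ℕ.*-comm k p))))))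
        n≡kp power (ℕ.nonTrivial⇒n>1 p {{prime⇒nonTrivial p-prime}})
      where
      open Reducible m d R R≠□
      -- Generalising over k and p lets the oddness witnesses be matched by reflexivity, which
      -- supplies l and t with k = 1 + 2l and p = 1 + 2t.
      go : ∀ {k p} → Odd p → Odd k → 1 ℕ.+ 2 ℕ.* m ≡ k ℕ.* p → ∃[ γ ] γ ^√ p ≡ conjugateRatio d R R≠□ →
        1 < p → ⊥
      go (t , ≡.refl) (l , ≡.refl) n≡kp power 1<p = value-exists (rational-value l t n≡kp power)
        where
        value-exists : ¬ (∃[ y ] dickson ℚ-ring ((d ℚ.* d ℚ.- R) ℚ^.^ (1 ℕ.+ 2 ℕ.* l)) y (1 ℕ.+ 2 ℕ.* t) ≡
          (+ 2 ℚ./ 1) ℚ.* d ℚ.* (d ℚ.* d ℚ.- R) ℚ^.^ m)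
        value-exists (y , value) = irreducible⇒¬power 3≤n irr (2 ℕ.* l) (1 ℕ.+ 2 ℕ.* t) 1<p n≡kp y value
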